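{- Let $\mathrm{Pol}:\mathcal{T}^\#\to\mathbb{N}[\mathcal{V}]$ be a multilinear polynomial interpretation. Let $\mathcal{P}=\mathcal{P}_{\ge}\uplus\mathcal{P}_{>}$ be an ADP problem with $\mathcal{P}_{>}\ne\emptyset$ such that: (1) for every $\ell\to\{p_1:r_1,\dots,p_k:r_k\}^m\in\mathcal{P}$: $\mathrm{Pol}(\ell^\#)\ge\sum_{1\le j\le k}p_j\cdot\mathcal{S}um(r_j)$; (2) for every $\ell\to\{p_1:r_1,\dots,p_k:r_k\}^m\in\mathcal{P}_{>}$ there is a $j\in\{1,\dots,k\}$ with $\mathrm{Pol}(\ell^\#)>\mathcal{S}um(r_j)$, and if $m=\mathsf{true}$, then additionally (for this $j$) $\mathrm{Pol}(\ell)\ge\mathrm{Pol}(\flat(r_j))$; (3) for every $\ell\to\{p_1:r_1,\dots,p_k:r_k\}^{\mathsf{true}}\in\mathcal{P}$: $\mathrm{Pol}(\ell)\ge\sum_{1\le j\le k}p_j\cdot\mathrm{Pol}(\flat(r_j))$. Then the processor $\mathrm{Proc}_{\mathtt{RP}}(\mathcal{P})=\{\mathcal{P}_{\ge}\cup\flat(\mathcal{P}_{>})\}$ is sound and complete for $\mathtt{iAST}$ and for $\mathtt{AST}$. That is, $\mathcal{P}$ is $\mathtt{iAST}$ iff $\mathcal{P}_{\ge}\cup\flat(\mathcal{P}_{>})$ is $\mathtt{iAST}$, and $\mathcal{P}$ is $\mathtt{AST}$ iff $\mathcal{P}_{\ge}\cup\flat(\mathcal{P}_{>})$ is $\mathtt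{AST}$.
   Context: **Terms and annotations.** $\Sigma$ is a finite signature, $\mathcal{V}$ a set of variables, $\mathcal{T}=\mathcal{T}(\Sigma,\mathcal{V})$. $\mathcal{D}\subseteq\Sigma$ is the set of defined symbols, i.e., root symbols of left-hand sides of the ADPs under consideration. $\mathrm{Pos}(t)$, $t|_\pi$, $t[r]_\pi$ denote positions, subterm, replacement. A substitution is $\sigma:\mathcal{V}\to\mathcal{T}$ with $\sigma(x)=x$ for all but finitely many $x$. For each $f\in\mathcal{D}$ let $f^\#$ be a fresh symbol of the same arity; $\mathcal{D}^\#=\{f^\#\mid f\in\mathcal{D}\}$, $\Sigma^\#=\Sigma\uplus\mathcal{D}^\#$, $\mathcal{T}^\#=\mathcal{T}(\Sigma^\#,\mathcal{V})$. For $t=f(t_1,\dots,t_n)\in\mathcal{T}$ with $f\in\mathcal{D}$, $t^\#=f^\#(t_1,\dots,t_n)$. $\mathrm{Pos}_X(t)$ is the set of positions of $t$ carrying a symbol or variable from $X$. For $\Phi\subseteq\mathrm{Pos}_{\mathcal{D}\cup\mathcal{D}^\#}(t)$, $\#_\Phi(t)$ is the variant of $t$ where exactly the symbols at positions in $\Phi$ are annotated (all other annotations removed); $\flat(t)=\#_\emptyset(t)$. $\flat^\uparrow_\pi(t)$ results from $t$ by removing all annotations strictly above $\pi$. **Polynomial interpretations.** A polynomial interpretation $\mathrm{Pol}$ maps every $f\in\Sigma^\#$ of arity $n$ to an $n$-ary polynomial $f_{\mathrm{Pol}}$ with coefficients in $\mathbb{N}$, and is extended to terms by $\mathrm{Pol}(x)=x$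 for variables and $\mathrm{Pol}(f(t_1,\dots,t_n))=f_{\mathrm{Pol}}(\mathrm{Pol}(t_1),\dots,\mathrm{Pol}(t_n))$. It is multilinear if all monomials of all $f_{\mathrm{Pol}}(x_1,\dots,x_n)$ have the form $c\cdot x_1^{e_1}\cdots x_n^{e_n}$ with $c\in\mathbb{N}$ and $e_1,\dots,e_n\in\{0,1\}$. Inequations between polynomials hold if they are true for all instantiations of the variables by natural numbers. For $r\in\mathcal{T}^\#$, $\mathcal{S}um(r)=\sum_{\pi\in\mathrm{Pos}_{\mathcal{D}^\#}(r)}\mathrm{Pol}\big((\flat(r|_\pi))^\#\big)$ (the sum over all annotated subterm occurrences of $r$). **ADPs.** An annotated dependency pair (ADP) has the form $\ell\to\{p_1:r_1,\dots,p_k:r_k\}^m$ with $\ell\in\mathcal{T}\setminus\mathcal{V}$, $m\in\{\mathsf{true},\mathsf{false}\}$, $r_j\in\mathcal{T}^\#$, all variables of $r_j$ occurring in $\ell$, probabilities $p_j\in(0,1]$ summing to $1$. An ADP problem is a finite set of ADPs. $\flat(\mathcal{P})$ is $\mathcal{P}$ with all annotations removed from all right-hand sides (flags kept). **Rewriting with ADPs (full).** A variable reposition function (VRF) for an ADP $\ell\to\{p_1:r_1,\dots,p_k:r_k\}^m$ is a family of functions $\varphi_j:\mathrm{Pos}_{\mathcal{V}}(\ell)\to\mathrm{Pos}_{\mathcal{V}}(r_j)\uplus\{\bot\}$, $1\le j\le k$, with $\ell|_\rho=r_j|_{\varphi_j(\rho)}$ whenever $\varphi_j(\rho)\ne\bot$.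 A term $s\in\mathcal{T}^\#$ rewrites with $\mathcal{P}$ to $\{p_1:t_1,\dots,p_k:t_k\}$ (written $s\hookrightarrow_{\mathcal{P}}\{p_1:t_1,\dots,p_k:t_k\}$) if there are an ADP $\ell\to\{p_1:r_1,\dots,p_k:r_k\}^m\in\mathcal{P}$, a VRF $(\varphi_j)_j$ for it, a substitution $\sigma$ and $\pi\in\mathrm{Pos}_{\mathcal{D}\cup\mathcal{D}^\#}(s)$ with $\flat(s|_\pi)=\ell\sigma$, such that for all $j$: - (at) $t_j=s[\#_{\Phi_j}(r_j\sigma)]_\pi$ if $\pi\in\mathrm{Pos}_{\mathcal{D}^\#}(s)$ and $m=\mathsf{true}$; - (af) $t_j=\flat^\uparrow_\pi(s[\#_{\Phi_j}(r_j\sigma)]_\pi)$ if $\pi\in\mathrm{Pos}_{\mathcal{D}^\#}(s)$ and $m=\mathsf{false}$; - (nt) $t_j=s[\#_{\Psi_j}(r_j\sigma)]_\pi$ if $\pi\notin\mathrm{Pos}_{\mathcal{D}^\#}(s)$ and $m=\mathsf{true}$. (There is no step if $\pi\notin\mathrm{Pos}_{\mathcal{D}^\#}(s)$ and $m=\mathsf{false}$.) Here $\Psi_j=\{\varphi_j(\rho).\tau\mid\rho\in\mathrm{Pos}_{\mathcal{V}}(\ell),\ \varphi_j(\rho)\ne\bot,\ \rho.\tau\in\mathrm{Pos}_{\mathcal{D}^\#}(s|_\pi)\}$ and $\Phi_j=\mathrm{Pos}_{\mathcal{D}^\#}(r_j)\cup\Psi_j$. **Innermost rewriting with ADPs.**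 $t\in\mathtt{ANF}_{\mathcal{P}}$ if there is no proper subterm $t'$ of $t$, ADP $\ell\to\mu^m\in\mathcal{P}$ and substitution $\sigma$ with $\ell\sigma=\flat(t')$. A term $s\in\mathcal{T}^\#$ rewrites innermost with $\mathcal{P}$ to $\{p_1:t_1,\dots,p_k:t_k\}$ if there are an ADP $\ell\to\{p_1:r_1,\dots,p_k:r_k\}^m\in\mathcal{P}$, a substitution $\sigma$ and $\pi\in\mathrm{Pos}_{\mathcal{D}\cup\mathcal{D}^\#}(s)$ with $\flat(s|_\pi)=\ell\sigma\in\mathtt{ANF}_{\mathcal{P}}$, such that for all $j$: - (at) $t_j=s[r_j\sigma]_\pi$ if $\pi\in\mathrm{Pos}_{\mathcal{D}^\#}(s)$, $m=\mathsf{true}$; - (af) $t_j=\flat^\uparrow_\pi(s[r_j\sigma]_\pi)$ if $\pi\in\mathrm{Pos}_{\mathcal{D}^\#}(s)$, $m=\mathsf{false}$; - (nt) $t_j=s[\flat(r_j)\sigma]_\pi$ if $\pi\notin\mathrm{Pos}_{\mathcal{D}^\#}(s)$, $m=\mathsf{true}$; - (nf) $t_j=\flat^\uparrow_\pi(s[\flat(r_j)\sigma]_\pi)$ if $\pi\notin\mathrm{Pos}_{\mathcal{D}^\#}(s)$, $m=\mathsf{false}$. **Chain trees, AST, iAST.** A $\mathcal{P}$-chain tree (CT) is $\mathfrak{T}=(V,E,L,A)$ where $(V,E)$ is a non-empty, possibly infinite, finitely branching directed tree; $L$ labels each node $v$ by a probability $p_v\in(0,1]$ and a term $t_v\in\mathcal{T}^\#$,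 with $p_v=1$ for the root; $A$ is a subset of the inner nodes; for each inner node $v$ with successors $w_1,\dots,w_k$, $t_v\hookrightarrow_{\mathcal{P}}\{\frac{p_{w_1}}{p_v}:t_{w_1},\dots,\frac{p_{w_k}}{p_v}:t_{w_k}\}$ using case (at) or (af) if $v\in A$ and another case if $v\notin A$; and every infinite path contains infinitely many nodes from $A$. A $\mathcal{P}$-innermost chain tree (iCT) is defined in the same way with innermost rewriting with $\mathcal{P}$ instead of $\hookrightarrow_{\mathcal{P}}$. $|\mathfrak{T}|_{\mathrm{Leaf}}$ is the sum of $p_v$ over all leaves $v$. $\mathcal{P}$ is $\mathtt{AST}$ (resp. $\mathtt{iAST}$) if $|\mathfrak{T}|_{\mathrm{Leaf}}=1$ for all $\mathcal{P}$-CTs (resp. $\mathcal{P}$-iCTs) $\mathfrak{T}$. **Processors.** A processor maps an ADP problem to a finite set of ADP problems. It is sound for a property if the input has the property whenever all resulting problems have it, and complete if all resulting problems have it whenever the input has it. -}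

module Defs where

open import Algebra.Bundles using (CommutativeRing)
import Algebra.Definitions.RawMonoid as RawMonoidDefinitions
open import Data.Bool.Base using (Bool; true; false; if_then_else_)
open import Data.Fin.Base using (Fin)
open import Data.Fin.Subset using (Subset; _∈_)
open import Data.Fin.Subset.Properties using (_∈?_)
open import Data.List.Base
  using (List; []; _∷_; _++_; map; concatMap; filterᵇ; foldr; length; lookup; applyUpTo; tabulate)
import Data.List.Membership.DecPropositional as DecMembership
open import Data.List.Membership.Propositional using () renaming (_∈_ to _∈ˡ_; _∉_ to _∉ˡ_)
open import Data.List.Properties using (≡-dec)
open import Data.List.Relation.Binary.Pointwise using (Pointwise)
open import Data.List.Relation.Unary.All using (All)
open import Data.Nat.ListAction using (sum)
open import Data.Maybe.Base using (Maybe; just; nothing; maybe′; is-just; _>>=_)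
open import Data.Nat.Base as ℕ using (ℕ; zero; suc)
import Data.Nat.Properties as ℕ
open import Data.Product using (∃; _×_; _,_; proj₁; proj₂)
open import Data.Vec.Base as Vec using (Vec; []; _∷_)
import Data.Vec.Relation.Unary.All as VecAll
open import Function.Base using (_∘_)
open import Function.Bundles using (_⇔_)
open import Level using (Level; _⊔_)
open import Relation.Binary.Core using (Rel)
open import Relation.Binary.PropositionalEquality using (_≡_; _≢_)
open import Relation.Binary.Structures using (IsDecTotalOrder)
import Relation.Binary.Construct.NonStrictToStrict as NonStrictToStrict
open import Relation.Nullary using (¬_; does)
open import Relation.Nullary.Decidable.Core using (dec⇒maybe)

-- The domain of probabilities. The standard library has no real numbers, so
-- everything below is over an arbitrary Archimedean ordered field: ℝ is an
-- instance and, classically, every instance embeds into ℝ.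

record ArchimedeanOrderedField (c ℓ₁ ℓ₂ : Level) : Set (Level.suc (c ⊔ ℓ₁ ⊔ ℓ₂)) where
  field
    commutativeRing : CommutativeRing c ℓ₁

  open CommutativeRing commutativeRing public
    using (Carrier; _≈_; _+_; _*_; _-_; 0#; 1#; +-rawMonoid)

  infix 4 _≤_
  field
    _≤_             : Rel Carrier ℓ₂
    isDecTotalOrder : IsDecTotalOrder _≈_ _≤_
    +-monoʳ-≤       : ∀ z {x y} → x ≤ y → z + x ≤ z + y
    *-nonNegative   : ∀ {x y} → 0# ≤ x → 0# ≤ y → 0# ≤ x * y
    0≉1             : ¬ (0# ≈ 1#)
    inverse         : ∀ x → ¬ (x ≈ 0#) → ∃ λ y → x * y ≈ 1#

  open NonStrictToStrict _≈_ _≤_ public using (_<_)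
  open RawMonoidDefinitions +-rawMonoid using () renaming (_×_ to _×ᴷ_)

  fromℕ : ℕ → Carrier
  fromℕ n = n ×ᴷ 1#

  field
    archimedean : ∀ x → ∃ λ n → x ≤ fromℕ n

  ∑ : List Carrier → Carrier
  ∑ = foldr _+_ 0#

-- Argument indices in positions start at 0.

Position : Set
Position = List ℕ

module _ {A : Set} where

  nth : ∀ {n} → Vec A n → ℕ → Maybe A
  nth []       _       = nothing
  nth (x ∷ _)  zero    = just x
  nth (_ ∷ xs) (suc i) = nth xs i

  modifyNth : ∀ {n} → ℕ → (A → A) → Vec A n → Vec A n
  modifyNth _       g []       = []
  modifyNth zero    g (x ∷ xs) = g x ∷ xs
  modifyNth (suc i) g (x ∷ xs) = x ∷ modifyNth i g xs

data Term {Op : Set} (ar : Op → ℕ) (V : Set) : Set where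
  var : V → Term ar V
  con : (f : Op) → Vec (Term ar V) (ar f) → Term ar V

module _ {Op : Set} {ar : Op → ℕ} {V : Set} where

  mutual
    fold : {A : Set} → (V → A) → ((f : Op) → Vec A (ar f) → A) → Term ar V → A
    fold v c (var x)    = v x
    fold v c (con f ts) = c f (foldAll v c ts)

    foldAll : {A : Set} → (V → A) → ((f : Op) → Vec A (ar f) → A) →
              ∀ {n} → Vec (Term ar V) n → Vec A n
    foldAll v c []       = []
    foldAll v c (t ∷ ts) = fold v c t ∷ foldAll v c ts

  infixl 8 _[_]
  _[_] : Term ar V → (V → Term ar V) → Term ar V
  t [ σ ] = fold σ con t

  isVar : Term ar V → Bool
  isVar (var _)   = true
  isVar (con _ _) = false

  root : Term ar V → Maybe Op
  root (var _)   = nothing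
  root (con f _) = just f

  infix 9 _∣_
  _∣_ : Term ar V → Position → Maybe (Term ar V)
  t        ∣ []      = just t
  var _    ∣ (_ ∷ _) = nothing
  con _ ts ∣ (i ∷ π) = nth ts i >>= (_∣ π)

  -- s [ r ]at π is s[r]_π; it is s itself if π is not a position of s.
  infixl 8 _[_]at_
  _[_]at_ : Term ar V → Term ar V → Position → Term ar V
  s        [ r ]at []      = r
  var x    [ r ]at (_ ∷ _) = var x
  con f ts [ r ]at (i ∷ π) = con f (modifyNth i (_[ r ]at π) ts)

  _occursIn_ : V → Term ar V → Set
  x occursIn t = ∃ λ π → t ∣ π ≡ just (var x)

  -- All pairs (π , t|_π), each position π of t being listed once.
  mutual
    occurrences : Term ar V → List (Position × Term ar V)
    occurrences (var x)    = ([] , var x) ∷ []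
    occurrences (con f ts) = ([] , con f ts) ∷ occurrencesFrom 0 ts

    occurrencesFrom : ∀ {n} → ℕ → Vec (Term ar V) n → List (Position × Term ar V)
    occurrencesFrom i []       = []
    occurrencesFrom i (t ∷ ts) =
      map (λ (π , u) → i ∷ π , u) (occurrences t) ++ occurrencesFrom (ℕ.suc i) ts

  occurrencesWhere : (Term ar V → Bool) → Term ar V → List (Position × Term ar V)
  occurrencesWhere p t = filterᵇ (p ∘ proj₂) (occurrences t)

  positionsWhere : (Term ar V → Bool) → Term ar V → List Position
  positionsWhere p t = map proj₁ (occurrencesWhere p t)

-- An n-ary polynomial with coefficients in ℕ is a list of monomials, each
-- given by its coefficient and its exponents.

Polynomial : ℕ → Set
Polynomial n = List (ℕ × Vec ℕ n)

evalMonomial : ∀ {n} → ℕ × Vec ℕ n → Vec ℕ n → ℕ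
evalMonomial (c , es) xs = c ℕ.* Vec.foldr′ ℕ._*_ 1 (Vec.zipWith ℕ._^_ xs es)

evalPolynomial : ∀ {n} → Polynomial n → Vec ℕ n → ℕ
evalPolynomial p xs = sum (map (λ m → evalMonomial m xs) p)

MultilinearPolynomial : ∀ {n} → Polynomial n → Set
MultilinearPolynomial = All (VecAll.All (ℕ._≤ 1) ∘ proj₂)

record Signature : Set where
  field
    size  : ℕ
    arity : Fin size → ℕ

module ADPFramework {c ℓ₁ ℓ₂ : Level}
  (K : ArchimedeanOrderedField c ℓ₁ ℓ₂)
  (Sig : Signature)
  (V : Set)
  (D : Subset (Signature.size Sig))
  where

  open ArchimedeanOrderedField K
  open Signature Sig

  Symbol : Set
  Symbol = Fin size

  T : Set
  T = Term arity V

  -- (f , nothing) is the symbol f itself, (f , just _) is f♯.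
  Symbol♯ : Set
  Symbol♯ = ∃ λ f → Maybe (f ∈ D)

  arity♯ : Symbol♯ → ℕ
  arity♯ = arity ∘ proj₁

  T♯ : Set
  T♯ = Term arity♯ V

  ⌈_⌉ : T → T♯
  ⌈_⌉ = fold var (λ f → con (f , nothing))

  ♭ : T♯ → T
  ♭ = fold var (λ f → con (proj₁ f))

  isAnnotated : T♯ → Bool
  isAnnotated (var _)         = false
  isAnnotated (con (_ , m) _) = is-just m

  isDefined : T♯ → Bool
  isDefined (var _)         = false
  isDefined (con (f , _) _) = does (f ∈? D)

  variablePositions : T → List Position
  variablePositions = positionsWhere isVar

  annotatedPositions : T♯ → List Position
  annotatedPositions = positionsWhere isAnnotated

  annotateSymbol : Bool → Symbol♯ → Symbol♯
  annotateSymbol b (f , _) = f , (if b then dec⇒maybe (f ∈? D) else nothing)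

  mutual
    annotate : (Position → Bool) → T♯ → T♯
    annotate Φ (var x)    = var x
    annotate Φ (con f ts) = con (annotateSymbol (Φ []) f) (annotateFrom 0 Φ ts)

    annotateFrom : ∀ {n} → ℕ → (Position → Bool) → Vec T♯ n → Vec T♯ n
    annotateFrom i Φ []       = []
    annotateFrom i Φ (t ∷ ts) = annotate (Φ ∘ (i ∷_)) t ∷ annotateFrom (ℕ.suc i) Φ ts

  -- #_Φ(t), for a finite set Φ of positions given as a list.
  #[_] : List Position → T♯ → T♯
  #[ Φ ] = annotate (λ π → does (π ∈ᵖ? Φ))
    where open DecMembership (≡-dec ℕ._≟_) using () renaming (_∈?_ to _∈ᵖ?_)

  -- t♯ annotates the root of t; it is only used when that root lies in D.
  infix 9 _♯
  _♯ : T → T♯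
  t ♯ = #[ [] ∷ [] ] ⌈ t ⌉

  -- ♭↑ π t removes the annotations strictly above π.
  ♭↑ : Position → T♯ → T♯
  ♭↑ []      t                = t
  ♭↑ (_ ∷ _) (var x)          = var x
  ♭↑ (i ∷ π) (con (f , _) ts) = con (f , nothing) (modifyNth i (♭↑ π) ts)

  record Substitution : Set where
    field
      apply  : V → T
      finite : ∃ λ (xs : List V) → ∀ x → x ∉ˡ xs → apply x ≡ var x

  open Substitution public

  infixl 8 _⟨_⟩ _⟨_⟩♯
  _⟨_⟩ : T → Substitution → T
  t ⟨ σ ⟩ = t [ apply σ ]

  _⟨_⟩♯ : T♯ → Substitution → T♯
  r ⟨ σ ⟩♯ = r [ ⌈_⌉ ∘ apply σ ]

  -- Elements of ℕ[V] only occur in inequations, which quantify over all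
  -- valuations of the variables, so Pol(t) is given by its values.

  PolynomialInterpretation : Set
  PolynomialInterpretation = (f : Symbol♯) → Polynomial (arity♯ f)

  Multilinear : PolynomialInterpretation → Set
  Multilinear Pol = ∀ f → MultilinearPolynomial (Pol f)

  Valuation : Set
  Valuation = V → ℕ

  value : PolynomialInterpretation → T♯ → Valuation → ℕ
  value Pol t x = fold x (λ f → evalPolynomial (Pol f)) t

  Sum : PolynomialInterpretation → T♯ → Valuation → ℕ
  Sum Pol r x =
    sum (map (λ (_ , u) → value Pol (♭ u ♯) x) (occurrencesWhere isAnnotated r))

  MultiDistribution : Set → Set c
  MultiDistribution A = List (Carrier × A)

  record ADP : Set c where
    field
      lhs  : T
      rhs  : MultiDistribution T♯
      flag : Bool

    Outcome : Set
    Outcome = Fin (length rhs)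

    p : Outcome → Carrier
    p j = proj₁ (lookup rhs j)

    r : Outcome → T♯
    r j = proj₂ (lookup rhs j)

    distribution : (Outcome → T♯) → MultiDistribution T♯
    distribution t = tabulate (λ j → p j , t j)

    expectation : (T♯ → ℕ) → Carrier
    expectation h = ∑ (tabulate (λ j → p j * fromℕ (h (r j))))

  open ADP public

  record IsADP (α : ADP) : Set (c ⊔ ℓ₁ ⊔ ℓ₂) where
    field
      lhs-nonVariable : isVar (lhs α) ≡ false
      p-positive      : ∀ j → 0# < p α j
      p-≤1            : ∀ j → p α j ≤ 1#
      p-sum           : ∑ (tabulate (p α)) ≈ 1#
      r-variables     : ∀ j x → x occursIn r α j → x occursIn lhs α

  -- A finite set of ADPs as a list; order and repetitions play no role.
  ADPProblem : Set c
  ADPProblem = List ADP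

  IsADPProblem : ADPProblem → Set (c ⊔ ℓ₁ ⊔ ℓ₂)
  IsADPProblem = All IsADP

  DefinedSymbolsOf : ADPProblem → Set c
  DefinedSymbolsOf P = ∀ f → (f ∈ D) ⇔ (∃ λ α → α ∈ˡ P × root (lhs α) ≡ just f)

  ♭ᴬ : ADP → ADP
  ♭ᴬ α = record
    { lhs  = lhs α
    ; rhs  = map (λ (q , t) → q , ⌈ ♭ t ⌉) (rhs α)
    ; flag = flag α
    }

  ♭ᴾ : ADPProblem → ADPProblem
  ♭ᴾ = map ♭ᴬ

  -- The values of φ j outside the variable positions of the left-hand side
  -- are never used.
  Repositioning : ADP → Set
  Repositioning α = Outcome α → Position → Maybe Position

  IsVRF : (α : ADP) → Repositioning α → Set
  IsVRF α φ = ∀ j ρ ρ′ → ρ ∈ˡ variablePositions (lhs α) → φ j ρ ≡ just ρ′ →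
    ∃ λ x → lhs α ∣ ρ ≡ just (var x) × r α j ∣ ρ′ ≡ just (var x)

  -- Ψ ℓ φ u = { φ(ρ).τ ∣ ρ ∈ Pos_V(ℓ), φ(ρ) ≠ ⊥, τ ∈ Pos_D♯(u|_ρ) }
  Ψ : T → (Position → Maybe Position) → T♯ → List Position
  Ψ ℓ φ u = concatMap
    (λ ρ → maybe′ (λ ρ′ → map (ρ′ ++_) (maybe′ annotatedPositions [] (u ∣ ρ))) [] (φ ρ))
    (variablePositions ℓ)

  Φ : T → T♯ → (Position → Maybe Position) → T♯ → List Position
  Φ ℓ r φ u = annotatedPositions r ++ Ψ ℓ φ u

  ANF : ADPProblem → T → Set c
  ANF P t = ∀ π t′ → π ≢ [] → t ∣ π ≡ just t′ →
    ∀ α → α ∈ˡ P → ∀ (σ : Substitution) → lhs α ⟨ σ ⟩ ≢ t′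

  record Redex (P : ADPProblem) (s : T♯) : Set c where
    field
      α         : ADP
      α∈P       : α ∈ˡ P
      σ         : Substitution
      π         : Position
      u         : T♯
      s∣π       : s ∣ π ≡ just u
      u-defined : isDefined u ≡ true
      matches   : ♭ u ≡ lhs α ⟨ σ ⟩

  -- In both relations below, the Boolean index is true for the steps
  -- (at) and (af), i.e. those at an annotated position.

  infix 4 _⊢_↪[_]_ _⊢_↪ⁱ[_]_

  data _⊢_↪[_]_ (P : ADPProblem) (s : T♯) : Bool → MultiDistribution T♯ → Set c where
    at : (R : Redex P s) → let open Redex R in
         (φ : Repositioning α) → IsVRF α φ →
         isAnnotated u ≡ true → flag α ≡ true →
         P ⊢ s ↪[ true ] distribution α λ j →
           s [ #[ Φ (lhs α) (r α j) (φ j) u ] (r α j ⟨ σ ⟩♯) ]at π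
    af : (R : Redex P s) → let open Redex R in
         (φ : Repositioning α) → IsVRF α φ →
         isAnnotated u ≡ true → flag α ≡ false →
         P ⊢ s ↪[ true ] distribution α λ j →
           ♭↑ π (s [ #[ Φ (lhs α) (r α j) (φ j) u ] (r α j ⟨ σ ⟩♯) ]at π)
    nt : (R : Redex P s) → let open Redex R in
         (φ : Repositioning α) → IsVRF α φ →
         isAnnotated u ≡ false → flag α ≡ true →
         P ⊢ s ↪[ false ] distribution α λ j →
           s [ #[ Ψ (lhs α) (φ j) u ] (r α j ⟨ σ ⟩♯) ]at π

  data _⊢_↪ⁱ[_]_ (P : ADPProblem) (s : T♯) : Bool → MultiDistribution T♯ → Set c where
    at : (R : Redex P s) → let open Redex R in
         ANF P (lhs α ⟨ σ ⟩) →
         isAnnotated u ≡ true → flag α ≡ true →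
         P ⊢ s ↪ⁱ[ true ] distribution α λ j →
           s [ r α j ⟨ σ ⟩♯ ]at π
    af : (R : Redex P s) → let open Redex R in
         ANF P (lhs α ⟨ σ ⟩) →
         isAnnotated u ≡ true → flag α ≡ false →
         P ⊢ s ↪ⁱ[ true ] distribution α λ j →
           ♭↑ π (s [ r α j ⟨ σ ⟩♯ ]at π)
    nt : (R : Redex P s) → let open Redex R in
         ANF P (lhs α ⟨ σ ⟩) →
         isAnnotated u ≡ false → flag α ≡ true →
         P ⊢ s ↪ⁱ[ false ] distribution α λ j →
           s [ ⌈ ♭ (r α j) ⌉ ⟨ σ ⟩♯ ]at π
    nf : (R : Redex P s) → let open Redex R in
         ANF P (lhs α ⟨ σ ⟩) →
         isAnnotated u ≡ false → flag α ≡ false →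
         P ⊢ s ↪ⁱ[ false ] distribution α λ j →
           ♭↑ π (s [ ⌈ ♭ (r α j) ⌉ ⟨ σ ⟩♯ ]at π)

  -- Finitely branching trees, presented by the out-degree of each node.
  -- A node is addressed by the path leading to it, last choice first: the
  -- i-th child of v is i ∷ v. Only the addresses in Node v are nodes.

  Address : Set
  Address = List ℕ

  module _ (deg : Address → ℕ) where

    data Node : Address → Set where
      root-node  : Node []
      child-node : ∀ {v i} → Node v → i ℕ.< deg v → Node (i ∷ v)

    children : Address → List Address
    children v = applyUpTo (_∷ v) (deg v)

    record IsInfinitePath (path : ℕ → Address) : Set where
      field
        start : Node (path 0)
        next  : ∀ n → path (ℕ.suc n) ∈ˡ children (path n)

    -- The leaves that lie at most n levels below v.
    leavesWithin : ℕ → Address → List Address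
    leavesWithin n v with deg v
    leavesWithin n          v | zero    = v ∷ []
    leavesWithin zero       v | ℕ.suc _ = []
    leavesWithin (ℕ.suc n)  v | ℕ.suc _ = concatMap (leavesWithin n) (children v)

  -- Siblings are numbered in the order of the multi-distribution μ reached by
  -- the step, and p_w / p_v = q is stated as p_w = p_v * q.

  record ChainTree (_↪[_]_ : T♯ → Bool → MultiDistribution T♯ → Set c) :
                   Set (c ⊔ ℓ₁ ⊔ ℓ₂) where
    field
      deg  : Address → ℕ
      prob : Address → Carrier
      term : Address → T♯
      A    : Address → Bool

      prob-root     : prob [] ≈ 1#
      prob-positive : ∀ {v} → Node deg v → 0# < prob v
      prob-≤1       : ∀ {v} → Node deg v → prob v ≤ 1#
      A-inner       : ∀ {v} → Node deg v → A v ≡ true → deg v ≢ 0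
      step          : ∀ {v} → Node deg v → deg v ≢ 0 →
                      ∃ λ μ → term v ↪[ A v ] μ ×
                        Pointwise (λ (q , t) w → prob w ≈ prob v * q × term w ≡ t)
                                  μ (children deg v)
      A-infinite    : ∀ path → IsInfinitePath deg path →
                      ∀ n → ∃ λ m → n ℕ.≤ m × A (path m) ≡ true

    leafProbWithin : ℕ → Carrier
    leafProbWithin n = ∑ (map prob (leavesWithin deg n []))

  infix 4 _⟶_
  _⟶_ : (ℕ → Carrier) → Carrier → Set (c ⊔ ℓ₁ ⊔ ℓ₂)
  a ⟶ l = ∀ ε → 0# < ε → ∃ λ N → ∀ n → N ℕ.≤ n → (l - ε < a n) × (a n < l + ε)

  -- |𝔗|_Leaf = p: the series over all leaves, grouped by depth, converges to p.
  LeafProbability : ∀ {_↪[_]_} → ChainTree _↪[_]_ → Carrier → Set (c ⊔ ℓ₁ ⊔ ℓ₂)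
  LeafProbability 𝔗 q = ChainTree.leafProbWithin 𝔗 ⟶ q

  AST : ADPProblem → Set (c ⊔ ℓ₁ ⊔ ℓ₂)
  AST P = (𝔗 : ChainTree (P ⊢_↪[_]_)) → LeafProbability 𝔗 1#

  iAST : ADPProblem → Set (c ⊔ ℓ₁ ⊔ ℓ₂)
  iAST P = (𝔗 : ChainTree (P ⊢_↪ⁱ[_]_)) → LeafProbability 𝔗 1#

  -- Soundness and completeness of a processor that maps P to Qs.

  Sound : ∀ {ℓ} → (ADPProblem → Set ℓ) → ADPProblem → List ADPProblem → Set (c ⊔ ℓ)
  Sound Property P Qs = All Property Qs → Property P

  Complete : ∀ {ℓ} → (ADPProblem → Set ℓ) → ADPProblem → List ADPProblem → Set (c ⊔ ℓ)
  Complete Property P Qs = Property P → All Property Qs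

  Proc-RP : (P≥ P> : ADPProblem) → List ADPProblem
  Proc-RP P≥ P> = (P≥ ++ ♭ᴾ P>) ∷ []

module Submission where

-- Completeness: a chain tree of the new problem is simulated by one of P with at least as many
-- annotations, node by node.
--
-- Soundness: let X(t) be the value of Sum Pol t at a fixed valuation. By multilinearity X is a
-- supermartingale along every chain tree of P, and at an annotated step with an ADP of P> it
-- drops by at least 1 with probability at least q₀ > 0. Cutting the tree at these strict steps
-- leaves chain trees of the new problem, which terminate almost surely; so it suffices that
-- passing many strict steps is unlikely. This follows from the potential
--   c · (number of strict steps passed) + a · X + b · u(X),   u(x) = M² ∸ (M ∸ x)²,
-- where u is bounded, concave, and strictly concave up to M: the potential is a supermartingale
-- while X ≤ M, and it is at least 1 once M ≤ X or once enough strict steps have been passed.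
-- For suitable M and small a, b, c = b q₀ its initial value is arbitrarily small.

open import Defs
open import Algebra.Bundles using (CommutativeRing)
import Algebra.Properties.Semiring.Mult as SemiringMult
import Algebra.Solver.Ring.NaturalCoefficients.Default as SemiringSolver
open import Data.Bool.Base using (Bool; true; false; if_then_else_)
open import Data.Empty using (⊥-elim)
open import Data.Fin.Base using (Fin; zero; suc; cast)
open import Data.Fin.Properties using (cast-is-id; cast-involutive)
open import Data.Fin.Subset using (Subset)
open import Data.List.Base using (List; []; _∷_; _++_; map; tabulate; concatMap; filterᵇ; applyUpTo; length; lookup)
import Data.List.Membership.DecPropositional as DecMembership
open import Data.List.Membership.Propositional using (_∈_)
import Data.List.Membership.Propositional.Properties as ∈
import Data.List.Properties as List
open import Data.List.Relation.Binary.Disjoint.Propositional using (Disjoint)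
open import Data.List.Relation.Binary.Pointwise using (Pointwise; []; _∷_)
import Data.List.Relation.Binary.Pointwise as Pointwise
open import Data.List.Relation.Binary.Subset.Propositional using (_⊆_)
import Data.List.Relation.Binary.Subset.Propositional.Properties as ⊆
open import Data.List.Relation.Unary.All as All using (All; []; _∷_)
import Data.List.Relation.Unary.All.Properties as All
open import Data.List.Relation.Unary.Any as Any using (Any; here; there)
import Data.List.Relation.Unary.Any.Properties as Any
open import Data.Maybe.Base as Maybe using (Maybe; just; nothing; maybe′; is-just; _>>=_)
open import Data.Maybe.Properties using (just-injective)
open import Data.Nat.Base as ℕ using (ℕ; zero; suc; _≥_; _>_)
open import Data.Nat.ListAction using (sum)
open import Data.Nat.ListAction.Properties using (sum-++)
import Data.Nat.Properties as ℕ
open import Data.Nat.Solver using (module +-*-Solver)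
open import Data.Product using (∃; _×_; _,_; proj₁; proj₂)
open import Data.Sum.Base using (_⊎_; inj₁; inj₂)
open import Data.Vec.Base as Vec using (Vec; []; _∷_)
import Data.Vec.Relation.Unary.All as VecAll
open import Function.Base using (_∘_; const; id)
open import Level using (Level; _⊔_)
open import Relation.Binary.Bundles using (Poset)
import Relation.Binary.Construct.NonStrictToStrict as NonStrictToStrict
open import Relation.Binary.PropositionalEquality as ≡ using (_≡_; _≢_)
import Relation.Binary.Reasoning.PartialOrder as PartialOrderReasoning
open import Relation.Binary.Structures using (IsDecTotalOrder)
open import Relation.Nullary using (Dec; yes; no; does; contradiction)
open import Relation.Nullary.Decidable using (map′; _×-dec_; ¬?; dec-true)

-- Ordered fields

-- The obstacle is that a strict step need not lower the mean of `X`: like a fair random walk, `X`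
-- may rise on the other outcomes, so no potential linear in `X` can count strict steps. Strict
-- concavity turns such fluctuation into a definite loss, but a loss bounded away from zero is
-- possible only on a bounded range; hence the cap at `M`. The term `a · X` prices the escape from
-- that range, as in Markov's inequality.
--
-- No measure on infinite paths is used: every claim concerns the leaf mass found within some finite
-- depth. A cut tree then terminates only up to a share `η`, which is harmless because only a fixed
-- number `k` of strict steps has to be followed. The constants are chosen in the order `a`, `M`,
-- `b`, `k`, `η`, each depending on earlier ones.
--
-- Unannotated steps with ADPs of `P>` need no cut: they do not introduce the annotations of the
-- right-hand side, so they are steps of the new problem too. In the completeness direction the
-- terms of a tree cannot be kept: an erased ADP replaced by its original adds annotations that
-- persist, and later steps may become annotated ones.

module OrderedFieldProperties {c ℓ₁ ℓ₂ : Level} (K : ArchimedeanOrderedField c ℓ₁ ℓ₂) where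

  open ArchimedeanOrderedField K public
  open CommutativeRing commutativeRing public
    using (commutativeSemiring; semiring; +-cong; +-congˡ; +-congʳ; *-congˡ; *-congʳ;
           +-assoc; +-comm; +-identityˡ; +-identityʳ; *-assoc; *-comm; *-identityˡ; *-identityʳ;
           zeroˡ; zeroʳ; distribˡ; -‿inverseˡ; -‿inverseʳ; -_; refl; sym; trans; reflexive)
  open SemiringSolver commutativeSemiring public using (solve; _:=_; _:+_; _:*_; con)
  open IsDecTotalOrder isDecTotalOrder public
    using (total; antisym; isPartialOrder; ≤-respˡ-≈; ≤-respʳ-≈)
    renaming (refl to ≤-refl; trans to ≤-trans; reflexive to ≤-reflexive)

  ≤-poset : Poset c ℓ₁ ℓ₂
  ≤-poset = record { isPartialOrder = isPartialOrder }

  module ≤-Reasoning = PartialOrderReasoning ≤-poset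

  <⇒≤ : ∀ {x y} → x < y → x ≤ y
  <⇒≤ = proj₁

  <-≤-trans : ∀ {x y z} → x < y → y ≤ z → x < z
  <-≤-trans = NonStrictToStrict.<-≤-trans _≈_ _≤_ sym ≤-trans antisym ≤-respʳ-≈

  ≤-<-trans : ∀ {x y z} → x ≤ y → y < z → x < z
  ≤-<-trans = NonStrictToStrict.≤-<-trans _≈_ _≤_ ≤-trans antisym ≤-respˡ-≈

  +-mono-≤ : ∀ {w x y z} → w ≤ x → y ≤ z → w + y ≤ x + z
  +-mono-≤ {w} {x} {y} {z} w≤x y≤z = begin
    w + y  ≤⟨ +-monoʳ-≤ w y≤z ⟩
    w + z  ≈⟨ +-comm w z ⟩
    z + w  ≤⟨ +-monoʳ-≤ z w≤x ⟩
    z + x  ≈⟨ +-comm z x ⟩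
    x + z  ∎
    where open ≤-Reasoning

  +-monoˡ-≤ : ∀ z {x y} → x ≤ y → x + z ≤ y + z
  +-monoˡ-≤ z x≤y = +-mono-≤ x≤y ≤-refl

  -x+[x+y]≈y : ∀ x y → - x + (x + y) ≈ y
  -x+[x+y]≈y x y = trans (sym (+-assoc (- x) x y)) (trans (+-congʳ (-‿inverseˡ x)) (+-identityˡ y))

  +-cancelˡ-≤ : ∀ z {x y} → z + x ≤ z + y → x ≤ y
  +-cancelˡ-≤ z {x} {y} h = begin
    x              ≈⟨ -x+[x+y]≈y z x ⟨
    - z + (z + x)  ≤⟨ +-monoʳ-≤ (- z) h ⟩
    - z + (z + y)  ≈⟨ -x+[x+y]≈y z y ⟩
    y              ∎
    where open ≤-Reasoning

  +-cancelʳ-≤ : ∀ z {x y} → x + z ≤ y + z → x ≤ y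
  +-cancelʳ-≤ z {x} {y} h = +-cancelˡ-≤ z (≤-respˡ-≈ (+-comm x z) (≤-respʳ-≈ (+-comm y z) h))

  x≤x+y : ∀ x {y} → 0# ≤ y → x ≤ x + y
  x≤x+y x 0≤y = ≤-respˡ-≈ (+-identityʳ x) (+-monoʳ-≤ x 0≤y)

  +-nonNegative : ∀ {x y} → 0# ≤ x → 0# ≤ y → 0# ≤ x + y
  +-nonNegative 0≤x 0≤y = ≤-trans 0≤x (x≤x+y _ 0≤y)

  *-monoˡ-≤ : ∀ {z x y} → 0# ≤ z → x ≤ y → z * x ≤ z * y
  *-monoˡ-≤ {z} {x} {y} 0≤z x≤y = begin
    z * x                  ≤⟨ x≤x+y _ (*-nonNegative 0≤z 0≤y-x) ⟩
    z * x + z * (- x + y)  ≈⟨ distribˡ z x (- x + y) ⟨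
    z * (x + (- x + y))    ≈⟨ *-congˡ (trans (sym (+-assoc x (- x) y))
                                (trans (+-congʳ (-‿inverseʳ x)) (+-identityˡ y))) ⟩
    z * y                  ∎
    where
    open ≤-Reasoning
    0≤y-x : 0# ≤ - x + y
    0≤y-x = ≤-respˡ-≈ (-‿inverseˡ x) (+-monoʳ-≤ (- x) x≤y)

  *-monoʳ-≤ : ∀ {z x y} → 0# ≤ z → x ≤ y → x * z ≤ y * z
  *-monoʳ-≤ {z} {x} {y} 0≤z x≤y = begin
    x * z  ≈⟨ *-comm x z ⟩
    z * x  ≤⟨ *-monoˡ-≤ 0≤z x≤y ⟩
    z * y  ≈⟨ *-comm z y ⟩
    y * z  ∎
    where open ≤-Reasoning

  x≤0⇒0≤-x : ∀ {x} → x ≤ 0# → 0# ≤ - x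
  x≤0⇒0≤-x {x} x≤0 = ≤-respˡ-≈ (-‿inverseˡ x) (≤-respʳ-≈ (+-identityʳ (- x)) (+-monoʳ-≤ (- x) x≤0))

  +-swapʳ : ∀ x y z → x + y + z ≈ x + z + y
  +-swapʳ = solve 3 (λ a b c → a :+ b :+ c := a :+ c :+ b) refl

  *-swapʳ : ∀ x y z → x * y * z ≈ x * z * y
  *-swapʳ = solve 3 (λ a b c → a :* b :* c := a :* c :* b) refl

  x-y≤z⇒x≤z+y : ∀ {x y z} → x - y ≤ z → x ≤ z + y
  x-y≤z⇒x≤z+y {x} {y} {z} h = ≤-respˡ-≈
    (trans (+-assoc x (- y) y) (trans (+-congˡ (-‿inverseˡ y)) (+-identityʳ x))) (+-monoˡ-≤ y h)

  x≤z+y⇒x-y≤z : ∀ {x y z} → x ≤ z + y → x - y ≤ z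
  x≤z+y⇒x-y≤z {x} {y} {z} h = ≤-respʳ-≈
    (trans (+-assoc z y (- y)) (trans (+-congˡ (-‿inverseʳ y)) (+-identityʳ z))) (+-monoˡ-≤ (- y) h)

  x<x+y : ∀ x {y} → 0# < y → x < x + y
  x<x+y x {y} (0≤y , 0≉y) = x≤x+y x 0≤y , λ x≈x+y →
    0≉y (antisym 0≤y (+-cancelˡ-≤ x (≤-reflexive (trans (sym x≈x+y) (sym (+-identityʳ x))))))

  -- Otherwise `- 1#` is nonnegative, hence so is its square, and
  -- `- 1# ≤ - 1# + (- 1# * - 1#) ≈ 0#`, which is the claim shifted by `- 1#`.
  0≤1 : 0# ≤ 1#
  0≤1 with total 0# 1#
  ... | inj₁ h = h
  ... | inj₂ 1≤0 = +-cancelˡ-≤ (- 1#) (≤-respˡ-≈ (sym (+-identityʳ (- 1#)))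
    (≤-respʳ-≈ (sym (-‿inverseˡ 1#)) (≤-trans (≤-reflexive eq) (≤-trans lt (≤-reflexive eq′)))))
    where
    eq : - 1# ≈ - 1# + 0#
    eq = sym (+-identityʳ _)
    lt : - 1# + 0# ≤ - 1# + (- 1# * - 1#)
    lt = +-monoʳ-≤ (- 1#) (*-nonNegative (x≤0⇒0≤-x 1≤0) (x≤0⇒0≤-x 1≤0))
    eq′ : - 1# + (- 1# * - 1#) ≈ 0#
    eq′ = trans (+-cong (sym (*-identityʳ (- 1#))) refl)
      (trans (sym (distribˡ (- 1#) 1# (- 1#))) (trans (*-congˡ (-‿inverseʳ 1#)) (zeroʳ _)))

  0<1 : 0# < 1#
  0<1 = 0≤1 , 0≉1

  *-positive : ∀ {x y} → 0# < x → 0# < y → 0# < x * y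
  *-positive {x} {y} (0≤x , 0≉x) (0≤y , 0≉y) = *-nonNegative 0≤x 0≤y , λ 0≈xy →
    let x⁻¹ , xx⁻¹≈1 = inverse x (0≉x ∘ sym) in
    0≉y (begin
      0#             ≈⟨ zeroʳ x⁻¹ ⟨
      x⁻¹ * 0#       ≈⟨ *-congˡ 0≈xy ⟩
      x⁻¹ * (x * y)  ≈⟨ solve 3 (λ a b c → a :* (b :* c) := b :* a :* c) refl x⁻¹ x y ⟩
      x * x⁻¹ * y    ≈⟨ *-congʳ xx⁻¹≈1 ⟩
      1# * y         ≈⟨ *-identityˡ y ⟩
      y              ∎)
    where open import Relation.Binary.Reasoning.Setoid (CommutativeRing.setoid commutativeRing)

  positive-inverse : ∀ {x} → 0# < x → ∃ λ y → 0# < y × x * y ≈ 1#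
  positive-inverse {x} (0≤x , 0≉x) with inverse x (0≉x ∘ sym)
  ... | y , xy≈1 with total 0# y
  ...   | inj₁ 0≤y = y , (0≤y , λ 0≈y → 0≉1 (trans (sym (zeroʳ x)) (trans (*-congˡ 0≈y) xy≈1))) , xy≈1
  ...   | inj₂ y≤0 = ⊥-elim (0≉1 (antisym 0≤1 (≤-respˡ-≈ xy≈1 (≤-respʳ-≈ (zeroʳ x) (*-monoˡ-≤ 0≤x y≤0)))))

  fromℕ-nonNegative : ∀ n → 0# ≤ fromℕ n
  fromℕ-nonNegative zero    = ≤-refl
  fromℕ-nonNegative (suc n) = +-nonNegative 0≤1 (fromℕ-nonNegative n)

  fromℕ-mono-≤ : ∀ {m n} → m ℕ.≤ n → fromℕ m ≤ fromℕ n
  fromℕ-mono-≤ {n = n} ℕ.z≤n = fromℕ-nonNegative n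
  fromℕ-mono-≤ (ℕ.s≤s m≤n)   = +-monoʳ-≤ 1# (fromℕ-mono-≤ m≤n)

  fromℕ-+ : ∀ m n → fromℕ (m ℕ.+ n) ≈ fromℕ m + fromℕ n
  fromℕ-+ = SemiringMult.×-homo-+ semiring 1#

  fromℕ-* : ∀ m n → fromℕ (m ℕ.* n) ≈ fromℕ m * fromℕ n
  fromℕ-* = SemiringMult.×1-homo-* semiring

  fromℕ-positive : ∀ n → 0# < fromℕ (suc n)
  fromℕ-positive n = <-≤-trans 0<1 (x≤x+y 1# (fromℕ-nonNegative n))

  -- Dividing by `suc n` instead of `n` covers `n = 0` without a case split.
  fraction : ∀ {ε} → 0# < ε → ∀ n → ∃ λ δ → 0# < δ × fromℕ n * δ ≤ ε
  fraction {ε} 0<ε n =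
    let n⁻¹ , 0<n⁻¹ , nn⁻¹≈1 = positive-inverse (fromℕ-positive n) in
    ε * n⁻¹ , *-positive 0<ε 0<n⁻¹ , (begin
      fromℕ n * (ε * n⁻¹)        ≤⟨ *-monoʳ-≤ (<⇒≤ (*-positive 0<ε 0<n⁻¹)) (fromℕ-mono-≤ (ℕ.n≤1+n n)) ⟩
      fromℕ (suc n) * (ε * n⁻¹)  ≈⟨ solve 3 (λ a b c → a :* (b :* c) := b :* (a :* c)) refl _ ε n⁻¹ ⟩
      ε * (fromℕ (suc n) * n⁻¹)  ≈⟨ *-congˡ nn⁻¹≈1 ⟩
      ε * 1#                     ≈⟨ *-identityʳ ε ⟩
      ε                          ∎)
    where open ≤-Reasoning

  multiple≥1 : ∀ {ε} → 0# < ε → ∃ λ n → 1# ≤ ε * fromℕ n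
  multiple≥1 {ε} 0<ε =
    let ε⁻¹ , _ , εε⁻¹≈1 = positive-inverse 0<ε
        n , ε⁻¹≤n        = archimedean ε⁻¹
    in n , ≤-respˡ-≈ εε⁻¹≈1 (*-monoˡ-≤ (<⇒≤ 0<ε) ε⁻¹≤n)

  ∑-cong : ∀ {a} {A : Set a} (f g : A → Carrier) → (∀ x → f x ≈ g x) → ∀ xs → ∑ (map f xs) ≈ ∑ (map g xs)
  ∑-cong f g f≈g []       = refl
  ∑-cong f g f≈g (x ∷ xs) = +-cong (f≈g x) (∑-cong f g f≈g xs)

  ∑-+ : ∀ {a} {A : Set a} (f g : A → Carrier) xs →
        ∑ (map (λ x → f x + g x) xs) ≈ ∑ (map f xs) + ∑ (map g xs)
  ∑-+ f g []       = sym (+-identityˡ 0#)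
  ∑-+ f g (x ∷ xs) = trans (+-congˡ (∑-+ f g xs))
    (solve 4 (λ a b c d → (a :+ b) :+ (c :+ d) := (a :+ c) :+ (b :+ d)) refl _ _ _ _)

  ∑-*ˡ : ∀ {a} {A : Set a} k (f : A → Carrier) xs → ∑ (map (λ x → k * f x) xs) ≈ k * ∑ (map f xs)
  ∑-*ˡ k f []       = sym (zeroʳ k)
  ∑-*ˡ k f (x ∷ xs) = trans (+-congˡ (∑-*ˡ k f xs)) (sym (distribˡ k _ _))

  ∑-tabulate-mono : ∀ {n} (f g : Fin n → Carrier) → (∀ i → f i ≤ g i) → ∑ (tabulate f) ≤ ∑ (tabulate g)
  ∑-tabulate-mono {zero}  f g f≤g = ≤-refl
  ∑-tabulate-mono {suc n} f g f≤g = +-mono-≤ (f≤g zero) (∑-tabulate-mono (f ∘ suc) (g ∘ suc) (f≤g ∘ suc))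

  -- Serves to average a bound that is affine in the values of `Pol` and `Sum` at a right-hand side,
  -- with coefficients independent of the outcome.
  ∑-tabulate-linear : ∀ {n} (p : Fin n → Carrier) k₀ k₁ k₂ (f g : Fin n → Carrier) →
    ∑ (tabulate (λ i → p i * (k₀ + k₁ * f i + k₂ * g i))) ≈
    k₀ * ∑ (tabulate p) + k₁ * ∑ (tabulate (λ i → p i * f i)) + k₂ * ∑ (tabulate (λ i → p i * g i))
  ∑-tabulate-linear {zero}  p k₀ k₁ k₂ f g =
    solve 3 (λ a b c → con 0 := a :* con 0 :+ b :* con 0 :+ c :* con 0) refl k₀ k₁ k₂
  ∑-tabulate-linear {suc n} p k₀ k₁ k₂ f g =
    trans (+-congˡ (∑-tabulate-linear (p ∘ suc) k₀ k₁ k₂ (f ∘ suc) (g ∘ suc)))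
      (solve 9 (λ a b c p f g P F G → p :* (a :+ b :* f :+ c :* g) :+ (a :* P :+ b :* F :+ c :* G)
         := a :* (p :+ P) :+ b :* (p :* f :+ F) :+ c :* (p :* g :+ G)) refl
         k₀ k₁ k₂ (p zero) (f zero) (g zero) _ _ _)

-- A concave function

-- This is the nonnegativity of `(y - z)²`; over `ℕ` the difference `d` has to be extracted in
-- either order.
2yz≤y²+z² : ∀ y z → y ℕ.* z ℕ.+ y ℕ.* z ℕ.≤ y ℕ.* y ℕ.+ z ℕ.* z
2yz≤y²+z² y z with ℕ.≤-total y z
... | inj₁ y≤z with ℕ.m≤n⇒∃[o]m+o≡n y≤z
...   | d , ≡.refl = ℕ.≤-trans (ℕ.m≤m+n _ (d ℕ.* d)) (ℕ.≤-reflexive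
  (solve 2 (λ y d → y :* (y :+ d) :+ y :* (y :+ d) :+ d :* d := y :* y :+ (y :+ d) :* (y :+ d)) ≡.refl y d))
  where open +-*-Solver
2yz≤y²+z² y z | inj₂ z≤y with ℕ.m≤n⇒∃[o]m+o≡n z≤y
...   | d , ≡.refl = ℕ.≤-trans (ℕ.m≤m+n _ (d ℕ.* d)) (ℕ.≤-reflexive
  (solve 2 (λ z d → (z :+ d) :* z :+ (z :+ d) :* z :+ d :* d := (z :+ d) :* (z :+ d) :+ z :* z) ≡.refl z d))
  where open +-*-Solver

2yz<y²+z² : ∀ {y z} → y ℕ.< z → y ℕ.* z ℕ.+ y ℕ.* z ℕ.< y ℕ.* y ℕ.+ z ℕ.* z
2yz<y²+z² {y} y<z with ℕ.m≤n⇒∃[o]m+o≡n y<z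
-- With `z = 1 + y + d` the gap is `(1 + d)²`; one unit of it is kept and `d * d + (d + d)` is given
-- away.
... | d , ≡.refl = ℕ.≤-trans (ℕ.m≤m+n _ (d ℕ.* d ℕ.+ (d ℕ.+ d))) (ℕ.≤-reflexive
  (solve 2 (λ y d → con 1 :+ (y :* (con 1 :+ y :+ d) :+ y :* (con 1 :+ y :+ d)) :+ (d :* d :+ (d :+ d))
    := y :* y :+ (con 1 :+ y :+ d) :* (con 1 :+ y :+ d)) ≡.refl y d))
  where open +-*-Solver

-- Equals `2Mx - x²` up to `M` and the constant `M²` from there on. Its values are natural numbers,
-- so strict concavity gains a whole unit.
capped : ℕ → ℕ → ℕ
capped M x = M ℕ.* M ℕ.∸ (M ℕ.∸ x) ℕ.* (M ℕ.∸ x)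

-- The derivative `2(M - x)` of `capped M` at `x`, which is zero beyond `M`.
slope : ℕ → ℕ → ℕ
slope M x = (M ℕ.∸ x) ℕ.+ (M ℕ.∸ x)

module _ (M x z : ℕ) where

  private
    y = M ℕ.∸ x
    w = M ℕ.∸ z

    capped+square : ∀ x → capped M x ℕ.+ (M ℕ.∸ x) ℕ.* (M ℕ.∸ x) ≡ M ℕ.* M
    capped+square x = ℕ.m∸n+n≡m (ℕ.*-mono-≤ (ℕ.m∸n≤m M x) (ℕ.m∸n≤m M x))

    -- Adding both squares to each side completes the truncated differences in `capped` to `M * M`,
    -- so that an inequality between squares remains. The number `k` is the gap to be kept.
    capped-tangent : ∀ k → k ℕ.+ (y ℕ.* y ℕ.+ (y ℕ.+ y) ℕ.* x) ℕ.≤ w ℕ.* w ℕ.+ (y ℕ.+ y) ℕ.* z →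
      k ℕ.+ (capped M z ℕ.+ slope M x ℕ.* x) ℕ.≤ capped M x ℕ.+ slope M x ℕ.* z
    capped-tangent k h = ℕ.+-cancelˡ-≤ (y ℕ.* y ℕ.+ w ℕ.* w) _ _ (begin
      (y ℕ.* y ℕ.+ w ℕ.* w) ℕ.+ (k ℕ.+ (capped M z ℕ.+ slope M x ℕ.* x))
        ≡⟨ solve 5 (λ k Y W u s → (Y :+ W) :+ (k :+ (u :+ s)) := (u :+ W) :+ (k :+ (Y :+ s))) ≡.refl
             k (y ℕ.* y) (w ℕ.* w) (capped M z) (slope M x ℕ.* x) ⟩
      (capped M z ℕ.+ w ℕ.* w) ℕ.+ (k ℕ.+ (y ℕ.* y ℕ.+ slope M x ℕ.* x))
        ≡⟨ ≡.cong (λ m → m ℕ.+ (k ℕ.+ (y ℕ.* y ℕ.+ slope M x ℕ.* x))) (≡.trans (capped+square z) (≡.sym (capped+square x))) ⟩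
      (capped M x ℕ.+ y ℕ.* y) ℕ.+ (k ℕ.+ (y ℕ.* y ℕ.+ slope M x ℕ.* x))
        ≤⟨ ℕ.+-monoʳ-≤ (capped M x ℕ.+ y ℕ.* y) h ⟩
      (capped M x ℕ.+ y ℕ.* y) ℕ.+ (w ℕ.* w ℕ.+ slope M x ℕ.* z)
        ≡⟨ solve 4 (λ Y W u s → (u :+ Y) :+ (W :+ s) := (Y :+ W) :+ (u :+ s)) ≡.refl
             (y ℕ.* y) (w ℕ.* w) (capped M x) (slope M x ℕ.* z) ⟩
      (y ℕ.* y ℕ.+ w ℕ.* w) ℕ.+ (capped M x ℕ.+ slope M x ℕ.* z) ∎)
      where
      open ℕ.≤-Reasoning
      open +-*-Solver

    square-tangent : ∀ k → x ℕ.≤ M → k ℕ.+ (y ℕ.* w ℕ.+ y ℕ.* w) ℕ.≤ y ℕ.* y ℕ.+ w ℕ.* w →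
      k ℕ.+ (y ℕ.* y ℕ.+ (y ℕ.+ y) ℕ.* x) ℕ.≤ w ℕ.* w ℕ.+ (y ℕ.+ y) ℕ.* z
    square-tangent k x≤M h = ℕ.+-cancelˡ-≤ (y ℕ.* y) _ _ (begin
      y ℕ.* y ℕ.+ (k ℕ.+ (y ℕ.* y ℕ.+ (y ℕ.+ y) ℕ.* x))
        ≡⟨ solve 3 (λ k x y → y :* y :+ (k :+ (y :* y :+ (y :+ y) :* x)) := k :+ (y :+ y) :* (x :+ y)) ≡.refl k x y ⟩
      k ℕ.+ (y ℕ.+ y) ℕ.* (x ℕ.+ y)
        ≤⟨ ℕ.+-monoʳ-≤ k (ℕ.*-monoʳ-≤ (y ℕ.+ y)
             (ℕ.≤-trans (ℕ.≤-reflexive (ℕ.m+[n∸m]≡n x≤M)) (ℕ.m≤n+m∸n M z))) ⟩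
      k ℕ.+ (y ℕ.+ y) ℕ.* (z ℕ.+ w)
        ≡⟨ solve 4 (λ k y z w → k :+ (y :+ y) :* (z :+ w) := (k :+ (y :* w :+ y :* w)) :+ (y :+ y) :* z) ≡.refl k y z w ⟩
      (k ℕ.+ (y ℕ.* w ℕ.+ y ℕ.* w)) ℕ.+ (y ℕ.+ y) ℕ.* z
        ≤⟨ ℕ.+-monoˡ-≤ _ h ⟩
      (y ℕ.* y ℕ.+ w ℕ.* w) ℕ.+ (y ℕ.+ y) ℕ.* z
        ≡⟨ ℕ.+-assoc (y ℕ.* y) (w ℕ.* w) _ ⟩
      y ℕ.* y ℕ.+ (w ℕ.* w ℕ.+ (y ℕ.+ y) ℕ.* z) ∎)
      where
      open ℕ.≤-Reasoning
      open +-*-Solver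

  -- The graph lies below its tangent at `x`, with terms moved across to avoid negative numbers.
  -- Past `M` the tangent is horizontal and touches the maximum.
  capped-concave : capped M z ℕ.+ slope M x ℕ.* x ℕ.≤ capped M x ℕ.+ slope M x ℕ.* z
  capped-concave with ℕ.≤-total x M
  ... | inj₁ x≤M = capped-tangent 0 (square-tangent 0 x≤M (2yz≤y²+z² y w))
  ... | inj₂ M≤x = capped-tangent 0 (≡.subst (λ y → y ℕ.* y ℕ.+ (y ℕ.+ y) ℕ.* x ℕ.≤ w ℕ.* w ℕ.+ (y ℕ.+ y) ℕ.* z)
                     (≡.sym (ℕ.m≤n⇒m∸n≡0 M≤x)) ℕ.z≤n)

  -- Here `M ∸ x` and `M ∸ z` differ, so the square of their difference is at least one; beyond `M`
  -- both could be zero.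
  capped-strictlyConcave : z ℕ.< x → x ℕ.≤ M →
    suc (capped M z ℕ.+ slope M x ℕ.* x) ℕ.≤ capped M x ℕ.+ slope M x ℕ.* z
  capped-strictlyConcave z<x x≤M = capped-tangent 1 (square-tangent 1 x≤M (2yz<y²+z² (ℕ.∸-monoʳ-< z<x x≤M)))

-- Chain trees

module ChainTrees {c ℓ₁ ℓ₂ : Level} (K : ArchimedeanOrderedField c ℓ₁ ℓ₂)
  (Sig : Signature) (V : Set) (D : Subset (Signature.size Sig)) where

  open OrderedFieldProperties K
  open ADPFramework K Sig V D

  𝔼 : MultiDistribution T♯ → (T♯ → Carrier) → Carrier
  𝔼 μ h = ∑ (map (λ (q , t) → q * h t) μ)

  mass : MultiDistribution T♯ → Carrier
  mass μ = ∑ (map proj₁ μ)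

  𝔼-+ : ∀ μ f g → 𝔼 μ (λ t → f t + g t) ≈ 𝔼 μ f + 𝔼 μ g
  𝔼-+ μ f g = trans (∑-cong _ _ (λ (q , t) → distribˡ q (f t) (g t)) μ) (∑-+ _ _ μ)

  𝔼-* : ∀ μ k f → 𝔼 μ (λ t → k * f t) ≈ k * 𝔼 μ f
  𝔼-* μ k f = trans
    (∑-cong _ _ (λ (q , t) → solve 3 (λ q k f → q :* (k :* f) := k :* (q :* f)) refl q k (f t)) μ) (∑-*ˡ k _ μ)

  𝔼-const : ∀ μ → mass μ ≈ 1# → ∀ k → 𝔼 μ (λ _ → k) ≈ k
  𝔼-const μ total k = trans (∑-cong _ _ (λ (q , _) → *-comm q k) μ)
    (trans (∑-*ˡ k proj₁ μ) (trans (*-congˡ total) (*-identityʳ k)))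

  𝔼-mono : ∀ {μ f g} → All (λ (q , _) → 0# < q) μ → (∀ t → f t ≤ g t) → 𝔼 μ f ≤ 𝔼 μ g
  𝔼-mono []           f≤g = ≤-refl
  𝔼-mono (0<q ∷ 0<qs) f≤g = +-mono-≤ (*-monoˡ-≤ (<⇒≤ 0<q) (f≤g _)) (𝔼-mono 0<qs f≤g)

  -- A unit gap at a single outcome of probability `q` already contributes `q`, hence at least `p`,
  -- to the difference of the expectations.
  𝔼-strictMono : ∀ {μ f g p} → All (λ (q , _) → 0# < q) μ → (∀ t → f t ≤ g t) →
                 Any (λ (q , t) → p ≤ q × f t + 1# ≤ g t) μ → 𝔼 μ f + p ≤ 𝔼 μ g
  𝔼-strictMono {(q , t) ∷ μ} {f} {g} {p} (0<q ∷ 0<qs) f≤g (here (p≤q , ft+1≤gt)) = begin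
    (q * f t + 𝔼 μ f) + p  ≤⟨ +-monoʳ-≤ _ p≤q ⟩
    (q * f t + 𝔼 μ f) + q  ≈⟨ solve 3 (λ q f E → (q :* f :+ E) :+ q := q :* (f :+ con 1) :+ E) refl q (f t) (𝔼 μ f) ⟩
    q * (f t + 1#) + 𝔼 μ f  ≤⟨ +-mono-≤ (*-monoˡ-≤ (<⇒≤ 0<q) ft+1≤gt) (𝔼-mono 0<qs f≤g) ⟩
    q * g t + 𝔼 μ g        ∎
    where open ≤-Reasoning
  𝔼-strictMono {(q , t) ∷ μ} {f} {g} {p} (0<q ∷ 0<qs) f≤g (there any) = begin
    (q * f t + 𝔼 μ f) + p  ≈⟨ +-assoc _ _ p ⟩
    q * f t + (𝔼 μ f + p)  ≤⟨ +-mono-≤ (*-monoˡ-≤ (<⇒≤ 0<q) (f≤g t)) (𝔼-strictMono 0<qs f≤g any) ⟩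
    q * g t + 𝔼 μ g        ∎
    where open ≤-Reasoning

  ∑-++ : ∀ xs ys → ∑ (xs ++ ys) ≈ ∑ xs + ∑ ys
  ∑-++ []       ys = sym (+-identityˡ _)
  ∑-++ (x ∷ xs) ys = trans (+-congˡ (∑-++ xs ys)) (sym (+-assoc x _ _))

  ∑-concatMap : ∀ (f : Address → Carrier) (g : Address → List Address) xs →
                ∑ (map f (concatMap g xs)) ≈ ∑ (map (λ x → ∑ (map f (g x))) xs)
  ∑-concatMap f g []       = refl
  ∑-concatMap f g (x ∷ xs) = trans (reflexive (≡.cong ∑ (List.map-++ f (g x) _)))
    (trans (∑-++ (map f (g x)) _) (+-congˡ (∑-concatMap f g xs)))

  applyUpTo-Pointwise : ∀ {a b r s} {A : Set a} {B : Set b} {R : A → B → Set r} {S : A → B → Set s} {f g : ℕ → B} n →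
    (∀ {x i} → i ℕ.< n → R x (f i) → S x (g i)) →
    ∀ {xs} → Pointwise R xs (applyUpTo f n) → Pointwise S xs (applyUpTo g n)
  applyUpTo-Pointwise zero    R⇒S []        = []
  applyUpTo-Pointwise (suc n) R⇒S (r ∷ rs) = R⇒S (ℕ.s≤s ℕ.z≤n) r ∷ applyUpTo-Pointwise n (R⇒S ∘ ℕ.s≤s) rs

  module _ (deg : Address → ℕ) where

    Node? : ∀ v → Dec (Node deg v)
    Node? []      = yes root-node
    Node? (i ∷ v) = map′ (λ (n , i<) → child-node n i<) (λ { (child-node n i<) → n , i< })
                      (Node? v ×-dec (i ℕ.<? deg v))

    InnerNode : Address → Set
    InnerNode v = Node deg v × deg v ≢ 0

    -- Chain trees carry data at all addresses but steps only at inner nodes, so a construction by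
    -- recursion on addresses has to decide where it is.
    InnerNode? : ∀ v → Dec (InnerNode v)
    InnerNode? v = Node? v ×-dec ¬? (deg v ℕ.≟ 0)

    ∈-children⁻ : ∀ {v w} → w ∈ children deg v → ∃ λ i → i ℕ.< deg v × w ≡ i ∷ v
    ∈-children⁻ = ∈.∈-applyUpTo⁻ _

    children-nodes : ∀ {v} → Node deg v → All (Node deg) (children deg v)
    children-nodes {v} nv = All.tabulate λ w∈ → node (∈-children⁻ w∈)
      where
      node : ∀ {w} → (∃ λ i → i ℕ.< deg v × w ≡ i ∷ v) → Node deg w
      node (i , i< , ≡.refl) = child-node nv i<

    -- With the next two, the unfolding equations of `leavesWithin`, which does not reduce until the
    -- degree is known.
    leavesWithin-leaf : ∀ n v → deg v ≡ 0 → leavesWithin deg n v ≡ v ∷ []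
    leavesWithin-leaf n v eq with deg v
    leavesWithin-leaf n       v eq | zero = ≡.refl

    leavesWithin-zero : ∀ v → deg v ≢ 0 → leavesWithin deg 0 v ≡ []
    leavesWithin-zero v nz with deg v
    ... | zero  = ⊥-elim (nz ≡.refl)
    ... | suc _ = ≡.refl

    leavesWithin-suc : ∀ n v → deg v ≢ 0 →
      leavesWithin deg (suc n) v ≡ concatMap (leavesWithin deg n) (children deg v)
    leavesWithin-suc n v nz with deg v in eq
    ... | zero  = ⊥-elim (nz ≡.refl)
    ... | suc _ rewrite eq = ≡.refl

    -- Abstract in the degree as well, since it is used both for a given tree and for the same tree
    -- cut at its strict steps.
    module LeafSums (prob : Address → Carrier) where

      leafSum : ℕ → Address → Carrier
      leafSum n v = ∑ (map prob (leavesWithin deg n v))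

      leafSum-leaf : ∀ n {v} → deg v ≡ 0 → leafSum n v ≈ prob v
      leafSum-leaf n {v} eq = trans (reflexive (≡.cong (∑ ∘ map prob) (leavesWithin-leaf n v eq))) (+-identityʳ _)

      leafSum-zero : ∀ {v} → deg v ≢ 0 → leafSum 0 v ≈ 0#
      leafSum-zero {v} nz = reflexive (≡.cong (∑ ∘ map prob) (leavesWithin-zero v nz))

      leafSum-suc : ∀ n {v} → deg v ≢ 0 → leafSum (suc n) v ≈ ∑ (map (leafSum n) (children deg v))
      leafSum-suc n {v} nz = trans (reflexive (≡.cong (∑ ∘ map prob) (leavesWithin-suc n v nz)))
        (∑-concatMap prob (leavesWithin deg n) (children deg v))

  -- Addresses list the last choice first, so the subtree at `v` is reached by appending `v` at the
  -- end.
  leavesWithin-++ : ∀ deg v n w →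
    map (_++ v) (leavesWithin (λ u → deg (u ++ v)) n w) ≡ leavesWithin deg n (w ++ v)
  leavesWithin-++ deg v n w with deg (w ++ v) ℕ.≟ 0
  ... | yes z = ≡.trans (≡.cong (map (_++ v)) (leavesWithin-leaf (λ u → deg (u ++ v)) n w z)) (≡.sym (leavesWithin-leaf deg n (w ++ v) z))
  leavesWithin-++ deg v zero    w | no nz =
    ≡.trans (≡.cong (map (_++ v)) (leavesWithin-zero (λ u → deg (u ++ v)) w nz)) (≡.sym (leavesWithin-zero deg (w ++ v) nz))
  leavesWithin-++ deg v (suc n) w | no nz = begin
    map (_++ v) (leavesWithin deg′ (suc n) w)                         ≡⟨ ≡.cong (map (_++ v)) (leavesWithin-suc deg′ n w nz) ⟩
    map (_++ v) (concatMap (leavesWithin deg′ n) (children deg′ w))   ≡⟨ List.map-concatMap (_++ v) (leavesWithin deg′ n) (children deg′ w) ⟩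
    concatMap (map (_++ v) ∘ leavesWithin deg′ n) (children deg′ w)   ≡⟨ List.concatMap-cong (leavesWithin-++ deg v n) (children deg′ w) ⟩
    concatMap (leavesWithin deg n ∘ (_++ v)) (children deg′ w)        ≡⟨ List.concatMap-map (leavesWithin deg n) (_++ v) (children deg′ w) ⟨
    concatMap (leavesWithin deg n) (map (_++ v) (children deg′ w))    ≡⟨ ≡.cong (concatMap (leavesWithin deg n)) (List.map-applyUpTo (_∷ w) (_++ v) (deg′ w)) ⟩
    concatMap (leavesWithin deg n) (children deg (w ++ v))            ≡⟨ leavesWithin-suc deg n (w ++ v) nz ⟨
    leavesWithin deg (suc n) (w ++ v)                                 ∎
    where
    open ≡.≡-Reasoning
    deg′ : Address → ℕ
    deg′ u = deg (u ++ v)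

  ∑-mono : ∀ {a} {A : Set a} (f g : A → Carrier) {xs} → All (λ x → f x ≤ g x) xs → ∑ (map f xs) ≤ ∑ (map g xs)
  ∑-mono f g []           = ≤-refl
  ∑-mono f g (fx≤gx ∷ hs) = +-mono-≤ fx≤gx (∑-mono f g hs)

  ∑-nonNegative : ∀ {a} {A : Set a} (f : A → Carrier) {xs} → All (λ x → 0# ≤ f x) xs → 0# ≤ ∑ (map f xs)
  ∑-nonNegative f []           = ≤-refl
  ∑-nonNegative f (0≤fx ∷ 0≤f) = +-nonNegative 0≤fx (∑-nonNegative f 0≤f)

  AreChildren : (Address → Carrier) → (Address → T♯) → Address → MultiDistribution T♯ → List Address → Set (c ⊔ ℓ₁)
  AreChildren prob term v = Pointwise (λ (q , t) w → prob w ≈ prob v * q × term w ≡ t)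

  module _ {prob : Address → Carrier} {term : Address → T♯} {v : Address} where

    ∑-children : ∀ (g : T♯ → Carrier) {μ ws} → AreChildren prob term v μ ws →
                 ∑ (map (λ w → prob w * g (term w)) ws) ≈ prob v * 𝔼 μ g
    ∑-children g []                        = sym (zeroʳ _)
    ∑-children g {(q , t) ∷ μ} ((eq , ≡.refl) ∷ pw) = trans (+-cong (*-congʳ eq) (∑-children g pw))
      (solve 4 (λ p q g E → (p :* q) :* g :+ p :* E := p :* (q :* g :+ E)) refl (prob v) q (g t) (𝔼 μ g))

    ∑-children-prob : ∀ {μ ws} → AreChildren prob term v μ ws → mass μ ≈ 1# → ∑ (map prob ws) ≈ prob v
    ∑-children-prob {μ} {ws} pw total = trans (∑-cong prob _ (λ w → sym (*-identityʳ (prob w))) ws)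
      (trans (∑-children (λ _ → 1#) pw) (trans (*-congˡ (𝔼-const μ total 1#)) (*-identityʳ _)))

  record Proper (μ : MultiDistribution T♯) : Set (c ⊔ ℓ₁ ⊔ ℓ₂) where
    field
      positive : All (λ (q , _) → 0# < q) μ
      mass≈1   : mass μ ≈ 1#

  module ChainTreeProperties {_↪[_]_ : T♯ → Bool → MultiDistribution T♯ → Set c}
    (proper : ∀ {s b μ} → s ↪[ b ] μ → Proper μ) (𝔗 : ChainTree _↪[_]_) where

    open ChainTree 𝔗
    open LeafSums deg prob public

    children-prob : ∀ {v} → Node deg v → deg v ≢ 0 → ∑ (map prob (children deg v)) ≈ prob v
    children-prob nv nz with step nv nz
    ... | _ , st , pw = ∑-children-prob pw (Proper.mass≈1 (proper st))

    leafSum-nonNegative : ∀ n {v} → Node deg v → 0# ≤ leafSum n v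
    leafSum-nonNegative n {v} nv with deg v ℕ.≟ 0
    ... | yes z = ≤-respʳ-≈ (sym (leafSum-leaf n z)) (<⇒≤ (prob-positive nv))
    leafSum-nonNegative zero    nv | no nz = ≤-reflexive (sym (leafSum-zero nz))
    leafSum-nonNegative (suc n) nv | no nz = ≤-respʳ-≈ (sym (leafSum-suc n nz))
      (∑-nonNegative (leafSum n) (All.map (leafSum-nonNegative n) (children-nodes deg nv)))

    leafSum-≤-prob : ∀ n {v} → Node deg v → leafSum n v ≤ prob v
    leafSum-≤-prob n {v} nv with deg v ℕ.≟ 0
    ... | yes z = ≤-reflexive (leafSum-leaf n z)
    leafSum-≤-prob zero    nv | no nz = ≤-respˡ-≈ (sym (leafSum-zero nz)) (<⇒≤ (prob-positive nv))
    leafSum-≤-prob (suc n) nv | no nz = ≤-respˡ-≈ (sym (leafSum-suc n nz)) (≤-respʳ-≈ (children-prob nv nz)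
      (∑-mono (leafSum n) prob (All.map (leafSum-≤-prob n) (children-nodes deg nv))))

    leafSum-mono : ∀ {m n} → m ℕ.≤ n → ∀ {v} → Node deg v → leafSum m v ≤ leafSum n v
    leafSum-mono {m} {n} m≤n {v} nv with deg v ℕ.≟ 0
    ... | yes z = ≤-reflexive (trans (leafSum-leaf m z) (sym (leafSum-leaf n z)))
    leafSum-mono {n = n} ℕ.z≤n nv | no nz = ≤-respˡ-≈ (sym (leafSum-zero nz)) (leafSum-nonNegative n nv)
    leafSum-mono (ℕ.s≤s m≤n)   nv | no nz = ≤-respˡ-≈ (sym (leafSum-suc _ nz)) (≤-respʳ-≈ (sym (leafSum-suc _ nz))
      (∑-mono _ _ (All.map (leafSum-mono m≤n) (children-nodes deg nv))))

    -- Each child comes with a depth of its own; as leaf sums grow with the depth and there are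
    -- finitely many children, the maximum serves all of them.
    leafSum-common : ∀ (f h : Address → Carrier) {ws} → All (Node deg) ws →
      All (λ w → ∃ λ n → f w ≤ leafSum n w + h w) ws →
      ∃ λ n → ∑ (map f ws) ≤ ∑ (map (leafSum n) ws) + ∑ (map h ws)
    leafSum-common f h []         []              = 0 , ≤-reflexive (sym (+-identityˡ 0#))
    leafSum-common f h {w ∷ ws} (nw ∷ nws) ((m , fw≤) ∷ hs) =
      let n , ∑≤ = leafSum-common f h nws hs
          m≤k    = ℕ.m≤m⊔n m n
          n≤k    = ℕ.m≤n⊔m m n
      in m ℕ.⊔ n , (begin
        f w + ∑ (map f ws)
          ≤⟨ +-mono-≤ (≤-trans fw≤ (+-monoˡ-≤ _ (leafSum-mono m≤k nw)))
                      (≤-trans ∑≤ (+-monoˡ-≤ _ (∑-mono _ _ (All.map (leafSum-mono n≤k) nws)))) ⟩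
        (leafSum (m ℕ.⊔ n) w + h w) + (∑ (map (leafSum (m ℕ.⊔ n)) ws) + ∑ (map h ws))
          ≈⟨ solve 4 (λ a b c d → (a :+ b) :+ (c :+ d) := (a :+ c) :+ (b :+ d)) refl _ _ _ _ ⟩
        (leafSum (m ℕ.⊔ n) w + ∑ (map (leafSum (m ℕ.⊔ n)) ws)) + (h w + ∑ (map h ws)) ∎)
      where open ≤-Reasoning

    -- The induction step for bounds of the form leaf mass plus defect: weighted by their
    -- probabilities, the defects of the children add up to an expectation at `v`. Looking through
    -- the children costs one level of depth.
    leafSum-children : ∀ (f : Address → Carrier) (g : T♯ → Carrier) e {v} → Node deg v → (nz : deg v ≢ 0) →
      ∀ {μ} → AreChildren prob term v μ (children deg v) → mass μ ≈ 1# →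
      (∀ {w} → Node deg w → ∃ λ n → f w ≤ leafSum n w + prob w * (g (term w) + e)) →
      ∃ λ n → ∑ (map f (children deg v)) ≤ leafSum n v + prob v * (𝔼 μ g + e)
    leafSum-children f g e {v} nv nz {μ} pw total bound =
      let n , ∑≤ = leafSum-common f (λ w → prob w * (g (term w) + e)) (children-nodes deg nv)
                     (All.map bound (children-nodes deg nv))
      in suc n , ≤-trans ∑≤ (≤-reflexive (+-cong (sym (leafSum-suc n nz))
           (trans (∑-children (λ t → g t + e) pw) (*-congˡ (trans (𝔼-+ μ g (λ _ → e)) (+-congˡ (𝔼-const μ total e)))))))

-- Soundness from a strictly decreasing supermartingale

private
  isRight : ∀ {a b} {A : Set a} {B : Set b} → A ⊎ B → Bool
  isRight (inj₁ _) = false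
  isRight (inj₂ _) = true

  fromLeft : ∀ {a b} {A : Set a} {B : Set b} (x : A ⊎ B) → isRight x ≡ false → A
  fromLeft (inj₁ x) _ = x

  fromRight : ∀ {a b} {A : Set a} {B : Set b} (x : A ⊎ B) → isRight x ≡ true → B
  fromRight (inj₂ y) _ = y

  if-false : ∀ {a} {A : Set a} {b} {x y : A} → b ≡ false → (if b then x else y) ≡ y
  if-false ≡.refl = ≡.refl

  if-true : ∀ {a} {A : Set a} {b} {x y : A} → b ≡ true → (if b then x else y) ≡ x
  if-true ≡.refl = ≡.refl

  if≢0 : ∀ b {n} → (if b then 0 else n) ≢ 0 → b ≡ false × n ≢ 0
  if≢0 false n≢0 = ≡.refl , n≢0
  if≢0 true  0≢0 = contradiction ≡.refl 0≢0

  <if : ∀ b {i n} → i ℕ.< (if b then 0 else n) → b ≡ false × i ℕ.< n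
  <if false i<n = ≡.refl , i<n

  if-then-false : ∀ b {b′} → (if b then false else b′) ≡ true → b ≡ false × b′ ≡ true
  if-then-false false eq = ≡.refl , eq

module CutSoundness {c ℓ₁ ℓ₂ : Level} (K : ArchimedeanOrderedField c ℓ₁ ℓ₂)
  (Sig : Signature) (V : Set) (D : Subset (Signature.size Sig)) where

  open OrderedFieldProperties K
  open ADPFramework K Sig V D
  open ChainTrees K Sig V D

  module Potential (X : T♯ → ℕ) (p a b : Carrier) (0≤a : 0# ≤ a) (0≤b : 0# ≤ b) (0≤p : 0# ≤ p) (M : ℕ) where

    Decreasing : T♯ → MultiDistribution T♯ → Set (c ⊔ ℓ₂)
    Decreasing s = Any (λ (q , t) → p ≤ q × X t ℕ.< X s)

    c₀ : Carrier
    c₀ = b * p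

    potential : ℕ → T♯ → Carrier
    potential j t = c₀ * fromℕ j + (a * fromℕ (X t) + b * fromℕ (capped M (X t)))

    potential≥count : ∀ j t → c₀ * fromℕ j ≤ potential j t
    potential≥count j t = x≤x+y _ (+-nonNegative (*-nonNegative 0≤a (fromℕ-nonNegative (X t)))
                                                 (*-nonNegative 0≤b (fromℕ-nonNegative (capped M (X t)))))

    potential≥value : ∀ j t → a * fromℕ (X t) ≤ potential j t
    potential≥value j t = ≤-trans (x≤x+y _ (*-nonNegative 0≤b (fromℕ-nonNegative (capped M (X t)))))
      (≤-respʳ-≈ (+-comm _ _) (x≤x+y _ (*-nonNegative (*-nonNegative 0≤b 0≤p) (fromℕ-nonNegative j))))

    potential-nonNegative : ∀ j t → 0# ≤ potential j t
    potential-nonNegative j t = ≤-trans (*-nonNegative 0≤a (fromℕ-nonNegative (X t))) (potential≥value j t)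

    𝔼-potential : ∀ {μ} → Proper μ → ∀ j → 𝔼 μ (potential j) ≈
      c₀ * fromℕ j + (a * 𝔼 μ (fromℕ ∘ X) + b * 𝔼 μ (fromℕ ∘ capped M ∘ X))
    𝔼-potential {μ} pr j = trans (𝔼-+ μ _ _) (+-cong (𝔼-const μ (Proper.mass≈1 pr) _)
      (trans (𝔼-+ μ _ _) (+-cong (𝔼-* μ a _) (𝔼-* μ b _))))

    module _ {s : T♯} {μ : MultiDistribution T♯} (pr : Proper μ) (super : 𝔼 μ (fromℕ ∘ X) ≤ fromℕ (X s)) where

      open Proper pr

      private
        x k : ℕ
        x = X s
        k = slope M x

        chord tangent : T♯ → Carrier
        chord t   = fromℕ (capped M (X t)) + fromℕ k * fromℕ x
        tangent t = fromℕ (capped M x) + fromℕ k * fromℕ (X t)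

        fromℕ-affine : ∀ m n o → fromℕ (m ℕ.+ n ℕ.* o) ≈ fromℕ m + fromℕ n * fromℕ o
        fromℕ-affine m n o = trans (fromℕ-+ m (n ℕ.* o)) (+-congˡ (fromℕ-* n o))

        chord≤tangent : ∀ t → chord t ≤ tangent t
        chord≤tangent t = ≤-respˡ-≈ (fromℕ-affine (capped M (X t)) k x) (≤-respʳ-≈ (fromℕ-affine (capped M x) k (X t))
          (fromℕ-mono-≤ (capped-concave M x (X t))))

        chord+1≤tangent : ∀ t → x ℕ.≤ M → X t ℕ.< x → chord t + 1# ≤ tangent t
        chord+1≤tangent t x≤M Xt<x = ≤-respˡ-≈ (trans (+-comm 1# _) (+-congʳ (fromℕ-affine (capped M (X t)) k x)))
          (≤-respʳ-≈ (fromℕ-affine (capped M x) k (X t)) (fromℕ-mono-≤ (capped-strictlyConcave M x (X t) Xt<x x≤M)))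

        𝔼-chord : 𝔼 μ chord ≈ 𝔼 μ (fromℕ ∘ capped M ∘ X) + fromℕ k * fromℕ x
        𝔼-chord = trans (𝔼-+ μ _ _) (+-congˡ (𝔼-const μ mass≈1 _))

        𝔼-tangent : 𝔼 μ tangent ≤ fromℕ (capped M x) + fromℕ k * fromℕ x
        𝔼-tangent = ≤-respˡ-≈ (sym (trans (𝔼-+ μ _ _) (+-cong (𝔼-const μ mass≈1 _) (𝔼-* μ (fromℕ k) _))))
          (+-monoʳ-≤ _ (*-monoˡ-≤ (fromℕ-nonNegative k) super))

        -- Jensen's inequality: average the tangent at `x`. As its slope is nonnegative, the
        -- supermartingale inequality `super` suffices.
        𝔼-capped : 𝔼 μ (fromℕ ∘ capped M ∘ X) ≤ fromℕ (capped M x)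
        𝔼-capped = +-cancelʳ-≤ _ (≤-respˡ-≈ 𝔼-chord (≤-trans (𝔼-mono positive chord≤tangent) 𝔼-tangent))

        -- On the outcome where `X` drops, the tangent exceeds the graph by a full unit. The mean of
        -- the capped value thus falls by `p` even if the mean of `X` does not fall.
        𝔼-capped-decreasing : x ℕ.≤ M → Decreasing s μ → 𝔼 μ (fromℕ ∘ capped M ∘ X) + p ≤ fromℕ (capped M x)
        𝔼-capped-decreasing x≤M dec = +-cancelʳ-≤ (fromℕ k * fromℕ x) (begin
          (𝔼 μ (fromℕ ∘ capped M ∘ X) + p) + fromℕ k * fromℕ x  ≈⟨ solve 3 (λ a b c → a :+ b :+ c := a :+ c :+ b) refl _ p _ ⟩
          (𝔼 μ (fromℕ ∘ capped M ∘ X) + fromℕ k * fromℕ x) + p  ≈⟨ +-congʳ 𝔼-chord ⟨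
          𝔼 μ chord + p                                         ≤⟨ 𝔼-strictMono positive chord≤tangent
            (Any.map (λ {(_ , t)} (p≤q , Xt<x) → p≤q , chord+1≤tangent t x≤M Xt<x) dec) ⟩
          𝔼 μ tangent                                           ≤⟨ 𝔼-tangent ⟩
          fromℕ (capped M x) + fromℕ k * fromℕ x                ∎)
          where open ≤-Reasoning

      potential-supermartingale : ∀ j → 𝔼 μ (potential j) ≤ potential j s
      potential-supermartingale j = ≤-respˡ-≈ (sym (𝔼-potential pr j))
        (+-monoʳ-≤ _ (+-mono-≤ (*-monoˡ-≤ 0≤a super) (*-monoˡ-≤ 0≤b 𝔼-capped)))

      -- Raising the counter costs `c₀ = b * p`, exactly what the capped term, which loses `p` and
      -- is weighted by `b`, pays back.
      potential-decreasing : X s ℕ.≤ M → Decreasing s μ → ∀ j → 𝔼 μ (potential (suc j)) ≤ potential j s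
      potential-decreasing x≤M dec j = begin
        𝔼 μ (potential (suc j))
          ≈⟨ 𝔼-potential pr (suc j) ⟩
        b * p * (1# + fromℕ j) + (a * 𝔼 μ (fromℕ ∘ X) + b * 𝔼 μ (fromℕ ∘ capped M ∘ X))
          ≈⟨ solve 5 (λ b p j X u → b :* p :* (con 1 :+ j) :+ (X :+ b :* u) := b :* p :* j :+ (X :+ b :* (u :+ p))) refl
               b p (fromℕ j) _ _ ⟩
        c₀ * fromℕ j + (a * 𝔼 μ (fromℕ ∘ X) + b * (𝔼 μ (fromℕ ∘ capped M ∘ X) + p))
          ≤⟨ +-monoʳ-≤ _ (+-mono-≤ (*-monoˡ-≤ 0≤a super) (*-monoˡ-≤ 0≤b (𝔼-capped-decreasing x≤M dec))) ⟩
        potential j s ∎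
        where open ≤-Reasoning

  -- The step relations are abstract so that one argument serves both full and innermost rewriting.
  module _ {_↪[_]_ _↪′[_]_ : T♯ → Bool → MultiDistribution T♯ → Set c}
    (X : T♯ → ℕ) (p : Carrier) (0<p : 0# < p)
    (proper : ∀ {s b μ} → s ↪[ b ] μ → Proper μ)
    (proper-≤1 : ∀ {s b μ} → s ↪[ b ] μ → All (λ (q , _) → q ≤ 1#) μ)
    (super : ∀ {s b μ} → s ↪[ b ] μ → 𝔼 μ (fromℕ ∘ X) ≤ fromℕ (X s))
    (classify : ∀ {s b μ} → s ↪[ b ] μ →
                (s ↪′[ b ] μ) ⊎ Any (λ (q , t) → p ≤ q × X t ℕ.< X s) μ)
    (converges′ : (𝔗 : ChainTree _↪′[_]_) → LeafProbability 𝔗 1#)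
    (𝔗 : ChainTree _↪[_]_)
    where

    open ChainTree 𝔗
    open ChainTreeProperties proper 𝔗

    private
      cutAt : ∀ {v} → Dec (InnerNode deg v) → Bool
      cutAt (no _)          = false
      cutAt (yes (nv , nz)) = isRight (classify (proj₁ (proj₂ (step nv nz))))

    cut : Address → Bool
    cut v = cutAt (InnerNode? deg v)

    cut-false : ∀ {v} → InnerNode deg v → cut v ≡ false →
      ∃ λ μ → (term v ↪′[ A v ] μ) × AreChildren prob term v μ (children deg v)
    cut-false {v} inner eq = decide (InnerNode? deg v) eq
      where
      decide : (d : Dec (InnerNode deg v)) → cutAt d ≡ false →
        ∃ λ μ → (term v ↪′[ A v ] μ) × AreChildren prob term v μ (children deg v)
      decide (no ¬inner) _ = contradiction inner ¬inner
      decide (yes (nv , nz)) eq =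
        let μ , st , pw = step nv nz in μ , fromLeft (classify st) eq , pw

    cut-true : ∀ {v} → cut v ≡ true →
      InnerNode deg v × ∃ λ μ → (term v ↪[ A v ] μ) ×
      Any (λ (q , t) → p ≤ q × X t ℕ.< X (term v)) μ × AreChildren prob term v μ (children deg v)
    cut-true {v} eq = decide (InnerNode? deg v) eq
      where
      decide : (d : Dec (InnerNode deg v)) → cutAt d ≡ true →
        InnerNode deg v × ∃ λ μ → (term v ↪[ A v ] μ) ×
        Any (λ (q , t) → p ≤ q × X t ℕ.< X (term v)) μ × AreChildren prob term v μ (children deg v)
      decide (yes (nv , nz)) eq =
        let μ , st , pw = step nv nz in (nv , nz) , μ , st , fromRight (classify st) eq , pw

    cutDeg : Address → ℕ
    cutDeg v = if cut v then 0 else deg v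

    cutDeg≢0 : ∀ v → cutDeg v ≢ 0 → cut v ≡ false × deg v ≢ 0
    cutDeg≢0 v = if≢0 (cut v)

    cutDeg-< : ∀ {i} v → i ℕ.< cutDeg v → cut v ≡ false × i ℕ.< deg v
    cutDeg-< v = <if (cut v)

    open LeafSums cutDeg prob using () renaming
      (leafSum to cutSum; leafSum-leaf to cutSum-leaf; leafSum-zero to cutSum-zero; leafSum-suc to cutSum-suc)

    child-prob-≤ : ∀ {v i} → Node deg v → i ℕ.< deg v → prob (i ∷ v) ≤ prob v
    child-prob-≤ {v} {i} nv i< with step nv (ℕ.>⇒≢ (ℕ.≤-<-trans ℕ.z≤n i<))
    ... | μ , st , pw = applied (proper-≤1 st) pw (∈.∈-applyUpTo⁺ (_∷ v) i<)
      where
      applied : ∀ {μ ws w} → All (λ (q , _) → q ≤ 1#) μ → AreChildren prob term v μ ws → w ∈ ws → prob w ≤ prob v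
      applied (q≤1 ∷ _) ((eq , _) ∷ _)  (here ≡.refl) =
        ≤-respˡ-≈ (sym eq) (≤-respʳ-≈ (*-identityʳ _) (*-monoˡ-≤ (<⇒≤ (prob-positive nv)) q≤1))
      applied (_ ∷ q≤1s) (_ ∷ pw)       (there w∈)    = applied q≤1s pw w∈

    private
      -- The tree below `v` down to the next strict steps; division by `prob v` restores probability
      -- one at its root. Cut nodes are leaves, so they must leave `A`. An infinite path never meets
      -- them and keeps its infinitely many annotated steps.
      subtree : ∀ {v} → Node deg v → ChainTree _↪′[_]_
      subtree {v} nv = record
        { deg           = λ w → cutDeg (w ++ v)
        ; prob          = λ w → prob (w ++ v) * inv
        ; term          = λ w → term (w ++ v)
        ; A             = λ w → if cut (w ++ v) then false else A (w ++ v)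
        ; prob-root     = prob-inv
        ; prob-positive = λ nw → *-positive (prob-positive (node nw)) 0<inv
        ; prob-≤1       = λ nw → ≤-respʳ-≈ prob-inv (*-monoʳ-≤ (<⇒≤ 0<inv) (prob-≤ nw))
        ; A-inner       = λ {w} nw → A-inner′ w (node nw)
        ; step          = λ {w} nw nz → step′ w (node nw) nz
        ; A-infinite    = A-infinite′
        }
        where
        inv : Carrier
        inv = proj₁ (positive-inverse (prob-positive nv))

        0<inv : 0# < inv
        0<inv = proj₁ (proj₂ (positive-inverse (prob-positive nv)))

        prob-inv : prob v * inv ≈ 1#
        prob-inv = proj₂ (proj₂ (positive-inverse (prob-positive nv)))

        node : ∀ {w} → Node (λ w → cutDeg (w ++ v)) w → Node deg (w ++ v)
        node root-node                  = nv
        node (child-node {w} {i} nw i<) = child-node (node nw) (proj₂ (cutDeg-< (w ++ v) i<))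

        prob-≤ : ∀ {w} → Node (λ w → cutDeg (w ++ v)) w → prob (w ++ v) ≤ prob v
        prob-≤ root-node = ≤-refl
        prob-≤ (child-node {w} {i} nw i<) = ≤-trans
          (child-prob-≤ (node nw) (proj₂ (cutDeg-< (w ++ v) i<))) (prob-≤ nw)

        A-inner′ : ∀ w → Node deg (w ++ v) → (if cut (w ++ v) then false else A (w ++ v)) ≡ true →
                   cutDeg (w ++ v) ≢ 0
        A-inner′ w nw eq =
          let ¬cut , Aw = if-then-false (cut (w ++ v)) eq
          in A-inner nw Aw ∘ ≡.trans (≡.sym (if-false ¬cut))

        step′ : ∀ w → Node deg (w ++ v) → cutDeg (w ++ v) ≢ 0 →
          ∃ λ μ → (term (w ++ v) ↪′[ (if cut (w ++ v) then false else A (w ++ v)) ] μ) ×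
            AreChildren (λ w → prob (w ++ v) * inv) (λ w → term (w ++ v)) w μ (children (λ w → cutDeg (w ++ v)) w)
        step′ w nw nz =
          let ¬cut , nz′  = cutDeg≢0 (w ++ v) nz
              μ , st , pw = cut-false (nw , nz′) ¬cut
          in μ , ≡.subst (λ b → term (w ++ v) ↪′[ b ] μ) (≡.sym (if-false ¬cut)) st ,
             ≡.subst (λ d → AreChildren _ _ w μ (applyUpTo (_∷ w) d)) (≡.sym (if-false ¬cut)) (shift pw)
          where
          shift : ∀ {μ} → AreChildren prob term (w ++ v) μ (children deg (w ++ v)) →
            AreChildren (λ w → prob (w ++ v) * inv) (λ w → term (w ++ v)) w μ (applyUpTo (_∷ w) (deg (w ++ v)))
          shift = applyUpTo-Pointwise _ λ {(q , _)} _ (eq , eq′) → trans (*-congʳ eq) (*-swapʳ (prob (w ++ v)) q inv) , eq′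

        A-infinite′ : ∀ path → IsInfinitePath (λ w → cutDeg (w ++ v)) path →
          ∀ n → ∃ λ m → n ℕ.≤ m × (if cut (path m ++ v) then false else A (path m ++ v)) ≡ true
        A-infinite′ path isPath n =
          let m , n≤m , eq = A-infinite (λ n → path n ++ v) isPath′ n
          in m , n≤m , ≡.trans (if-false (proj₁ (next′ m))) eq
          where
          open IsInfinitePath isPath
          next′ : ∀ n → cut (path n ++ v) ≡ false × path (suc n) ++ v ∈ children deg (path n ++ v)
          next′ n with ∈-children⁻ (λ w → cutDeg (w ++ v)) (next n)
          ... | i , i< , eq with cutDeg-< (path n ++ v) i<
          ...   | ¬cut , i<′ = ¬cut , ≡.subst (λ w → w ++ v ∈ children deg (path n ++ v)) (≡.sym eq) (∈.∈-applyUpTo⁺ _ i<′)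
          isPath′ : IsInfinitePath deg (λ n → path n ++ v)
          isPath′ = record { start = node start ; next = λ n → proj₂ (next′ n) }

      subtree-converges : ∀ {v} → Node deg v → ∀ {η} → 0# < η → ∃ λ n → prob v ≤ cutSum n v + prob v * η
      subtree-converges {v} nv {η} 0<η with converges′ (subtree nv) η 0<η
      ... | n , bound = n , (begin
        prob v                                ≈⟨ *-identityʳ _ ⟨
        prob v * 1#                           ≤⟨ *-monoˡ-≤ (<⇒≤ (prob-positive nv)) (x-y≤z⇒x≤z+y (<⇒≤ (proj₁ (bound n ℕ.≤-refl)))) ⟩
        prob v * (∑ (map (λ w → prob (w ++ v) * inv) leaves) + η)
          ≈⟨ *-congˡ (+-congʳ (trans (∑-cong _ _ (λ w → *-comm _ inv) leaves) (∑-*ˡ inv (λ w → prob (w ++ v)) leaves))) ⟩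
        prob v * (inv * ∑ (map (λ w → prob (w ++ v)) leaves) + η)
          ≈⟨ trans (distribˡ (prob v) _ η) (+-congʳ (sym (*-assoc (prob v) inv _))) ⟩
        (prob v * inv) * ∑ (map (λ w → prob (w ++ v)) leaves) + prob v * η
          ≈⟨ +-congʳ (trans (*-congʳ prob-inv) (*-identityˡ _)) ⟩
        ∑ (map (λ w → prob (w ++ v)) leaves) + prob v * η
          ≈⟨ +-congʳ (reflexive (≡.cong ∑ (≡.trans (List.map-∘ leaves) (≡.cong (map prob) (leavesWithin-++ cutDeg v n []))))) ⟩
        cutSum n v + prob v * η               ∎)
        where
        open ≤-Reasoning
        inv : Carrier
        inv = proj₁ (positive-inverse (prob-positive nv))
        prob-inv : prob v * inv ≈ 1#
        prob-inv = proj₂ (proj₂ (positive-inverse (prob-positive nv)))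
        leaves : List Address
        leaves = leavesWithin (λ w → cutDeg (w ++ v)) n []

    module Survival (a b η : Carrier) (0≤a : 0# ≤ a) (0≤b : 0# ≤ b) (0<η : 0# < η)
      (M : ℕ) (1≤aM : 1# ≤ a * fromℕ M) where

      open Potential X p a b 0≤a 0≤b (<⇒≤ 0<p) M

      -- j counts the cut nodes passed so far; η is the mass given up in reaching each of the
      -- at most i cut nodes still to come.
      Survives : ℕ → ℕ → (Address → Carrier) → Address → Set ℓ₂
      Survives i j f v = ∃ λ n → f v ≤ leafSum n v + prob v * (potential j (term v) + fromℕ i * η)

      private
        error-nonNegative : ∀ i → 0# ≤ fromℕ i * η
        error-nonNegative i = *-nonNegative (fromℕ-nonNegative i) (<⇒≤ 0<η)

        defect-nonNegative : ∀ {v} → Node deg v → ∀ i j → 0# ≤ prob v * (potential j (term v) + fromℕ i * η)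
        defect-nonNegative {v} nv i j = *-nonNegative (<⇒≤ (prob-positive nv))
          (+-nonNegative (potential-nonNegative j (term v)) (error-nonNegative i))

        -- The defect alone exceeds `prob v`, so the whole branch can be written off.
        survives-large : ∀ i j {v} → Node deg v → 1# ≤ potential j (term v) → Survives i j prob v
        survives-large i j {v} nv 1≤pot = 0 , (begin
          prob v                                                     ≈⟨ *-identityʳ _ ⟨
          prob v * 1#                                                ≤⟨ *-monoˡ-≤ (<⇒≤ (prob-positive nv))
            (≤-trans 1≤pot (x≤x+y _ (error-nonNegative i))) ⟩
          prob v * (potential j (term v) + fromℕ i * η)              ≈⟨ +-identityˡ _ ⟨
          0# + prob v * (potential j (term v) + fromℕ i * η)         ≤⟨ +-monoˡ-≤ _ (leafSum-nonNegative 0 nv) ⟩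
          leafSum 0 v + prob v * (potential j (term v) + fromℕ i * η) ∎)
          where open ≤-Reasoning

        survives-step : ∀ i j j′ (f : Address → Carrier) {v μ} → (nv : Node deg v) → deg v ≢ 0 → mass μ ≈ 1# →
          AreChildren prob term v μ (children deg v) → 𝔼 μ (potential j′) ≤ potential j (term v) →
          (∀ {w} → Node deg w → Survives i j′ f w) →
          ∃ λ n → ∑ (map f (children deg v)) ≤ leafSum n v + prob v * (potential j (term v) + fromℕ i * η)
        survives-step i j j′ f nv nz mass≈1 pw 𝔼≤ survives =
          let n , h = leafSum-children f (potential j′) (fromℕ i * η) nv nz pw mass≈1 survives
          in n , ≤-trans h (+-monoʳ-≤ _ (*-monoˡ-≤ (<⇒≤ (prob-positive nv)) (+-monoˡ-≤ _ 𝔼≤)))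

        Survives-resp : ∀ {i j f g v} → f v ≈ g v → Survives i j f v → Survives i j g v
        Survives-resp f≈g (n , h) = n , ≤-respˡ-≈ f≈g h

      -- Induction on the depth `n` at which the cut tree is truncated. Nodes beyond it contribute
      -- nothing, genuine leaves count in full, and at a strict step the mass passes to the children
      -- with the counter raised, where `IH` takes over.
      survives-cut : ∀ i j → (∀ {w} → Node deg w → Survives i (suc j) prob w) →
                     ∀ n {v} → Node deg v → Survives i j (cutSum n) v
      survives-cut i j IH = λ n {v} nv → byCut n nv (cut v) ≡.refl
        where
        atCut : ∀ {v} → Node deg v → cut v ≡ true → Survives i j prob v
        atCut {v} nv eq = bySize (ℕ.≤-total (X (term v)) M)
          where
          bySize : X (term v) ℕ.≤ M ⊎ M ℕ.≤ X (term v) → Survives i j prob v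
          bySize (inj₁ X≤M) =
            let (_ , nz) , μ , st , dec , pw = cut-true eq
                mass≈1 = Proper.mass≈1 (proper st)
                n , h  = survives-step i j (suc j) prob nv nz mass≈1 pw
                           (potential-decreasing (proper st) (super st) X≤M dec j) IH
            in n , ≤-respˡ-≈ (∑-children-prob pw mass≈1) h
          -- Strict concavity is lost above `M`, but there `a * X ≥ a * M ≥ 1`.
          bySize (inj₂ M≤X) = survives-large i j nv (≤-trans 1≤aM
            (≤-trans (*-monoˡ-≤ 0≤a (fromℕ-mono-≤ M≤X)) (potential≥value j (term v))))

        atLeaf : ∀ {v} → Node deg v → deg v ≡ 0 → Survives i j prob v
        atLeaf nv z = 0 , ≤-respˡ-≈ (leafSum-leaf 0 z) (x≤x+y _ (defect-nonNegative nv i j))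

        byCut : ∀ n {v} → Node deg v → (b : Bool) → cut v ≡ b → Survives i j (cutSum n) v
        byDegree : ∀ n {v} → Node deg v → cut v ≡ false → Dec (deg v ≡ 0) → Survives i j (cutSum n) v

        byCut n nv true  eq = Survives-resp {i} {j} {prob} {cutSum n} (sym (cutSum-leaf n (if-true eq))) (atCut nv eq)
        byCut n nv false eq = byDegree n nv eq (deg _ ℕ.≟ 0)

        byDegree n nv eq (yes z) =
          Survives-resp {i} {j} {prob} {cutSum n} (sym (cutSum-leaf n (≡.trans (if-false eq) z))) (atLeaf nv z)
        byDegree zero nv eq (no nz) = 0 , ≤-respˡ-≈ (sym (cutSum-zero (nz ∘ ≡.trans (≡.sym (if-false eq)))))
          (+-nonNegative (leafSum-nonNegative 0 nv) (defect-nonNegative nv i j))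
        byDegree (suc n) {v} nv eq (no nz) =
          let μ , st , pw = step nv nz
              m , h = survives-step i j j (cutSum n) nv nz (Proper.mass≈1 (proper st)) pw
                        (potential-supermartingale (proper st) (super st) j)
                        (λ {w} nw → byCut n nw (cut w) ≡.refl)
          in m , ≤-respˡ-≈ (trans
            (reflexive (≡.cong (λ d → ∑ (map (cutSum n) (applyUpTo (_∷ v) d))) (≡.sym (if-false eq))))
            (sym (cutSum-suc n (nz ∘ ≡.trans (≡.sym (if-false eq)))))) h

      -- Induction on the budget `i` of strict steps still to be followed. The sum `i + j` is
      -- invariant, so once the budget is spent the counter alone lifts the potential to one. Each
      -- round loses one more share `η` by stopping the cut tree at a finite depth.
      survives : ∀ i j → 1# ≤ c₀ * fromℕ (i ℕ.+ j) → ∀ {v} → Node deg v → Survives i j prob v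
      survives zero    j 1≤c₀j nv = survives-large 0 j nv (≤-trans 1≤c₀j (potential≥count j (term _)))
      survives (suc i) j 1≤c₀[i+j] {v} nv =
        let n , h = subtree-converges nv 0<η
            m , g = survives-cut i j (survives i (suc j)
                      (≡.subst (λ k → 1# ≤ c₀ * fromℕ k) (≡.sym (ℕ.+-suc i j)) 1≤c₀[i+j])) n nv
        in m , (begin
          prob v
            ≤⟨ h ⟩
          cutSum n v + prob v * η
            ≤⟨ +-monoˡ-≤ _ g ⟩
          (leafSum m v + prob v * (potential j (term v) + fromℕ i * η)) + prob v * η
            ≈⟨ solve 5 (λ L p G i e → (L :+ p :* (G :+ i :* e)) :+ p :* e := L :+ p :* (G :+ (con 1 :+ i) :* e)) refl
                 (leafSum m v) (prob v) (potential j (term v)) (fromℕ i) η ⟩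
          leafSum m v + prob v * (potential j (term v) + (1# + fromℕ i) * η) ∎)
        where open ≤-Reasoning

    converges : LeafProbability 𝔗 1#
    converges ε 0<ε = n , λ m n≤m → (<-≤-trans lower (leafSum-mono n≤m root-node)) ,
        ≤-<-trans (≤-respʳ-≈ prob-root (leafSum-≤-prob m root-node)) (x<x+y 1# 0<ε)
      where
      x₀ : ℕ
      x₀ = X (term [])
      -- Three quarters bound the `a`-term, the `b`-term and the accumulated error `k * η` at the
      -- root; the fourth makes the final inequality strict.
      δ,4δ≤ε : ∃ λ δ → 0# < δ × fromℕ 4 * δ ≤ ε
      δ,4δ≤ε = fraction 0<ε 4
      δ : Carrier
      δ = proj₁ δ,4δ≤ε
      0<δ : 0# < δ
      0<δ = proj₁ (proj₂ δ,4δ≤ε)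
      a,ax₀≤δ : ∃ λ a → 0# < a × fromℕ x₀ * a ≤ δ
      a,ax₀≤δ = fraction 0<δ x₀
      a : Carrier
      a = proj₁ a,ax₀≤δ
      M,1≤aM : ∃ λ M → 1# ≤ a * fromℕ M
      M,1≤aM = multiple≥1 (proj₁ (proj₂ a,ax₀≤δ))
      M : ℕ
      M = proj₁ M,1≤aM
      b,bu≤δ : ∃ λ b → 0# < b × fromℕ (capped M x₀) * b ≤ δ
      b,bu≤δ = fraction 0<δ (capped M x₀)
      b : Carrier
      b = proj₁ b,bu≤δ
      k,1≤bpk : ∃ λ k → 1# ≤ b * p * fromℕ k
      k,1≤bpk = multiple≥1 (*-positive (proj₁ (proj₂ b,bu≤δ)) 0<p)
      k : ℕ
      k = proj₁ k,1≤bpk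
      η,kη≤δ : ∃ λ η → 0# < η × fromℕ k * η ≤ δ
      η,kη≤δ = fraction 0<δ k
      η : Carrier
      η = proj₁ η,kη≤δ
      0≤a : 0# ≤ a
      0≤a = <⇒≤ (proj₁ (proj₂ a,ax₀≤δ))
      0≤b : 0# ≤ b
      0≤b = <⇒≤ (proj₁ (proj₂ b,bu≤δ))
      open Potential X p a b 0≤a 0≤b (<⇒≤ 0<p) M using (potential)
      survives₀ : ∃ λ n → prob [] ≤ leafSum n [] + prob [] * (potential 0 (term []) + fromℕ k * η)
      survives₀ = Survival.survives a b η 0≤a 0≤b (proj₁ (proj₂ η,kη≤δ)) M (proj₂ M,1≤aM) k 0
        (≡.subst (λ k → 1# ≤ b * p * fromℕ k) (≡.sym (ℕ.+-identityʳ k)) (proj₂ k,1≤bpk)) root-node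
      n : ℕ
      n = proj₁ survives₀
      open ≤-Reasoning
      lower : 1# - ε < leafSum n []
      lower = <-≤-trans (x<x+y (1# - ε) 0<δ) (≤-respˡ-≈ (+-swapʳ 1# δ (- ε)) (x≤z+y⇒x-y≤z (begin
        1# + δ
          ≤⟨ +-monoˡ-≤ δ (≤-respˡ-≈ prob-root (proj₂ survives₀)) ⟩
        (leafSum n [] + prob [] * (potential 0 (term []) + fromℕ k * η)) + δ
          ≈⟨ +-congʳ (+-congˡ (trans (*-congʳ prob-root) (*-identityˡ _))) ⟩
        (leafSum n [] + ((b * p * 0# + (a * fromℕ x₀ + b * fromℕ (capped M x₀))) + fromℕ k * η)) + δ
          ≈⟨ +-congʳ (+-congˡ (+-congʳ (trans (+-congʳ (zeroʳ _))
               (trans (+-identityˡ _) (+-cong (*-comm a _) (*-comm b _)))))) ⟩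
        (leafSum n [] + ((fromℕ x₀ * a + fromℕ (capped M x₀) * b) + fromℕ k * η)) + δ
          ≤⟨ +-monoˡ-≤ δ (+-monoʳ-≤ _ (+-mono-≤ (+-mono-≤ (proj₂ (proj₂ a,ax₀≤δ)) (proj₂ (proj₂ b,bu≤δ)))
               (proj₂ (proj₂ η,kη≤δ)))) ⟩
        (leafSum n [] + ((δ + δ) + δ)) + δ
          ≈⟨ solve 2 (λ L d → (L :+ ((d :+ d) :+ d)) :+ d
               := L :+ (con 1 :+ (con 1 :+ (con 1 :+ (con 1 :+ con 0)))) :* d) refl (leafSum n []) δ ⟩
        leafSum n [] + fromℕ 4 * δ
          ≤⟨ +-monoʳ-≤ _ (proj₂ (proj₂ δ,4δ≤ε)) ⟩
        leafSum n [] + ε ∎)))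

-- Simulation of chain trees

module Simulation {c ℓ₁ ℓ₂ : Level} (K : ArchimedeanOrderedField c ℓ₁ ℓ₂)
  (Sig : Signature) (V : Set) (D : Subset (Signature.size Sig)) where

  open OrderedFieldProperties K
  open ADPFramework K Sig V D
  open ChainTrees K Sig V D

  -- An unannotated step may be simulated by an annotated one: enlarging `A` preserves the condition
  -- on infinite paths.
  Simulates : (_⊑_ : T♯ → T♯ → Set) (_↪[_]_ _↪′[_]_ : T♯ → Bool → MultiDistribution T♯ → Set c) → Set c
  Simulates _⊑_ _↪[_]_ _↪′[_]_ = ∀ {s t b μ} → s ⊑ t → s ↪[ b ] μ →
    ∃ λ b′ → ∃ λ μ′ → (t ↪′[ b′ ] μ′) × (b ≡ true → b′ ≡ true) ×
    Pointwise (λ (q , u) (q′ , u′) → q ≡ q′ × u ⊑ u′) μ μ′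

  module _ {_⊑_ : T♯ → T♯ → Set} {_↪[_]_ _↪′[_]_ : T♯ → Bool → MultiDistribution T♯ → Set c}
    (⊑-refl : ∀ t → t ⊑ t) (simulate : Simulates _⊑_ _↪[_]_ _↪′[_]_) (𝔗 : ChainTree _↪[_]_) where

    open ChainTree 𝔗

    private
      Label : Address → Set
      Label v = ∃ λ t → term v ⊑ t

      LabelledChildren : Address → MultiDistribution T♯ → List Address → Set (c ⊔ ℓ₁)
      LabelledChildren v = Pointwise (λ (q , t) w → prob w ≈ prob v * q × term w ⊑ t)

      record SimulatedStep (v : Address) (t : T♯) : Set (c ⊔ ℓ₁) where
        field
          annotated   : Bool
          μ           : MultiDistribution T♯
          simulated   : t ↪′[ annotated ] μ
          annotated-A : A v ≡ true → annotated ≡ true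
          labels      : LabelledChildren v μ (children deg v)

      open SimulatedStep

      relabel : ∀ {v μ μ′ ws} → AreChildren prob term v μ ws →
                Pointwise (λ (q , u) (q′ , u′) → q ≡ q′ × u ⊑ u′) μ μ′ → LabelledChildren v μ′ ws
      relabel []                       []                    = []
      relabel ((eq , ≡.refl) ∷ pw) ((≡.refl , u⊑u′) ∷ pw′) = (eq , u⊑u′) ∷ relabel pw pw′

      simulateAt : ∀ {v} → InnerNode deg v → (l : Label v) → SimulatedStep v (proj₁ l)
      simulateAt (nv , nz) (t , v⊑t) =
        let _ , st , pw                = step nv nz
            b′ , μ′ , st′ , mono , pw′ = simulate v⊑t st
        in record { annotated = b′ ; μ = μ′ ; simulated = st′ ; annotated-A = mono ; labels = relabel pw pw′ }

      childLabel : ∀ {v μ} f n → LabelledChildren v μ (applyUpTo f n) → ∀ i → Label (f i)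
      childLabel f zero    _        i       = term (f i) , ⊑-refl _
      childLabel f (suc n) ((_ , l) ∷ _)  zero    = _ , l
      childLabel f (suc n) (_ ∷ ls) (suc i) = childLabel (f ∘ suc) n ls i

      nextLabel : ∀ {v} → Dec (InnerNode deg v) → Label v → ∀ i → Label (i ∷ v)
      nextLabel     (no _)      _ i = _ , ⊑-refl _
      nextLabel {v} (yes inner) l i = childLabel (_∷ v) (deg v) (labels (simulateAt inner l)) i

      -- The terms of the new tree are found along the address from the root: the simulated step at
      -- a node determines the terms of all its children at once. Addresses outside the tree keep
      -- their old term as a default.
      label : ∀ v → Label v
      label []      = _ , ⊑-refl _
      label (i ∷ v) = nextLabel (InnerNode? deg v) (label v) i

      annotatedAt : ∀ {v} → Dec (InnerNode deg v) → Label v → Bool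
      annotatedAt (no _)      _ = false
      annotatedAt (yes inner) l = annotated (simulateAt inner l)

      annotatedAt-inner : ∀ {v} (d : Dec (InnerNode deg v)) l → annotatedAt d l ≡ true → InnerNode deg v
      annotatedAt-inner (yes inner) _ _ = inner

      annotatedAt-A : ∀ {v} (d : Dec (InnerNode deg v)) l → InnerNode deg v → A v ≡ true → annotatedAt d l ≡ true
      annotatedAt-A (no ¬inner) _ inner = contradiction inner ¬inner
      annotatedAt-A (yes inner) l _     = annotated-A (simulateAt inner l)

      childLabels : ∀ {v μ} (term′ : Address → T♯) f n (ls : LabelledChildren v μ (applyUpTo f n)) →
        (∀ i → term′ (f i) ≡ proj₁ (childLabel f n ls i)) → AreChildren prob term′ v μ (applyUpTo f n)
      childLabels term′ f zero    []               eqs = []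
      childLabels term′ f (suc n) ((eq , l) ∷ ls) eqs = (eq , eqs 0) ∷ childLabels term′ (f ∘ suc) n ls (eqs ∘ suc)

      stepAt : ∀ {v} (term′ : Address → T♯) (d : Dec (InnerNode deg v)) l → InnerNode deg v →
        (∀ i → term′ (i ∷ v) ≡ proj₁ (nextLabel d l i)) →
        ∃ λ μ → (proj₁ l ↪′[ annotatedAt d l ] μ) × AreChildren prob term′ v μ (children deg v)
      stepAt term′ (no ¬inner) l inner _ = contradiction inner ¬inner
      stepAt {v} term′ (yes inner) l _ eqs =
        _ , simulated (simulateAt inner l) , childLabels term′ (_∷ v) (deg v) (labels (simulateAt inner l)) eqs

      path-inner : ∀ path → IsInfinitePath deg path → ∀ n → InnerNode deg (path n)
      path-inner path isPath n = nodes n , nz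
        where
        open IsInfinitePath isPath
        nodes : ∀ n → Node deg (path n)
        nodes zero = start
        nodes (suc n) =
          let i , i< , eq = ∈-children⁻ deg (next n) in ≡.subst (Node deg) (≡.sym eq) (child-node (nodes n) i<)
        nz : deg (path n) ≢ 0
        nz = let _ , i< , _ = ∈-children⁻ deg (next n) in ℕ.>⇒≢ (ℕ.≤-<-trans ℕ.z≤n i<)

    simulatingTree : ChainTree _↪′[_]_
    simulatingTree = record
      { deg           = deg
      ; prob          = prob
      ; term          = proj₁ ∘ label
      ; A             = λ v → annotatedAt (InnerNode? deg v) (label v)
      ; prob-root     = prob-root
      ; prob-positive = prob-positive
      ; prob-≤1       = prob-≤1
      ; A-inner       = λ {v} _ eq → proj₂ (annotatedAt-inner (InnerNode? deg v) (label v) eq)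
      ; step          = λ {v} nv nz → stepAt (proj₁ ∘ label) (InnerNode? deg v) (label v) (nv , nz) (λ _ → ≡.refl)
      ; A-infinite    = λ path isPath n →
          let m , n≤m , eq = A-infinite path isPath n
          in m , n≤m , annotatedAt-A (InnerNode? deg (path m)) (label (path m)) (path-inner path isPath m) eq
      }

  simulation-converges : ∀ {_⊑_ : T♯ → T♯ → Set} {_↪[_]_ _↪′[_]_ : T♯ → Bool → MultiDistribution T♯ → Set c} →
    (∀ t → t ⊑ t) → Simulates _⊑_ _↪[_]_ _↪′[_]_ →
    ((𝔗 : ChainTree _↪′[_]_) → LeafProbability 𝔗 1#) → (𝔗 : ChainTree _↪[_]_) → LeafProbability 𝔗 1#
  simulation-converges ⊑-refl simulate converges 𝔗 = converges (simulatingTree ⊑-refl simulate 𝔗)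

-- Annotations and their polynomial weight

module _ where

  open ≡ using (refl; sym; trans; cong; cong₂; subst)
  open import Data.Nat.Base using (_+_; _*_; _≤_; z≤n)

  module _ {A : Set} where

    nth-modifyNth-id : ∀ {n} (xs : Vec A n) i {x} {g : A → A} → nth xs i ≡ just x → g x ≡ x → modifyNth i g xs ≡ xs
    nth-modifyNth-id (x ∷ xs) zero    refl eq = cong (_∷ xs) eq
    nth-modifyNth-id (x ∷ xs) (suc i) at   eq = cong (x ∷_) (nth-modifyNth-id xs i at eq)

    modifyNth-∘ : ∀ {n} (xs : Vec A n) i {f g : A → A} → modifyNth i f (modifyNth i g xs) ≡ modifyNth i (f ∘ g) xs
    modifyNth-∘ []       i       = refl
    modifyNth-∘ (x ∷ xs) zero    = refl
    modifyNth-∘ (x ∷ xs) (suc i) = cong (x ∷_) (modifyNth-∘ xs i)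

  module _ {Op : Set} {ar : Op → ℕ} {V : Set} where

    foldAll-nth : ∀ {A : Set} (v : V → A) c {n} (ts : Vec (Term ar V) n) i →
                  nth (foldAll v c ts) i ≡ Maybe.map (fold v c) (nth ts i)
    foldAll-nth v c []       i       = refl
    foldAll-nth v c (t ∷ ts) zero    = refl
    foldAll-nth v c (t ∷ ts) (suc i) = foldAll-nth v c ts i

    []at-self : ∀ (s : Term ar V) π {u} → s ∣ π ≡ just u → s [ u ]at π ≡ s
    []at-self s          []      refl = refl
    []at-self (con f ts) (i ∷ π) at with nth ts i in eq
    ... | just t = cong (con f) (nth-modifyNth-id ts i eq ([]at-self t π at))

    ∣-++ : ∀ (t : Term ar V) π τ → t ∣ (π ++ τ) ≡ (t ∣ π >>= (_∣ τ))
    ∣-++ t          []      τ = refl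
    ∣-++ (var x)    (i ∷ π) τ = refl
    ∣-++ (con f ts) (i ∷ π) τ with nth ts i
    ... | nothing = refl
    ... | just t  = ∣-++ t π τ

    ∣-subst : ∀ (t : Term ar V) (σ : V → Term ar V) π {u} → t ∣ π ≡ just u → (t [ σ ]) ∣ π ≡ just (u [ σ ])
    ∣-subst t          σ []      refl = refl
    ∣-subst (con f ts) σ (i ∷ π) at with nth ts i in eq
    ... | just t rewrite foldAll-nth σ con ts i | eq = ∣-subst t σ π at

    -- The summand also sees the position: descending into an argument prefixes positions, and the
    -- recursion equations below shift `G` accordingly.
    occurrenceSum : (Term ar V → Bool) → (Position × Term ar V → ℕ) → Term ar V → ℕ
    occurrenceSum p G t = sum (map G (occurrencesWhere p t))

    occurrenceSumFrom : ∀ {n} → ℕ → (Term ar V → Bool) → (Position × Term ar V → ℕ) → Vec (Term ar V) n → ℕ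
    occurrenceSumFrom i p G ts = sum (map G (filterᵇ (p ∘ proj₂) (occurrencesFrom i ts)))

    private
      sum-filterᵇ-map : ∀ {A B : Set} (q : B → Bool) (G : B → ℕ) (f : A → B) xs →
        sum (map G (filterᵇ q (map f xs))) ≡ sum (map (G ∘ f) (filterᵇ (q ∘ f) xs))
      sum-filterᵇ-map q G f []       = refl
      sum-filterᵇ-map q G f (x ∷ xs) with q (f x)
      ... | true  = cong (G (f x) +_) (sum-filterᵇ-map q G f xs)
      ... | false = sum-filterᵇ-map q G f xs

      filterᵇ-++ : ∀ {A : Set} (q : A → Bool) xs ys → filterᵇ q (xs ++ ys) ≡ filterᵇ q xs ++ filterᵇ q ys
      filterᵇ-++ q []       ys = refl
      filterᵇ-++ q (x ∷ xs) ys with q x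
      ... | true  = cong (x ∷_) (filterᵇ-++ q xs ys)
      ... | false = filterᵇ-++ q xs ys

    occurrenceSum-con : ∀ p G f ts → occurrenceSum p G (con f ts) ≡
      (if p (con f ts) then G ([] , con f ts) else 0) + occurrenceSumFrom 0 p G ts
    occurrenceSum-con p G f ts with p (con f ts)
    ... | true  = refl
    ... | false = refl

    occurrenceSumFrom-∷ : ∀ {n} i p G t (ts : Vec (Term ar V) n) → occurrenceSumFrom i p G (t ∷ ts) ≡
      occurrenceSum p (λ (π , u) → G (i ∷ π , u)) t + occurrenceSumFrom (suc i) p G ts
    occurrenceSumFrom-∷ i p G t ts = begin
      sum (map G (filterᵇ q (shifted ++ rest)))                        ≡⟨ cong (sum ∘ map G) (filterᵇ-++ q shifted rest) ⟩
      sum (map G (filterᵇ q shifted ++ filterᵇ q rest))                ≡⟨ cong sum (List.map-++ G (filterᵇ q shifted) _) ⟩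
      sum (map G (filterᵇ q shifted) ++ map G (filterᵇ q rest))        ≡⟨ sum-++ (map G (filterᵇ q shifted)) _ ⟩
      sum (map G (filterᵇ q shifted)) + sum (map G (filterᵇ q rest))   ≡⟨ cong (_+ _) (sum-filterᵇ-map q G _ (occurrences t)) ⟩
      occurrenceSum p (λ (π , u) → G (i ∷ π , u)) t + occurrenceSumFrom (suc i) p G ts ∎
      where
      open ≡.≡-Reasoning
      q = p ∘ proj₂
      shifted = map (λ (π , u) → i ∷ π , u) (occurrences t)
      rest = occurrencesFrom (suc i) ts

    private
      con-∣ : (ℕ → Maybe (Term ar V)) → Position → Maybe (Term ar V)
      con-∣ N []      = nothing
      con-∣ N (i ∷ π) = N i >>= (_∣ π)

      at-con : ∀ f ts π {u} → con-∣ (nth ts) π ≡ just u → con f ts ∣ π ≡ just u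
      at-con f ts (i ∷ π) at = at

    mutual
      occurrences-sound : ∀ (t : Term ar V) → All (λ (π , u) → t ∣ π ≡ just u) (occurrences t)
      occurrences-sound (var x)    = refl ∷ []
      occurrences-sound (con f ts) = refl ∷ All.map (λ {(π , _)} → at-con f ts π) (occurrencesFrom-sound 0 ts (nth ts) (λ _ → refl))

      -- N plays the role of nth on a vector of which ts is the suffix from index i on.
      occurrencesFrom-sound : ∀ {n} i (ts : Vec (Term ar V) n) (N : ℕ → Maybe (Term ar V)) →
        (∀ k → N (i + k) ≡ nth ts k) →
        All (λ (π , u) → (con-∣ N π) ≡ just u) (occurrencesFrom i ts)
      occurrencesFrom-sound i []       N eq = []
      occurrencesFrom-sound i (t ∷ ts) N eq = All.++⁺
        (All.map⁺ (All.map (λ {(π , u)} at → trans (cong (_>>= (_∣ π)) (trans (cong N (sym (ℕ.+-identityʳ i))) (eq 0))) at)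
          (occurrences-sound t)))
        (occurrencesFrom-sound (suc i) ts N (λ k → trans (cong N (sym (ℕ.+-suc i k))) (eq (suc k))))

    private
      sum-filterᵇ-mono : ∀ {A : Set} (q : A → Bool) {G H : A → ℕ} {xs} →
        All (λ x → q x ≡ true → G x ≤ H x) xs → sum (map G (filterᵇ q xs)) ≤ sum (map H (filterᵇ q xs))
      sum-filterᵇ-mono q []                = z≤n
      sum-filterᵇ-mono q {xs = x ∷ _} (h ∷ hs) with q x
      ... | true  = ℕ.+-mono-≤ (h refl) (sum-filterᵇ-mono q hs)
      ... | false = sum-filterᵇ-mono q hs

    occurrenceSum-mono : ∀ p {G H} (t : Term ar V) →
      (∀ {π u} → t ∣ π ≡ just u → p u ≡ true → G (π , u) ≤ H (π , u)) → occurrenceSum p G t ≤ occurrenceSum p H t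
    occurrenceSum-mono p t G≤H = sum-filterᵇ-mono (p ∘ proj₂) (All.map (λ at → G≤H at) (occurrences-sound t))

  module _ where

    open +-*-Solver using (solve; _:=_; _:+_; _:*_)

    private
      power-affine : ∀ e → e ≤ 1 → ∃ λ A → ∃ λ B → ∀ y → y ℕ.^ e ≡ A + B * y
      power-affine 0 _ = 1 , 0 , λ y → refl
      power-affine 1 _ = 0 , 1 , λ y → trans (ℕ.*-identityʳ y) (sym (ℕ.+-identityʳ y))
      power-affine (suc (suc _)) (ℕ.s≤s ())

      powers-affine : ∀ {n} (es : Vec ℕ n) → VecAll.All (_≤ 1) es → ∀ xs i → ∃ λ A → ∃ λ B → ∀ y →
        Vec.foldr′ _*_ 1 (Vec.zipWith ℕ._^_ (modifyNth i (const y) xs) es) ≡ A + B * y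
      powers-affine []       _          []       i    = 1 , 0 , λ y → refl
      powers-affine (e ∷ es) (e≤1 VecAll.∷ _) (x ∷ xs) zero =
        let A , B , eq = power-affine e e≤1
            P          = Vec.foldr′ _*_ 1 (Vec.zipWith ℕ._^_ xs es)
        in A * P , B * P , λ y → trans (cong (_* P) (eq y))
             (solve 4 (λ A B P y → (A :+ B :* y) :* P := A :* P :+ B :* P :* y) refl A B P y)
      powers-affine (e ∷ es) (_ VecAll.∷ es≤1) (x ∷ xs) (suc i) =
        let A , B , eq = powers-affine es es≤1 xs i
        in x ℕ.^ e * A , x ℕ.^ e * B , λ y → trans (cong (x ℕ.^ e *_) (eq y))
             (solve 4 (λ A B P y → P :* (A :+ B :* y) := P :* A :+ P :* B :* y) refl A B (x ℕ.^ e) y)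

    -- Exponents at most one leave every monomial affine in the `i`-th argument when the others are
    -- fixed; an index out of range gives a constant. This is where multilinearity enters, as affine
    -- maps commute with expectations.
    multilinear-affine : ∀ {n} (p : Polynomial n) → MultilinearPolynomial p → ∀ xs i → ∃ λ A → ∃ λ B → ∀ y →
      evalPolynomial p (modifyNth i (const y) xs) ≡ A + B * y
    multilinear-affine []             []           xs i = 0 , 0 , λ y → refl
    multilinear-affine ((c , es) ∷ p) (es≤1 ∷ lin) xs i =
      let A , B , eq    = powers-affine es es≤1 xs i
          A′ , B′ , eq′ = multilinear-affine p lin xs i
      in c * A + A′ , c * B + B′ , λ y → trans (cong₂ (λ u v → c * u + v) (eq y) (eq′ y))
           (solve 6 (λ c A B A′ B′ y → c :* (A :+ B :* y) :+ (A′ :+ B′ :* y) := c :* A :+ A′ :+ (c :* B :+ B′) :* y)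
             refl c A B A′ B′ y)

  if-∨ : ∀ b b₁ b₂ {n} → (b ≡ true → b₁ ≡ true ⊎ b₂ ≡ true) →
         (if b then n else 0) ≤ (if b₁ then n else 0) + (if b₂ then n else 0)
  if-∨ false b₁    b₂    h = z≤n
  if-∨ true  true  b₂    h = ℕ.m≤m+n _ _
  if-∨ true  false true  h = ℕ.≤-refl
  if-∨ true  false false h with h refl
  ... | inj₁ ()
  ... | inj₂ ()

module Annotations {c ℓ₁ ℓ₂ : Level} (K : ArchimedeanOrderedField c ℓ₁ ℓ₂)
  (Sig : Signature) (V : Set) (D : Subset (Signature.size Sig)) where

  open ≡ using (refl; sym; trans; cong; cong₂; subst)
  open import Data.Nat.Base using (_+_; _*_; _≤_; z≤n)
  open ADPFramework K Sig V D
  open Signature Sig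

  ⌈_⌉ⱽ : ∀ {n} → Vec T n → Vec T♯ n
  ⌈_⌉ⱽ = foldAll var (λ f → con (f , nothing))

  ♭ⱽ : ∀ {n} → Vec T♯ n → Vec T n
  ♭ⱽ = foldAll var (λ f → con (proj₁ f))

  mutual
    ♭-⌈⌉ : ∀ t → ♭ ⌈ t ⌉ ≡ t
    ♭-⌈⌉ (var x)    = refl
    ♭-⌈⌉ (con f ts) = cong (con f) (♭-⌈⌉-all ts)

    ♭-⌈⌉-all : ∀ {n} (ts : Vec T n) →
      ♭ⱽ ⌈ ts ⌉ⱽ ≡ ts
    ♭-⌈⌉-all []       = refl
    ♭-⌈⌉-all (t ∷ ts) = cong₂ _∷_ (♭-⌈⌉ t) (♭-⌈⌉-all ts)

  mutual
    ♭-subst : ∀ r σ → ♭ (r ⟨ σ ⟩♯) ≡ ♭ r ⟨ σ ⟩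
    ♭-subst (var x)    σ = ♭-⌈⌉ (apply σ x)
    ♭-subst (con f ts) σ = cong (con (proj₁ f)) (♭-subst-all ts σ)

    ♭-subst-all : ∀ {n} (ts : Vec T♯ n) σ →
      ♭ⱽ (foldAll (⌈_⌉ ∘ apply σ) con ts) ≡
      foldAll (apply σ) con (♭ⱽ ts)
    ♭-subst-all []       σ = refl
    ♭-subst-all (t ∷ ts) σ = cong₂ _∷_ (♭-subst t σ) (♭-subst-all ts σ)

  mutual
    ♭-annotate : ∀ Φ t → ♭ (annotate Φ t) ≡ ♭ t
    ♭-annotate Φ (var x)    = refl
    ♭-annotate Φ (con f ts) = cong (con (proj₁ f)) (♭-annotateFrom 0 Φ ts)

    ♭-annotateFrom : ∀ {n} i Φ (ts : Vec T♯ n) →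
      ♭ⱽ (annotateFrom i Φ ts) ≡ ♭ⱽ ts
    ♭-annotateFrom i Φ []       = refl
    ♭-annotateFrom i Φ (t ∷ ts) = cong₂ _∷_ (♭-annotate (Φ ∘ (i ∷_)) t) (♭-annotateFrom (suc i) Φ ts)

  mutual
    annotate-⌈♭⌉ : ∀ Φ t → annotate Φ ⌈ ♭ t ⌉ ≡ annotate Φ t
    annotate-⌈♭⌉ Φ (var x)    = refl
    annotate-⌈♭⌉ Φ (con f ts) = cong (con _) (annotateFrom-⌈♭⌉ 0 Φ ts)

    annotateFrom-⌈♭⌉ : ∀ {n} i Φ (ts : Vec T♯ n) →
      annotateFrom i Φ ⌈ ♭ⱽ ts ⌉ⱽ ≡
      annotateFrom i Φ ts
    annotateFrom-⌈♭⌉ i Φ []       = refl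
    annotateFrom-⌈♭⌉ i Φ (t ∷ ts) = cong₂ _∷_ (annotate-⌈♭⌉ (Φ ∘ (i ∷_)) t) (annotateFrom-⌈♭⌉ (suc i) Φ ts)

  -- `annotate` overwrites all existing annotations, so only the underlying term matters. This is
  -- why an unannotated step of full rewriting cannot tell an ADP from its erased version.
  annotate-cong-♭ : ∀ Φ {s t} → ♭ s ≡ ♭ t → annotate Φ s ≡ annotate Φ t
  annotate-cong-♭ Φ {s} {t} eq = trans (sym (annotate-⌈♭⌉ Φ s)) (trans (cong (annotate Φ ∘ ⌈_⌉) eq) (annotate-⌈♭⌉ Φ t))

  mutual
    annotate-none : ∀ Φ → (∀ π → Φ π ≡ false) → ∀ t → annotate Φ t ≡ ⌈ ♭ t ⌉
    annotate-none Φ ¬Φ (var x)    = refl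
    annotate-none Φ ¬Φ (con f ts) = cong₂ (λ b us → con (annotateSymbol b f) us) (¬Φ []) (annotateFrom-none 0 Φ (λ i π _ → ¬Φ (i ∷ π)) ts)

    annotateFrom-none : ∀ {n} i Φ → (∀ j π → i ≤ j → Φ (j ∷ π) ≡ false) → (ts : Vec T♯ n) → annotateFrom i Φ ts ≡
      ⌈ ♭ⱽ ts ⌉ⱽ
    annotateFrom-none i Φ ¬Φ []       = refl
    annotateFrom-none i Φ ¬Φ (t ∷ ts) =
      cong₂ _∷_ (annotate-none (Φ ∘ (i ∷_)) (λ π → ¬Φ i π ℕ.≤-refl) t)
      (annotateFrom-none (suc i) Φ (λ j π → ¬Φ j π ∘ ℕ.<⇒≤) ts)

  private
    ♭ⱽ-nth : ∀ {n} (ts : Vec T♯ n) i → nth (♭ⱽ ts) i ≡ Maybe.map ♭ (nth ts i)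
    ♭ⱽ-nth = foldAll-nth var _

    ⌈⌉ⱽ-nth : ∀ {n} (ts : Vec T n) i → nth ⌈ ts ⌉ⱽ i ≡ Maybe.map ⌈_⌉ (nth ts i)
    ⌈⌉ⱽ-nth = foldAll-nth var _

  ♭-∣ : ∀ t π → ♭ t ∣ π ≡ Maybe.map ♭ (t ∣ π)
  ♭-∣ t          []      = refl
  ♭-∣ (var x)    (i ∷ π) = refl
  ♭-∣ (con f ts) (i ∷ π) rewrite ♭ⱽ-nth ts i with nth ts i
  ... | nothing = refl
  ... | just t  = ♭-∣ t π

  ⌈⌉-∣ : ∀ t π → ⌈ t ⌉ ∣ π ≡ Maybe.map ⌈_⌉ (t ∣ π)
  ⌈⌉-∣ t          []      = refl
  ⌈⌉-∣ (var x)    (i ∷ π) = refl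
  ⌈⌉-∣ (con f ts) (i ∷ π) rewrite ⌈⌉ⱽ-nth ts i with nth ts i
  ... | nothing = refl
  ... | just t  = ⌈⌉-∣ t π

  ♯-con : ∀ f ts → con f ts ♯ ≡ con (annotateSymbol true (f , nothing)) ⌈ ts ⌉ⱽ
  ♯-con f ts = cong (con _) (trans (annotateFrom-none 0 _ (λ _ _ _ → refl) ⌈ ts ⌉ⱽ) (cong ⌈_⌉ⱽ (♭-⌈⌉-all ts)))

  private
    isAnnotatedSymbol : Bool → Symbol → Bool
    isAnnotatedSymbol b f = is-just (proj₂ (annotateSymbol b (f , nothing)))

  module Interpretation (Pol : PolynomialInterpretation) where

    val val♯ : T → Valuation → ℕ
    val  t x = value Pol ⌈ t ⌉ x
    val♯ t x = value Pol (t ♯) x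

    vals : ∀ {n} → Vec T n → Valuation → Vec ℕ n
    vals ts x = foldAll x (λ f → evalPolynomial (Pol f)) ⌈ ts ⌉ⱽ

    S : T♯ → Valuation → ℕ
    S = Sum Pol

    S-all : ∀ {n} → Vec T♯ n → Valuation → ℕ
    S-all []       x = 0
    S-all (t ∷ ts) x = S t x + S-all ts x

    infixl 8 _∘ᵛ_
    -- The valuation at which the conditions on an ADP are applied when its instance under `σ` is
    -- evaluated at `x`.
    _∘ᵛ_ : Valuation → Substitution → Valuation
    (x ∘ᵛ σ) v = val (apply σ v) x

    val♯-con : ∀ f ts x → val♯ (con f ts) x ≡ evalPolynomial (Pol (annotateSymbol true (f , nothing))) (vals ts x)
    val♯-con f ts x = cong (λ t → value Pol t x) (♯-con f ts)

    mutual
      val-subst : ∀ t σ x → val (t ⟨ σ ⟩) x ≡ val t (x ∘ᵛ σ)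
      val-subst (var v)    σ x = refl
      val-subst (con f ts) σ x = cong (evalPolynomial (Pol (f , nothing))) (vals-subst ts σ x)

      vals-subst : ∀ {n} (ts : Vec T n) σ x → vals (foldAll (apply σ) con ts) x ≡ vals ts (x ∘ᵛ σ)
      vals-subst []       σ x = refl
      vals-subst (t ∷ ts) σ x = cong₂ _∷_ (val-subst t σ x) (vals-subst ts σ x)

    -- For a variable the annotated root would come from `σ`; otherwise annotating the root commutes
    -- with substitution.
    val♯-subst : ∀ t σ x → isVar t ≡ false → val♯ (t ⟨ σ ⟩) x ≡ val♯ t (x ∘ᵛ σ)
    val♯-subst (con f ts) σ x _ = trans (val♯-con f (foldAll (apply σ) con ts) x)
      (trans (cong (evalPolynomial (Pol (annotateSymbol true (f , nothing)))) (vals-subst ts σ x)) (sym (val♯-con f ts (x ∘ᵛ σ))))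

    S-con : ∀ f m ts x → S (con (f , m) ts) x ≡ (if is-just m then val♯ (con f (♭ⱽ ts)) x else 0) + S-all ts x
    S-con f m ts x = trans (occurrenceSum-con isAnnotated G (f , m) ts)
      (cong ((if is-just m then val♯ (con f (♭ⱽ ts)) x else 0) +_) (all 0 ts))
      where
      G : Position × T♯ → ℕ
      G (_ , u) = val♯ (♭ u) x
      all : ∀ {n} i (ts : Vec T♯ n) → occurrenceSumFrom i isAnnotated G ts ≡ S-all ts x
      all i []       = refl
      all i (t ∷ ts) = trans (occurrenceSumFrom-∷ i isAnnotated G t ts) (cong (_ +_) (all (suc i) ts))

    mutual
      S-⌈⌉ : ∀ t x → S ⌈ t ⌉ x ≡ 0
      S-⌈⌉ (var v)    x = refl
      S-⌈⌉ (con f ts) x = trans (S-con f nothing ⌈ ts ⌉ⱽ x) (S-all-⌈⌉ ts x)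

      S-all-⌈⌉ : ∀ {n} (ts : Vec T n) x → S-all ⌈ ts ⌉ⱽ x ≡ 0
      S-all-⌈⌉ []       x = refl
      S-all-⌈⌉ (t ∷ ts) x = cong₂ _+_ (S-⌈⌉ t x) (S-all-⌈⌉ ts x)

    mutual
      S-subst : ∀ r σ x → S (r ⟨ σ ⟩♯) x ≡ S r (x ∘ᵛ σ)
      S-subst (var v)          σ x = S-⌈⌉ (apply σ v) x
      S-subst (con (f , m) ts) σ x = begin
        S (con (f , m) (foldAll (⌈_⌉ ∘ apply σ) con ts)) x
          ≡⟨ S-con f m _ x ⟩
        (if is-just m then val♯ (con f (♭ⱽ (foldAll (⌈_⌉ ∘ apply σ) con ts))) x else 0) + S-all (foldAll (⌈_⌉ ∘ apply σ) con ts) x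
          ≡⟨ cong₂ (λ v s → (if is-just m then v else 0) + s)
               (trans (cong (λ us → val♯ (con f us) x) (♭-subst-all ts σ)) (val♯-subst (con f (♭ⱽ ts)) σ x refl))
               (S-all-subst ts σ x) ⟩
        (if is-just m then val♯ (con f (♭ⱽ ts)) (x ∘ᵛ σ) else 0) + S-all ts (x ∘ᵛ σ)
          ≡⟨ S-con f m ts _ ⟨
        S (con (f , m) ts) (x ∘ᵛ σ) ∎
        where open ≡.≡-Reasoning

      S-all-subst : ∀ {n} (ts : Vec T♯ n) σ x → S-all (foldAll (⌈_⌉ ∘ apply σ) con ts) x ≡ S-all ts (x ∘ᵛ σ)
      S-all-subst []       σ x = refl
      S-all-subst (t ∷ ts) σ x = cong₂ _+_ (S-subst t σ x) (S-all-subst ts σ x)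

    S-annotate-con : ∀ Φ f m ts x → S (annotate Φ (con (f , m) ts)) x ≡
      (if isAnnotatedSymbol (Φ []) f then val♯ (con f (♭ⱽ ts)) x else 0) + S-all (annotateFrom 0 Φ ts) x
    S-annotate-con Φ f m ts x = trans (S-con f _ (annotateFrom 0 Φ ts) x)
      (cong (λ us → (if isAnnotatedSymbol (Φ []) f then val♯ (con f us) x else 0) + S-all (annotateFrom 0 Φ ts) x)
        (♭-annotateFrom 0 Φ ts))

    private
      isAnnotatedSymbol-∨ : ∀ f {b b₁ b₂} → (b ≡ true → b₁ ≡ true ⊎ b₂ ≡ true) →
        isAnnotatedSymbol b f ≡ true → isAnnotatedSymbol b₁ f ≡ true ⊎ isAnnotatedSymbol b₂ f ≡ true
      isAnnotatedSymbol-∨ f {true} h eq with h refl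
      ... | inj₁ refl = inj₁ eq
      ... | inj₂ refl = inj₂ eq

      if≤ : ∀ b {n} → (if b then n else 0) ≤ n
      if≤ true  = ℕ.≤-refl
      if≤ false = z≤n

    mutual
      S-annotate-∨ : ∀ {Φ Φ₁ Φ₂} → (∀ π → Φ π ≡ true → Φ₁ π ≡ true ⊎ Φ₂ π ≡ true) → ∀ t x →
        S (annotate Φ t) x ≤ S (annotate Φ₁ t) x + S (annotate Φ₂ t) x
      S-annotate-∨ h (var v)    x = z≤n
      S-annotate-∨ {Φ} {Φ₁} {Φ₂} h (con (f , m) ts) x = begin
        S (annotate Φ (con (f , m) ts)) x
          ≡⟨ S-annotate-con Φ f m ts x ⟩
        top Φ + rest Φ
          ≤⟨ ℕ.+-mono-≤ (if-∨ _ (isAnnotatedSymbol (Φ₁ []) f) _ (isAnnotatedSymbol-∨ f (h [])))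
                        (S-all-annotate-∨ 0 h ts x) ⟩
        (top Φ₁ + top Φ₂) + (rest Φ₁ + rest Φ₂)
          ≡⟨ solve 4 (λ a b c d → (a :+ b) :+ (c :+ d) := (a :+ c) :+ (b :+ d)) refl (top Φ₁) (top Φ₂) (rest Φ₁) (rest Φ₂) ⟩
        (top Φ₁ + rest Φ₁) + (top Φ₂ + rest Φ₂)
          ≡⟨ cong₂ _+_ (S-annotate-con Φ₁ f m ts x) (S-annotate-con Φ₂ f m ts x) ⟨
        S (annotate Φ₁ (con (f , m) ts)) x + S (annotate Φ₂ (con (f , m) ts)) x ∎
        where
        open ℕ.≤-Reasoning
        open +-*-Solver using (solve; _:=_; _:+_)
        top rest : (Position → Bool) → ℕ
        top Φ = if isAnnotatedSymbol (Φ []) f then val♯ (con f (♭ⱽ ts)) x else 0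
        rest Φ = S-all (annotateFrom 0 Φ ts) x

      S-all-annotate-∨ : ∀ {n} i {Φ Φ₁ Φ₂} → (∀ π → Φ π ≡ true → Φ₁ π ≡ true ⊎ Φ₂ π ≡ true) → ∀ (ts : Vec T♯ n) x →
        S-all (annotateFrom i Φ ts) x ≤ S-all (annotateFrom i Φ₁ ts) x + S-all (annotateFrom i Φ₂ ts) x
      S-all-annotate-∨ i h []       x = z≤n
      S-all-annotate-∨ i {Φ} {Φ₁} {Φ₂} h (t ∷ ts) x = ℕ.≤-trans
        (ℕ.+-mono-≤ (S-annotate-∨ {Φ ∘ (i ∷_)} {Φ₁ ∘ (i ∷_)} {Φ₂ ∘ (i ∷_)} (h ∘ (i ∷_)) t x) (S-all-annotate-∨ (suc i) h ts x))
        (ℕ.≤-reflexive (solve 4 (λ a b c d → (a :+ b) :+ (c :+ d) := (a :+ c) :+ (b :+ d)) refl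
          (S (annotate (Φ₁ ∘ (i ∷_)) t) x) (S (annotate (Φ₂ ∘ (i ∷_)) t) x)
          (S-all (annotateFrom (suc i) Φ₁ ts) x) (S-all (annotateFrom (suc i) Φ₂ ts) x)))
        where open +-*-Solver using (solve; _:=_; _:+_)

    -- An upper bound for what annotating `π` can add to `S`: undefined symbols and variables take
    -- no annotation, and paths outside `t` weigh zero.
    weight : T♯ → Valuation → Position → ℕ
    weight t x π = maybe′ (λ u → val♯ (♭ u) x) 0 (t ∣ π)

    S-annotate-none : ∀ Φ → (∀ π → Φ π ≡ false) → ∀ t x → S (annotate Φ t) x ≡ 0
    S-annotate-none Φ ¬Φ t x = trans (cong (λ t → S t x) (annotate-none Φ ¬Φ t)) (S-⌈⌉ (♭ t) x)

    private
      S-all-annotate-none : ∀ {n} i Φ → (∀ j π → i ≤ j → Φ (j ∷ π) ≡ false) → ∀ (ts : Vec T♯ n) x →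
        S-all (annotateFrom i Φ ts) x ≡ 0
      S-all-annotate-none i Φ ¬Φ ts x = trans (cong (λ ts → S-all ts x) (annotateFrom-none i Φ ¬Φ ts)) (S-all-⌈⌉ (♭ⱽ ts) x)

      ≢true⇒≡false : ∀ {b} → b ≢ true → b ≡ false
      ≢true⇒≡false {true}  h = contradiction refl h
      ≢true⇒≡false {false} h = refl

    mutual
      S-annotate-singleton : ∀ Φ ρ → (∀ π → Φ π ≡ true → π ≡ ρ) → ∀ t x → S (annotate Φ t) x ≤ weight t x ρ
      S-annotate-singleton Φ ρ h (var v) x = z≤n
      S-annotate-singleton Φ [] h (con (f , m) ts) x = begin
        S (annotate Φ (con (f , m) ts)) x
          ≡⟨ S-annotate-con Φ f m ts x ⟩
        (if isAnnotatedSymbol (Φ []) f then val♯ (con f (♭ⱽ ts)) x else 0) + S-all (annotateFrom 0 Φ ts) x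
          ≡⟨ cong ((if isAnnotatedSymbol (Φ []) f then val♯ (con f (♭ⱽ ts)) x else 0) +_) (S-all-annotate-none 0 Φ (λ j π _ → ≢true⇒≡false λ eq → contradiction (h (j ∷ π) eq) λ ()) ts x) ⟩
        (if isAnnotatedSymbol (Φ []) f then val♯ (con f (♭ⱽ ts)) x else 0) + 0
          ≡⟨ ℕ.+-identityʳ _ ⟩
        (if isAnnotatedSymbol (Φ []) f then val♯ (con f (♭ⱽ ts)) x else 0)
          ≤⟨ if≤ _ ⟩
        val♯ (con f (♭ⱽ ts)) x ∎
        where open ℕ.≤-Reasoning
      S-annotate-singleton Φ (j ∷ ρ) h (con (f , m) ts) x = begin
        S (annotate Φ (con (f , m) ts)) x
          ≡⟨ S-annotate-con Φ f m ts x ⟩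
        (if isAnnotatedSymbol (Φ []) f then val♯ (con f (♭ⱽ ts)) x else 0) + S-all (annotateFrom 0 Φ ts) x
          ≡⟨ cong (λ b → (if isAnnotatedSymbol b f then val♯ (con f (♭ⱽ ts)) x else 0) + S-all (annotateFrom 0 Φ ts) x)
               (≢true⇒≡false λ eq → contradiction (h [] eq) λ ()) ⟩
        S-all (annotateFrom 0 Φ ts) x
          ≤⟨ S-all-annotate-singleton 0 j Φ ρ (λ l π → h (l ∷ π)) ts x ⟩
        weight (con (f , m) ts) x (j ∷ ρ) ∎
        where open ℕ.≤-Reasoning

      S-all-annotate-singleton : ∀ {n} i k Φ ρ → (∀ l π → Φ (l ∷ π) ≡ true → l ∷ π ≡ (i + k) ∷ ρ) →
        ∀ (ts : Vec T♯ n) x →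
        S-all (annotateFrom i Φ ts) x ≤ maybe′ (λ u → val♯ (♭ u) x) 0 (nth ts k >>= (_∣ ρ))
      S-all-annotate-singleton i k       Φ ρ h []       x = z≤n
      S-all-annotate-singleton i zero    Φ ρ h (t ∷ ts) x = begin
        S (annotate (Φ ∘ (i ∷_)) t) x + S-all (annotateFrom (suc i) Φ ts) x
          ≡⟨ cong (_ +_) (S-all-annotate-none (suc i) Φ (λ l π i<l → ≢true⇒≡false λ eq →
               ℕ.<-irrefl (sym (trans (List.∷-injectiveˡ (h l π eq)) (ℕ.+-identityʳ i))) i<l) ts x) ⟩
        S (annotate (Φ ∘ (i ∷_)) t) x + 0
          ≡⟨ ℕ.+-identityʳ _ ⟩
        S (annotate (Φ ∘ (i ∷_)) t) x
          ≤⟨ S-annotate-singleton (Φ ∘ (i ∷_)) ρ (λ π eq → List.∷-injectiveʳ (h i π eq)) t x ⟩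
        weight t x ρ ∎
        where open ℕ.≤-Reasoning
      S-all-annotate-singleton i (suc k) Φ ρ h (t ∷ ts) x = begin
        S (annotate (Φ ∘ (i ∷_)) t) x + S-all (annotateFrom (suc i) Φ ts) x
          ≡⟨ cong (_+ S-all (annotateFrom (suc i) Φ ts) x) (S-annotate-none (Φ ∘ (i ∷_)) (λ π → ≢true⇒≡false λ eq →
               ℕ.m≢1+m+n i (trans (List.∷-injectiveˡ (h i π eq)) (ℕ.+-suc i k))) t x) ⟩
        S-all (annotateFrom (suc i) Φ ts) x
          ≤⟨ S-all-annotate-singleton (suc i) k Φ ρ (λ l π eq → trans (h l π eq) (cong (_∷ ρ) (ℕ.+-suc i k))) ts x ⟩
        maybe′ (λ u → val♯ (♭ u) x) 0 (nth ts k >>= (_∣ ρ)) ∎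
        where open ℕ.≤-Reasoning

    open DecMembership (List.≡-dec ℕ._≟_) using () renaming (_∈?_ to _∈ᵖ?_)

    -- A union bound, in which repeated positions in `L` merely enlarge the right-hand side. This
    -- matters for `Φ`, whose two parts are concatenated.
    S-#≤ : ∀ L t x → S (#[ L ] t) x ≤ sum (map (weight t x) L)
    S-#≤ []      t x = ℕ.≤-reflexive (S-annotate-none _ (λ _ → refl) t x)
    S-#≤ (ρ ∷ L) t x = ℕ.≤-trans
      (S-annotate-∨ {Φ₁ = λ π → does (List.≡-dec ℕ._≟_ π ρ)} {Φ₂ = λ π → does (π ∈ᵖ? L)} ∈-∷ t x)
      (ℕ.+-mono-≤ (S-annotate-singleton _ ρ ≡ρ t x) (S-#≤ L t x))
      where
      ≡ρ : ∀ π → does (List.≡-dec ℕ._≟_ π ρ) ≡ true → π ≡ ρ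
      ≡ρ π eq with List.≡-dec ℕ._≟_ π ρ
      ... | yes π≡ρ = π≡ρ
      ∈-∷ : ∀ π → does (π ∈ᵖ? (ρ ∷ L)) ≡ true →
            does (List.≡-dec ℕ._≟_ π ρ) ≡ true ⊎ does (π ∈ᵖ? L) ≡ true
      ∈-∷ π eq with does (List.≡-dec ℕ._≟_ π ρ)
      ... | true  = inj₁ refl
      ... | false = inj₂ eq

-- Weights inside and around a redex

module _ where

  open ≡ using (refl; sym; trans; cong; cong₂; subst)
  open import Data.Nat.Base using (_+_; _*_; _≤_; z≤n)

  sum-concatMap-≤ : ∀ {A B : Set} (F : A → ℕ) (G : B → ℕ) (g : A → List B) {xs} →
    All (λ x → sum (map G (g x)) ≤ F x) xs → sum (map G (concatMap g xs)) ≤ sum (map F xs)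
  sum-concatMap-≤ F G g []                 = z≤n
  sum-concatMap-≤ F G g {x ∷ xs} (h ∷ hs) = ℕ.≤-trans
    (ℕ.≤-reflexive (trans (cong sum (List.map-++ G (g x) (concatMap g xs))) (sum-++ (map G (g x)) (map G (concatMap g xs)))))
    (ℕ.+-mono-≤ h (sum-concatMap-≤ F G g hs))

  sum-zero : ∀ {A : Set} (xs : List A) → sum (map (const 0) xs) ≡ 0
  sum-zero []       = refl
  sum-zero (x ∷ xs) = sum-zero xs

module Contexts {c ℓ₁ ℓ₂ : Level} (K : ArchimedeanOrderedField c ℓ₁ ℓ₂)
  (Sig : Signature) (V : Set) (D : Subset (Signature.size Sig)) where

  open ≡ using (refl; sym; trans; cong; cong₂; subst)
  open import Data.Nat.Base using (_+_; _*_; _≤_; z≤n)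
  open ADPFramework K Sig V D hiding (at)
  open Signature Sig
  open Annotations K Sig V D

  module _ (Pol : PolynomialInterpretation) where

    open Interpretation Pol
    open +-*-Solver using (solve; _:=_; _:+_; _:*_)

    vals-modifyNth : ∀ {n} (ts : Vec T♯ n) i {t} (h : T♯ → T♯) x → nth ts i ≡ just t →
      vals (♭ⱽ (modifyNth i h ts)) x ≡ modifyNth i (const (val (♭ (h t)) x)) (vals (♭ⱽ ts) x)
    vals-modifyNth (t ∷ ts) zero    h x refl = refl
    vals-modifyNth (t ∷ ts) (suc i) h x at   = cong (val (♭ t) x ∷_) (vals-modifyNth ts i h x at)

    S-all-modifyNth : ∀ {n} (ts : Vec T♯ n) i {t} x → nth ts i ≡ just t →
      ∃ λ R → ∀ h → S-all (modifyNth i h ts) x ≡ R + S (h t) x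
    S-all-modifyNth (t ∷ ts) zero    x refl = S-all ts x , λ h → ℕ.+-comm (S (h t) x) _
    S-all-modifyNth (t ∷ ts) (suc i) x at   =
      let R , eq = S-all-modifyNth ts i x at
      in S t x + R , λ h → trans (cong (S t x +_) (eq h)) (sym (ℕ.+-assoc (S t x) R _))

    S-all-nth : ∀ {n} (ts : Vec T♯ n) i {t} x (at : nth ts i ≡ just t) →
      S-all ts x ≡ proj₁ (S-all-modifyNth ts i x at) + S t x
    S-all-nth ts i x at = trans (cong (λ ts → S-all ts x) (sym (nth-modifyNth-id ts i at refl)))
      (proj₂ (S-all-modifyNth ts i x at) id)

    module _ (multilinear : Multilinear Pol) where

      evalPolynomial-modifyNth : ∀ g (ts : Vec T♯ (arity♯ g)) i {t} x → nth ts i ≡ just t →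
        ∃ λ A → ∃ λ B → ∀ (h : T♯ → T♯) →
        evalPolynomial (Pol g) (vals (♭ⱽ (modifyNth i h ts)) x) ≡ A + B * val (♭ (h t)) x
      evalPolynomial-modifyNth g ts i x at =
        let A , B , eq = multilinear-affine (Pol g) (multilinear g) (vals (♭ⱽ ts) x) i
        in A , B , λ h → trans (cong (evalPolynomial (Pol g)) (vals-modifyNth ts i h x at)) (eq _)

      val-[]at : ∀ s π {u} x → s ∣ π ≡ just u → ∃ λ A → ∃ λ B → ∀ w →
        val (♭ (s [ w ]at π)) x ≡ A + B * val (♭ w) x
      val-[]at s                []      x at = 0 , 1 , λ w → sym (ℕ.*-identityˡ _)
      val-[]at (con (f , m) ts) (i ∷ π) x at with nth ts i in eq
      ... | just t =
        let A , B , eq₁ = evalPolynomial-modifyNth (f , nothing) ts i x eq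
            C , E , eq₂ = val-[]at t π x at
        in A + B * C , B * E , λ w → trans (eq₁ (_[ w ]at π)) (trans (cong (λ k → A + B * k) (eq₂ w))
             (solve 5 (λ A B C E z → A :+ B :* (C :+ E :* z) := A :+ B :* C :+ B :* E :* z) refl A B C E (val (♭ w) x)))

      val♯-[]at : ∀ f ts i {t} π {u} x → nth ts i ≡ just t → t ∣ π ≡ just u → ∃ λ A → ∃ λ B → ∀ w →
        val♯ (con f (♭ⱽ (modifyNth i (_[ w ]at π) ts))) x ≡ A + B * val (♭ w) x
      val♯-[]at f ts i {t} π x at-i at =
        let A , B , eq₁ = evalPolynomial-modifyNth (annotateSymbol true (f , nothing)) ts i x at-i
            C , E , eq₂ = val-[]at t π x at
        in A + B * C , B * E , λ w → trans (val♯-con f (♭ⱽ (modifyNth i (_[ w ]at π) ts)) x)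
             (trans (eq₁ (_[ w ]at π)) (trans (cong (λ k → A + B * k) (eq₂ w))
             (solve 5 (λ A B C E z → A :+ B :* (C :+ E :* z) := A :+ B :* C :+ B :* E :* z) refl A B C E (val (♭ w) x))))

      -- Annotated symbols above `π` see the replaced term through `Pol`, affinely by
      -- multilinearity; those beside it contribute a constant and those inside it form `S w`. The
      -- coefficients precede `w`, so all outcomes of a step share them.
      S-[]at : ∀ s π {u} x → s ∣ π ≡ just u → ∃ λ A → ∃ λ B → ∀ w →
        S (s [ w ]at π) x ≡ A + B * val (♭ w) x + S w x
      S-[]at s                []      x at = 0 , 0 , λ w → refl
      S-[]at (con (f , m) ts) (i ∷ π) x at with nth ts i in eq
      S-[]at (con (f , nothing) ts) (i ∷ π) x at | just t =
        let R , eq₁     = S-all-modifyNth ts i x eq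
            A , B , eq₂ = S-[]at t π x at
        in R + A , B , λ w → trans (S-con f nothing (modifyNth i (_[ w ]at π) ts) x)
             (trans (eq₁ (_[ w ]at π)) (trans (cong (R +_) (eq₂ w))
             (solve 4 (λ R A b s → R :+ (A :+ b :+ s) := R :+ A :+ b :+ s) refl R A (B * val (♭ w) x) (S w x))))
      S-[]at (con (f , just f∈D) ts) (i ∷ π) x at | just t =
        let R , eq₁     = S-all-modifyNth ts i x eq
            A , B , eq₂ = S-[]at t π x at
            C , E , eq₃ = val♯-[]at f ts i π x eq at
        in C + R + A , E + B , λ w → trans (S-con f (just f∈D) (modifyNth i (_[ w ]at π) ts) x)
             (trans (cong₂ _+_ (eq₃ w) (trans (eq₁ (_[ w ]at π)) (cong (R +_) (eq₂ w))))
             (solve 7 (λ C E R A B v s → C :+ E :* v :+ (R :+ (A :+ B :* v :+ s)) := C :+ R :+ A :+ (E :+ B) :* v :+ s) refl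
                C E R A B (val (♭ w) x) (S w x)))

    -- Once the annotations above `π` are gone, `w` enters through `S w` only. The comparison with
    -- `s` is an inequality because `s` may still have annotations there.
    S-♭↑-[]at : ∀ s π {u} x → s ∣ π ≡ just u →
      ∃ λ A → A + S u x ≤ S s x × ∀ w → S (♭↑ π (s [ w ]at π)) x ≡ A + S w x
    S-♭↑-[]at s                []      x refl = 0 , ℕ.≤-refl , λ w → refl
    S-♭↑-[]at (con (f , m) ts) (i ∷ π) {u} x at with nth ts i in eq
    ... | just t =
      let R , eq₁      = S-all-modifyNth ts i x eq
          A , ≤S , eq₂ = S-♭↑-[]at t π x at
      in R + A , ℕ.≤-trans (ℕ.≤-reflexive (ℕ.+-assoc R A (S u x))) (ℕ.≤-trans (ℕ.+-monoʳ-≤ R ≤S)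
           (ℕ.≤-trans (ℕ.≤-reflexive (sym (S-all-nth ts i x eq)))
           (ℕ.≤-trans (ℕ.m≤n+m (S-all ts x) (if is-just m then val♯ (con f (♭ⱽ ts)) x else 0))
             (ℕ.≤-reflexive (sym (S-con f m ts x)))))) ,
         λ w → trans (S-con f nothing (modifyNth i (♭↑ π) (modifyNth i (_[ w ]at π) ts)) x)
           (trans (cong (λ ts → S-all ts x) (modifyNth-∘ ts i))
           (trans (eq₁ (λ t → ♭↑ π (t [ w ]at π))) (trans (cong (R +_) (eq₂ w)) (sym (ℕ.+-assoc R A (S w x))))))

    variableSum : T → T♯ → Valuation → ℕ
    variableSum ℓ u x = sum (map (λ ρ → maybe′ (λ v → S v x) 0 (u ∣ ρ)) (variablePositions ℓ))

    private
      F : Valuation → Maybe T♯ → ℕ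
      F x = maybe′ (λ v → S v x) 0

      mutual
        -- Distinct variable positions of `ℓ` are parallel, so the annotations of `u` below them are
        -- disjoint; the recursion descends `ℓ` and `u` together to exploit this.
        variables-≤ : ∀ ℓ u x → occurrenceSum isVar (λ (ρ , _) → F x (u ∣ ρ)) ℓ ≤ S u x
        variables-≤ (var v)    u         x = ℕ.≤-reflexive (ℕ.+-identityʳ _)
        variables-≤ (con f ts) (var y)   x = variablesFrom-≤ 0 ts [] x _ (λ k ρ → ℕ.≤-refl)
        variables-≤ (con f ts) (con (g , m) us) x = ℕ.≤-trans (variablesFrom-≤ 0 ts us x _ (λ k ρ → ℕ.≤-refl))
          (ℕ.≤-trans (ℕ.m≤n+m (S-all us x) (if is-just m then val♯ (con g (♭ⱽ us)) x else 0))
            (ℕ.≤-reflexive (sym (S-con g m us x))))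

        -- The shapes of `ts` and `us` are unrelated, so arguments missing in `us` count zero.
        -- Bounding an abstract `G` through indices offset by `i` lets the recursion advance in both
        -- vectors.
        variablesFrom-≤ : ∀ {m n} i (ts : Vec T m) (us : Vec T♯ n) x (G : Position × T → ℕ) →
          (∀ k ρ {v} → G ((i + k) ∷ ρ , v) ≤ F x (nth us k >>= (_∣ ρ))) →
          occurrenceSumFrom i isVar G ts ≤ S-all us x
        variablesFrom-≤ i []       us x G h = z≤n
        variablesFrom-≤ i (t ∷ ts) us x G h = ℕ.≤-trans (ℕ.≤-reflexive (occurrenceSumFrom-∷ i isVar G t ts))
          (cons us h)
          where
          cons : ∀ {n} (us : Vec T♯ n) → (∀ k ρ {v} → G ((i + k) ∷ ρ , v) ≤ F x (nth us k >>= (_∣ ρ))) →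
            occurrenceSum isVar (λ (π , v) → G (i ∷ π , v)) t + occurrenceSumFrom (suc i) isVar G ts ≤ S-all us x
          cons [] h = ℕ.+-mono-≤ {y = 0} {v = 0}
            (ℕ.≤-trans (occurrenceSum-mono isVar t (λ {π} {v} _ _ → subst (λ j → G (j ∷ π , v) ≤ 0) (ℕ.+-identityʳ i) (h 0 π)))
              (ℕ.≤-reflexive (sum-zero (occurrencesWhere isVar t))))
            (variablesFrom-≤ (suc i) ts [] x G (λ k ρ {v} → subst (λ j → G (j ∷ ρ , v) ≤ 0) (ℕ.+-suc i k) (h (suc k) ρ)))
          cons (u ∷ us) h = ℕ.+-mono-≤
            (ℕ.≤-trans (occurrenceSum-mono isVar t (λ {π} {v} _ _ → subst (λ j → G (j ∷ π , v) ≤ F x (u ∣ π)) (ℕ.+-identityʳ i) (h 0 π)))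
              (variables-≤ t u x))
            (variablesFrom-≤ (suc i) ts us x G (λ k ρ {v} → subst (λ j → G (j ∷ ρ , v) ≤ F x (nth us k >>= (_∣ ρ))) (ℕ.+-suc i k) (h (suc k) ρ)))

    -- As `ℓ` is not a variable, the root is not among its variable positions and its annotation is
    -- not counted twice.
    redex-bound : ∀ ℓ u x → isVar ℓ ≡ false →
      (if isAnnotated u then val♯ (♭ u) x else 0) + variableSum ℓ u x ≤ S u x
    redex-bound ℓ u x nonvar = ℕ.≤-trans
      (ℕ.+-monoʳ-≤ (if isAnnotated u then val♯ (♭ u) x else 0) (ℕ.≤-reflexive
        (cong sum (sym (List.map-∘ (occurrencesWhere isVar ℓ)))))) (nonVariable ℓ u nonvar)
      where
      nonVariable : ∀ ℓ u → isVar ℓ ≡ false → (if isAnnotated u then val♯ (♭ u) x else 0) +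
        occurrenceSum isVar (λ (ρ , _) → F x (u ∣ ρ)) ℓ ≤ S u x
      nonVariable ℓ          (var y)          nonvar = variables-≤ ℓ (var y) x
      nonVariable (con f ts) (con (g , m) us) nonvar = ℕ.≤-trans
        (ℕ.+-monoʳ-≤ (if is-just m then val♯ (con g (♭ⱽ us)) x else 0)
          (variablesFrom-≤ 0 ts us x _ (λ k ρ → ℕ.≤-refl)))
        (ℕ.≤-reflexive (sym (S-con g m us x)))

    weight-annotated : ∀ r σ x → sum (map (weight (r ⟨ σ ⟩♯) x) (annotatedPositions r)) ≤ S r (x ∘ᵛ σ)
    weight-annotated r σ x = ℕ.≤-trans (ℕ.≤-reflexive (cong sum (sym (List.map-∘ (occurrencesWhere isAnnotated r)))))
      (occurrenceSum-mono isAnnotated r (λ {π} {u} → summand {π} {u}))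
      where
      summand : ∀ {π u} → r ∣ π ≡ just u → isAnnotated u ≡ true → weight (r ⟨ σ ⟩♯) x π ≤ val♯ (♭ u) (x ∘ᵛ σ)
      summand {π} {u@(con (f , m) ts)} at _ = ℕ.≤-reflexive (trans
        (cong (maybe′ (λ u → val♯ (♭ u) x) 0) (∣-subst r (⌈_⌉ ∘ apply σ) π at))
        (trans (cong (λ t → val♯ t x) (♭-subst u σ)) (val♯-subst (♭ u) σ x refl)))

    -- A repositioning sends each variable position of the left-hand side to at most one position of
    -- `r α j`, carrying the same variable and hence the same instance. So no annotation of the
    -- redex is counted more than once.
    weight-Ψ : ∀ {α φ} → IsVRF α φ → ∀ j {u σ} x → ♭ u ≡ lhs α ⟨ σ ⟩ →
      sum (map (weight (r α j ⟨ σ ⟩♯) x) (Ψ (lhs α) (φ j) u)) ≤ variableSum (lhs α) u x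
    weight-Ψ {α} {φ} vrf j {u} {σ} x matches = sum-concatMap-≤ _ (weight (r α j ⟨ σ ⟩♯) x) _
      (All.tabulate λ {ρ} ρ∈ → image ρ ρ∈ (φ j ρ) refl)
      where
      below : ∀ ρ ρ′ y → lhs α ∣ ρ ≡ just (var y) → r α j ∣ ρ′ ≡ just (var y) → (m : Maybe T♯) → u ∣ ρ ≡ m →
        sum (map (weight (r α j ⟨ σ ⟩♯) x) (map (ρ′ ++_) (maybe′ annotatedPositions [] m))) ≤ F x m
      below ρ ρ′ y at-ρ at-ρ′ nothing  _    = z≤n
      below ρ ρ′ y at-ρ at-ρ′ (just v) at-v = ℕ.≤-trans
        (ℕ.≤-reflexive (cong sum (trans (sym (List.map-∘ (annotatedPositions v))) (sym (List.map-∘ (occurrencesWhere isAnnotated v))))))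
        (occurrenceSum-mono isAnnotated v (λ {τ} {w} → summand {τ} {w}))
        where
        ♭v : ♭ v ≡ apply σ y
        ♭v = just-injective (trans (cong (Maybe.map ♭) (sym at-v)) (trans (sym (♭-∣ u ρ))
          (trans (cong (_∣ ρ) matches) (∣-subst (lhs α) (apply σ) ρ at-ρ))))
        summand : ∀ {τ w} → v ∣ τ ≡ just w → isAnnotated w ≡ true →
          weight (r α j ⟨ σ ⟩♯) x (ρ′ ++ τ) ≤ val♯ (♭ w) x
        summand {τ} {w} at-w _ = ℕ.≤-reflexive (trans (cong (maybe′ (λ u → val♯ (♭ u) x) 0) at-w′)
          (cong (λ t → val♯ t x) (♭-⌈⌉ (♭ w))))
          where
          open ≡.≡-Reasoning
          at-w′ : (r α j ⟨ σ ⟩♯) ∣ (ρ′ ++ τ) ≡ just ⌈ ♭ w ⌉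
          at-w′ = begin
            (r α j ⟨ σ ⟩♯) ∣ (ρ′ ++ τ)            ≡⟨ ∣-++ (r α j ⟨ σ ⟩♯) ρ′ τ ⟩
            ((r α j ⟨ σ ⟩♯) ∣ ρ′ >>= (_∣ τ))      ≡⟨ cong (_>>= (_∣ τ)) (∣-subst (r α j) (⌈_⌉ ∘ apply σ) ρ′ at-ρ′) ⟩
            ⌈ apply σ y ⌉ ∣ τ                     ≡⟨ cong (λ t → ⌈ t ⌉ ∣ τ) ♭v ⟨
            ⌈ ♭ v ⌉ ∣ τ                           ≡⟨ ⌈⌉-∣ (♭ v) τ ⟩
            Maybe.map ⌈_⌉ (♭ v ∣ τ)               ≡⟨ cong (Maybe.map ⌈_⌉) (trans (♭-∣ v τ) (cong (Maybe.map ♭) at-w)) ⟩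
            just ⌈ ♭ w ⌉                          ∎

      image : ∀ ρ → ρ ∈ variablePositions (lhs α) → (m : Maybe Position) → φ j ρ ≡ m →
        sum (map (weight (r α j ⟨ σ ⟩♯) x)
          (maybe′ (λ ρ′ → map (ρ′ ++_) (maybe′ annotatedPositions [] (u ∣ ρ))) [] m)) ≤ F x (u ∣ ρ)
      image ρ ρ∈ nothing   _  = z≤n
      image ρ ρ∈ (just ρ′) eq =
        let y , at-ρ , at-ρ′ = vrf j ρ ρ′ ρ∈ eq in below ρ ρ′ y at-ρ at-ρ′ (u ∣ ρ) refl

-- Bounds on the weight along one step

module StepBounds {c ℓ₁ ℓ₂ : Level} (K : ArchimedeanOrderedField c ℓ₁ ℓ₂)
  (Sig : Signature) (V : Set) (D : Subset (Signature.size Sig)) where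

  open ≡ using (refl; sym; trans; cong; cong₂; subst)
  open import Data.Nat.Base using (_+_; _*_; _≤_; z≤n)
  open ADPFramework K Sig V D
  open Annotations K Sig V D
  open Contexts K Sig V D

  module _ (Pol : PolynomialInterpretation) (multilinear : Multilinear Pol) (x : Valuation) where

    open Interpretation Pol
    open +-*-Solver using (solve; _:=_; _:+_; _:*_)

    -- Multilinearity makes S affine in Pol of the contracted redex, with slope B; C tells
    -- whether the redex is annotated.
    record StepBound (α : ADP) (s : T♯) (t : Outcome α → T♯) (b : Bool) : Set where
      field
        y         : Valuation
        A B C     : ℕ
        outcome   : ∀ j → S (t j) x ≤ A + B * val (♭ (r α j)) y + C * S (r α j) y
        source    : A + B * val (lhs α) y + C * val♯ (lhs α) y ≤ S s x
        flagged   : B ≡ 0 ⊎ flag α ≡ true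
        annotated : b ≡ true → C ≡ 1

    module _ {P : ADPProblem} (isP : IsADPProblem P) {s : T♯} (R : Redex P s) where

      open Redex R

      private
        y : Valuation
        y = x ∘ᵛ σ

        nonvar : isVar (lhs α) ≡ false
        nonvar = IsADP.lhs-nonVariable (All.lookup isP α∈P)

        val-u : val (♭ u) x ≡ val (lhs α) y
        val-u = trans (cong (λ t → val t x) matches) (val-subst (lhs α) σ x)

        val♯-u : val♯ (♭ u) x ≡ val♯ (lhs α) y
        val♯-u = trans (cong (λ t → val♯ t x) matches) (val♯-subst (lhs α) σ x nonvar)

        VS : ℕ
        VS = variableSum Pol (lhs α) u x

        annotated-bound : isAnnotated u ≡ true → val♯ (lhs α) y + VS ≤ S u x
        annotated-bound eq = ℕ.≤-trans (ℕ.≤-reflexive (cong (_+ VS) (trans (sym val♯-u)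
          (cong (λ b → if b then val♯ (♭ u) x else 0) (sym eq))))) (redex-bound Pol (lhs α) u x nonvar)

        unannotated-bound : VS ≤ S u x
        unannotated-bound = ℕ.≤-trans (ℕ.m≤n+m VS (if isAnnotated u then val♯ (♭ u) x else 0))
          (redex-bound Pol (lhs α) u x nonvar)

      -- `E` is the weight inherited from below the variables of the redex: `VS` in full rewriting,
      -- and zero in innermost rewriting, where the instances of variables enter without
      -- annotations.
      module _ (C E : ℕ) (w : Outcome α → T♯) (b : Bool) (Cb : b ≡ true → C ≡ 1)
        (♭w : ∀ j → ♭ (w j) ≡ ♭ (r α j) ⟨ σ ⟩)
        (S-w : ∀ j → S (w j) x ≤ C * S (r α j) y + E)
        (S-u : C * val♯ (lhs α) y + E ≤ S u x) where

        private
          val-w : ∀ j → val (♭ (w j)) x ≡ val (♭ (r α j)) y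
          val-w j = trans (cong (λ t → val t x) (♭w j)) (val-subst (♭ (r α j)) σ x)

        replace-bound : flag α ≡ true → StepBound α s (λ j → s [ w j ]at π) b
        replace-bound flagged =
          let A , B , eq = S-[]at Pol multilinear s π x s∣π
          in record
          { y = y ; A = A + E ; B = B ; C = C
          ; outcome = λ j → ℕ.≤-trans (ℕ.≤-reflexive (trans (eq (w j)) (cong (λ v → A + B * v + S (w j) x) (val-w j))))
              (ℕ.≤-trans (ℕ.+-monoʳ-≤ (A + B * val (♭ (r α j)) y) (S-w j))
              (ℕ.≤-reflexive (solve 4 (λ A v s E → A :+ v :+ (s :+ E) := A :+ E :+ v :+ s) refl
                 A (B * val (♭ (r α j)) y) (C * S (r α j) y) E)))
          -- The affine formula for the outcomes, taken at `w = u`, describes `s` itself.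
          ; source = ℕ.≤-trans (ℕ.≤-reflexive (solve 4 (λ A v s E → A :+ E :+ v :+ s := A :+ v :+ (s :+ E)) refl
                 A (B * val (lhs α) y) (C * val♯ (lhs α) y) E))
              (ℕ.≤-trans (ℕ.+-monoʳ-≤ (A + B * val (lhs α) y) S-u)
              (ℕ.≤-reflexive (trans (cong (λ v → A + B * v + S u x) (sym val-u))
                 (trans (sym (eq u)) (cong (λ t → S t x) ([]at-self s π s∣π))))))
          ; flagged = inj₂ flagged
          ; annotated = Cb
          }

        replace-♭↑-bound : StepBound α s (λ j → ♭↑ π (s [ w j ]at π)) b
        replace-♭↑-bound =
          let A , ≤S , eq = S-♭↑-[]at Pol s π x s∣π
          in record
          { y = y ; A = A + E ; B = 0 ; C = C
          ; outcome = λ j → ℕ.≤-trans (ℕ.≤-reflexive (eq (w j)))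
              (ℕ.≤-trans (ℕ.+-monoʳ-≤ A (S-w j))
              (ℕ.≤-reflexive (trans (regroup A (C * S (r α j) y) E) (cong (_+ C * S (r α j) y) (sym (ℕ.+-identityʳ (A + E)))))))
          ; source = ℕ.≤-trans (ℕ.≤-reflexive (trans (cong (_+ C * val♯ (lhs α) y) (ℕ.+-identityʳ (A + E)))
                (sym (regroup A (C * val♯ (lhs α) y) E))))
              (ℕ.≤-trans (ℕ.+-monoʳ-≤ A S-u) ≤S)
          ; flagged = inj₁ refl
          ; annotated = Cb
          }
          where
          regroup : ∀ a s e → a + (s + e) ≡ a + e + s
          regroup = solve 3 (λ a s e → a :+ (s :+ e) := a :+ e :+ s) refl

      module Full (φ : Repositioning α) (vrf : IsVRF α φ) where

        private
          ♭w : ∀ (L : Outcome α → List Position) j → ♭ (#[ L j ] (r α j ⟨ σ ⟩♯)) ≡ ♭ (r α j) ⟨ σ ⟩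
          ♭w L j = trans (♭-annotate _ (r α j ⟨ σ ⟩♯)) (♭-subst (r α j) σ)

          S-Ψ : ∀ j → sum (map (weight (r α j ⟨ σ ⟩♯) x) (Ψ (lhs α) (φ j) u)) ≤ VS
          S-Ψ j = weight-Ψ Pol {α} {φ} vrf j {u} {σ} x matches

          S-Φ : ∀ j → S (#[ Φ (lhs α) (r α j) (φ j) u ] (r α j ⟨ σ ⟩♯)) x ≤ 1 * S (r α j) y + VS
          S-Φ j = begin
            S (#[ Φ (lhs α) (r α j) (φ j) u ] (r α j ⟨ σ ⟩♯)) x
              ≤⟨ S-#≤ (Φ (lhs α) (r α j) (φ j) u) (r α j ⟨ σ ⟩♯) x ⟩
            sum (map W (annotatedPositions (r α j) ++ Ψ (lhs α) (φ j) u))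
              ≡⟨ cong sum (List.map-++ W (annotatedPositions (r α j)) (Ψ (lhs α) (φ j) u)) ⟩
            sum (map W (annotatedPositions (r α j)) ++ map W (Ψ (lhs α) (φ j) u))
              ≡⟨ sum-++ (map W (annotatedPositions (r α j))) (map W (Ψ (lhs α) (φ j) u)) ⟩
            sum (map W (annotatedPositions (r α j))) + sum (map W (Ψ (lhs α) (φ j) u))
              ≤⟨ ℕ.+-mono-≤ (weight-annotated Pol (r α j) σ x) (S-Ψ j) ⟩
            S (r α j) y + VS
              ≡⟨ cong (_+ VS) (ℕ.+-identityʳ (S (r α j) y)) ⟨
            1 * S (r α j) y + VS ∎
            where
            open ℕ.≤-Reasoning
            W : Position → ℕ
            W = weight (r α j ⟨ σ ⟩♯) x

          S-u : isAnnotated u ≡ true → 1 * val♯ (lhs α) y + VS ≤ S u x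
          S-u eq = ℕ.≤-trans (ℕ.≤-reflexive (cong (_+ VS) (ℕ.+-identityʳ _))) (annotated-bound eq)

        at-bound : isAnnotated u ≡ true → flag α ≡ true →
          StepBound α s (λ j → s [ #[ Φ (lhs α) (r α j) (φ j) u ] (r α j ⟨ σ ⟩♯) ]at π) true
        at-bound ann = replace-bound 1 VS _ true (λ _ → refl) (♭w (λ j → Φ (lhs α) (r α j) (φ j) u)) S-Φ (S-u ann)

        af-bound : isAnnotated u ≡ true →
          StepBound α s (λ j → ♭↑ π (s [ #[ Φ (lhs α) (r α j) (φ j) u ] (r α j ⟨ σ ⟩♯) ]at π)) true
        af-bound ann = replace-♭↑-bound 1 VS _ true (λ _ → refl) (♭w (λ j → Φ (lhs α) (r α j) (φ j) u)) S-Φ (S-u ann)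

        nt-bound : flag α ≡ true →
          StepBound α s (λ j → s [ #[ Ψ (lhs α) (φ j) u ] (r α j ⟨ σ ⟩♯) ]at π) false
        nt-bound = replace-bound 0 VS _ false (λ ()) (♭w (λ j → Ψ (lhs α) (φ j) u))
          (λ j → ℕ.≤-trans (S-#≤ (Ψ (lhs α) (φ j) u) (r α j ⟨ σ ⟩♯) x) (S-Ψ j)) unannotated-bound

      module Innermost where

        private
          S-r : ∀ j → S (r α j ⟨ σ ⟩♯) x ≤ 1 * S (r α j) y + 0
          S-r j = ℕ.≤-reflexive (trans (S-subst (r α j) σ x) (sym (trans (ℕ.+-identityʳ _) (ℕ.+-identityʳ _))))

          S-u : isAnnotated u ≡ true → 1 * val♯ (lhs α) y + 0 ≤ S u x
          S-u eq = ℕ.≤-trans (ℕ.≤-reflexive (trans (ℕ.+-identityʳ _) (ℕ.+-identityʳ _)))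
            (ℕ.≤-trans (ℕ.m≤m+n (val♯ (lhs α) y) VS) (annotated-bound eq))

          S-♭r : ∀ j → S (⌈ ♭ (r α j) ⌉ ⟨ σ ⟩♯) x ≤ 0
          S-♭r j = ℕ.≤-reflexive (trans (S-subst ⌈ ♭ (r α j) ⌉ σ x) (S-⌈⌉ (♭ (r α j)) y))

          ♭-♭r : ∀ j → ♭ (⌈ ♭ (r α j) ⌉ ⟨ σ ⟩♯) ≡ ♭ (r α j) ⟨ σ ⟩
          ♭-♭r j = trans (♭-subst ⌈ ♭ (r α j) ⌉ σ) (cong (_⟨ σ ⟩) (♭-⌈⌉ (♭ (r α j))))

        at-bound : isAnnotated u ≡ true → flag α ≡ true → StepBound α s (λ j → s [ r α j ⟨ σ ⟩♯ ]at π) true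
        at-bound ann = replace-bound 1 0 _ true (λ _ → refl) (λ j → ♭-subst (r α j) σ) S-r (S-u ann)

        af-bound : isAnnotated u ≡ true → StepBound α s (λ j → ♭↑ π (s [ r α j ⟨ σ ⟩♯ ]at π)) true
        af-bound ann = replace-♭↑-bound 1 0 _ true (λ _ → refl) (λ j → ♭-subst (r α j) σ) S-r (S-u ann)

        nt-bound : flag α ≡ true → StepBound α s (λ j → s [ ⌈ ♭ (r α j) ⌉ ⟨ σ ⟩♯ ]at π) false
        nt-bound = replace-bound 0 0 _ false (λ ()) ♭-♭r S-♭r z≤n

        nf-bound : StepBound α s (λ j → ♭↑ π (s [ ⌈ ♭ (r α j) ⌉ ⟨ σ ⟩♯ ]at π)) false
        nf-bound = replace-♭↑-bound 0 0 _ false (λ ()) ♭-♭r S-♭r z≤n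

    record BoundedStep (P : ADPProblem) (s : T♯) (b : Bool) (μ : MultiDistribution T♯) : Set c where
      field
        α     : ADP
        α∈P   : α ∈ P
        t     : Outcome α → T♯
        μ≡    : μ ≡ distribution α t
        bound : StepBound α s t b

    ↪-bound : ∀ {P s b μ} → IsADPProblem P → P ⊢ s ↪[ b ] μ → BoundedStep P s b μ
    ↪-bound isP (at R φ vrf ann fl) = record { α∈P = Redex.α∈P R ; μ≡ = refl ; bound = Full.at-bound isP R φ vrf ann fl }
    ↪-bound isP (af R φ vrf ann fl) = record { α∈P = Redex.α∈P R ; μ≡ = refl ; bound = Full.af-bound isP R φ vrf ann }
    ↪-bound isP (nt R φ vrf ann fl) = record { α∈P = Redex.α∈P R ; μ≡ = refl ; bound = Full.nt-bound isP R φ vrf fl }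

    ↪ⁱ-bound : ∀ {P s b μ} → IsADPProblem P → P ⊢ s ↪ⁱ[ b ] μ → BoundedStep P s b μ
    ↪ⁱ-bound isP (at R anf ann fl) = record { α∈P = Redex.α∈P R ; μ≡ = refl ; bound = Innermost.at-bound isP R ann fl }
    ↪ⁱ-bound isP (af R anf ann fl) = record { α∈P = Redex.α∈P R ; μ≡ = refl ; bound = Innermost.af-bound isP R ann }
    ↪ⁱ-bound isP (nt R anf ann fl) = record { α∈P = Redex.α∈P R ; μ≡ = refl ; bound = Innermost.nt-bound isP R fl }
    ↪ⁱ-bound isP (nf R anf ann fl) = record { α∈P = Redex.α∈P R ; μ≡ = refl ; bound = Innermost.nf-bound isP R }

-- Expected values along steps

module Expectations {c ℓ₁ ℓ₂ : Level} (K : ArchimedeanOrderedField c ℓ₁ ℓ₂)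
  (Sig : Signature) (V : Set) (D : Subset (Signature.size Sig)) where

  open OrderedFieldProperties K
  open ADPFramework K Sig V D
  open ChainTrees K Sig V D
  open Annotations K Sig V D
  open StepBounds K Sig V D

  𝔼-distribution : ∀ α (t : Outcome α → T♯) h →
                   𝔼 (distribution α t) h ≈ ∑ (tabulate (λ j → p α j * h (t j)))
  𝔼-distribution α t h = reflexive (≡.cong ∑ (List.map-tabulate (λ j → p α j , t j) (λ (q , t) → q * h t)))

  mass-distribution : ∀ {α} → IsADP α → ∀ t → mass (distribution α t) ≈ 1#
  mass-distribution {α} isα t =
    trans (reflexive (≡.cong ∑ (List.map-tabulate (λ j → p α j , t j) proj₁))) (IsADP.p-sum isα)

  distribution-proper : ∀ {α} → IsADP α → ∀ t → Proper (distribution α t)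
  distribution-proper isα t = record
    { positive = All.tabulate⁺ (IsADP.p-positive isα)
    ; mass≈1   = mass-distribution isα t
    }

  lower-bound : ∀ {n} (f : Fin n → Carrier) → (∀ i → 0# < f i) → ∃ λ p → 0# < p × ∀ i → p ≤ f i
  lower-bound {zero}  f 0<f = 1# , 0<1 , λ ()
  lower-bound {suc n} f 0<f with lower-bound (f ∘ suc) (0<f ∘ suc)
  ... | p , 0<p , p≤f with total p (f zero)
  ...   | inj₁ p≤f₀ = p , 0<p , λ { zero → p≤f₀ ; (suc i) → p≤f i }
  ...   | inj₂ f₀≤p = f zero , 0<f zero , λ { zero → ≤-refl ; (suc i) → ≤-trans f₀≤p (p≤f i) }

  -- The source of `q₀`: finitely many ADPs with finitely many outcomes, all of positive
  -- probability. The value `1#` for empty lists is an arbitrary positive default.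
  minimal-probability : ∀ {P} → IsADPProblem P → ∃ λ q → 0# < q × All (λ α → ∀ j → q ≤ p α j) P
  minimal-probability []         = 1# , 0<1 , []
  minimal-probability {α ∷ P} (isα ∷ isP) with lower-bound (p α) (IsADP.p-positive isα) | minimal-probability isP
  ... | q , 0<q , q≤p | q′ , 0<q′ , q′≤P with total q q′
  ...   | inj₁ q≤q′ = q , 0<q , q≤p ∷ All.map (λ q′≤p j → ≤-trans q≤q′ (q′≤p j)) q′≤P
  ...   | inj₂ q′≤q = q′ , 0<q′ , (λ j → ≤-trans q′≤q (q≤p j)) ∷ q′≤P

  module _ (Pol : PolynomialInterpretation) (multilinear : Multilinear Pol) (x : Valuation) where

    open Interpretation Pol

    private
      fromℕ-affine : ∀ A B C m n → fromℕ (A ℕ.+ B ℕ.* m ℕ.+ C ℕ.* n) ≈ fromℕ A + fromℕ B * fromℕ m + fromℕ C * fromℕ n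
      fromℕ-affine A B C m n = trans (fromℕ-+ (A ℕ.+ B ℕ.* m) (C ℕ.* n))
        (+-cong (trans (fromℕ-+ A (B ℕ.* m)) (+-congˡ (fromℕ-* B m))) (fromℕ-* C n))

    -- The expectation passes through the affine bound; then `𝔼S≤` controls the `C`-term and `𝔼val≤`
    -- the `B`-term, which vanishes when the flag is not set.
    StepBound-supermartingale : ∀ {α s t b} → IsADP α →
      (∀ y → expectation α (λ t → S t y) ≤ fromℕ (val♯ (lhs α) y)) →
      (flag α ≡ true → ∀ y → expectation α (λ t → val (♭ t) y) ≤ fromℕ (val (lhs α) y)) →
      StepBound Pol multilinear x α s t b → 𝔼 (distribution α t) (λ t → fromℕ (S t x)) ≤ fromℕ (S s x)
    StepBound-supermartingale {α} {s} {t} isα 𝔼S≤ 𝔼val≤ bound = begin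
      𝔼 (distribution α t) (λ t → fromℕ (S t x))
        ≈⟨ 𝔼-distribution α t (λ t → fromℕ (S t x)) ⟩
      ∑ (tabulate (λ j → p α j * fromℕ (S (t j) x)))
        ≤⟨ ∑-tabulate-mono _ _ (λ j → *-monoˡ-≤ (<⇒≤ (IsADP.p-positive isα j))
             (≤-respʳ-≈ (fromℕ-affine A B C (val (♭ (r α j)) y) (S (r α j) y)) (fromℕ-mono-≤ (outcome j)))) ⟩
      ∑ (tabulate (λ j → p α j * (fromℕ A + fromℕ B * fromℕ (val (♭ (r α j)) y) + fromℕ C * fromℕ (S (r α j) y))))
        ≈⟨ ∑-tabulate-linear (p α) (fromℕ A) (fromℕ B) (fromℕ C)
             (λ j → fromℕ (val (♭ (r α j)) y)) (λ j → fromℕ (S (r α j) y)) ⟩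
      fromℕ A * ∑ (tabulate (p α)) + fromℕ B * expectation α (λ t → val (♭ t) y) + fromℕ C * expectation α (λ t → S t y)
        ≤⟨ +-mono-≤ (+-mono-≤ (≤-reflexive (trans (*-congˡ (IsADP.p-sum isα)) (*-identityʳ _))) (slope-≤ flagged))
             (*-monoˡ-≤ (fromℕ-nonNegative C) (𝔼S≤ y)) ⟩
      fromℕ A + fromℕ B * fromℕ (val (lhs α) y) + fromℕ C * fromℕ (val♯ (lhs α) y)
        ≈⟨ fromℕ-affine A B C (val (lhs α) y) (val♯ (lhs α) y) ⟨
      fromℕ (A ℕ.+ B ℕ.* val (lhs α) y ℕ.+ C ℕ.* val♯ (lhs α) y)
        ≤⟨ fromℕ-mono-≤ source ⟩
      fromℕ (S s x) ∎
      where
      open ≤-Reasoning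
      open StepBound bound
      slope-≤ : B ≡ 0 ⊎ flag α ≡ true →
        fromℕ B * expectation α (λ t → val (♭ t) y) ≤ fromℕ B * fromℕ (val (lhs α) y)
      slope-≤ (inj₁ B≡0) = ≡.subst (λ B → fromℕ B * _ ≤ fromℕ B * _) (≡.sym B≡0)
        (≤-reflexive (trans (zeroˡ _) (sym (zeroˡ _))))
      slope-≤ (inj₂ fl)  = *-monoˡ-≤ (fromℕ-nonNegative B) (𝔼val≤ fl y)

    -- At an annotated redex `C` is one, so the strict inequality for the outcome `j` comes through
    -- undiminished, while the second condition on `j` keeps the `B`-term from growing. That `j`
    -- precedes the valuation makes it independent of the substitution used.
    StepBound-decreasing : ∀ {α s t q} → (∀ j → q ≤ p α j) →
      (∃ λ j → (∀ y → val♯ (lhs α) y ℕ.> S (r α j) y) × (flag α ≡ true → ∀ y → val (lhs α) y ℕ.≥ val (♭ (r α j)) y)) →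
      StepBound Pol multilinear x α s t true →
      Any (λ (q′ , t) → q ≤ q′ × S t x ℕ.< S s x) (distribution α t)
    StepBound-decreasing {α} {s} {t} q≤p (j , S<val♯ , val≥) bound = Any.tabulate⁺ j (q≤p j , (begin-strict
      S (t j) x
        ≤⟨ outcome j ⟩
      A ℕ.+ B ℕ.* val (♭ (r α j)) y ℕ.+ C ℕ.* S (r α j) y
        ≡⟨ ≡.cong (λ C → A ℕ.+ B ℕ.* val (♭ (r α j)) y ℕ.+ C ℕ.* S (r α j) y) (annotated ≡.refl) ⟩
      A ℕ.+ B ℕ.* val (♭ (r α j)) y ℕ.+ 1 ℕ.* S (r α j) y
        <⟨ ℕ.+-mono-≤-< (ℕ.+-monoʳ-≤ A (slope-≤ flagged)) (ℕ.*-monoʳ-< 1 (S<val♯ y)) ⟩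
      A ℕ.+ B ℕ.* val (lhs α) y ℕ.+ 1 ℕ.* val♯ (lhs α) y
        ≡⟨ ≡.cong (λ C → A ℕ.+ B ℕ.* val (lhs α) y ℕ.+ C ℕ.* val♯ (lhs α) y) (annotated ≡.refl) ⟨
      A ℕ.+ B ℕ.* val (lhs α) y ℕ.+ C ℕ.* val♯ (lhs α) y
        ≤⟨ source ⟩
      S s x ∎))
      where
      open ℕ.≤-Reasoning
      open StepBound bound
      slope-≤ : B ≡ 0 ⊎ flag α ≡ true → B ℕ.* val (♭ (r α j)) y ℕ.≤ B ℕ.* val (lhs α) y
      slope-≤ (inj₁ B≡0) = ≡.subst (λ B → B ℕ.* val (♭ (r α j)) y ℕ.≤ B ℕ.* val (lhs α) y) (≡.sym B≡0) ℕ.z≤n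
      slope-≤ (inj₂ fl)  = ℕ.*-monoʳ-≤ B (val≥ fl y)

-- Adding annotations

module AnnotationOrder {c ℓ₁ ℓ₂ : Level} (K : ArchimedeanOrderedField c ℓ₁ ℓ₂)
  (Sig : Signature) (V : Set) (D : Subset (Signature.size Sig)) where

  open ≡ using (refl; sym; trans; cong; cong₂; subst)
  open ADPFramework K Sig V D hiding (at)
  open Annotations K Sig V D

  infix 4 _⊑_ _⊑ⱽ_

  mutual
    -- Only the presence of annotations is compared, never the membership proofs stored in them.
    data _⊑_ : T♯ → T♯ → Set where
      var : ∀ {x} → var x ⊑ var x
      con : ∀ {f m m′ ss ts} → (is-just m ≡ true → is-just m′ ≡ true) → ss ⊑ⱽ ts → con (f , m) ss ⊑ con (f , m′) ts

    data _⊑ⱽ_ : ∀ {n} → Vec T♯ n → Vec T♯ n → Set where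
      []  : [] ⊑ⱽ []
      _∷_ : ∀ {n s t} {ss ts : Vec T♯ n} → s ⊑ t → ss ⊑ⱽ ts → s ∷ ss ⊑ⱽ t ∷ ts

  mutual
    ⊑-refl : ∀ t → t ⊑ t
    ⊑-refl (var x)    = var
    ⊑-refl (con f ts) = con id (⊑ⱽ-refl ts)

    ⊑ⱽ-refl : ∀ {n} (ts : Vec T♯ n) → ts ⊑ⱽ ts
    ⊑ⱽ-refl []       = []
    ⊑ⱽ-refl (t ∷ ts) = ⊑-refl t ∷ ⊑ⱽ-refl ts

  mutual
    ⊑⇒♭≡ : ∀ {s t} → s ⊑ t → ♭ s ≡ ♭ t
    ⊑⇒♭≡ var                = refl
    ⊑⇒♭≡ (con {f} _ ss⊑ts) = cong (con f) (⊑ⱽ⇒♭≡ ss⊑ts)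

    ⊑ⱽ⇒♭≡ : ∀ {n} {ss ts : Vec T♯ n} → ss ⊑ⱽ ts → ♭ⱽ ss ≡ ♭ⱽ ts
    ⊑ⱽ⇒♭≡ []            = refl
    ⊑ⱽ⇒♭≡ (s⊑t ∷ ss⊑ts) = cong₂ _∷_ (⊑⇒♭≡ s⊑t) (⊑ⱽ⇒♭≡ ss⊑ts)

  mutual
    ⌈♭⌉-⊑ : ∀ t → ⌈ ♭ t ⌉ ⊑ t
    ⌈♭⌉-⊑ (var x)    = var
    ⌈♭⌉-⊑ (con f ts) = con (λ ()) (⌈♭⌉ⱽ-⊑ ts)

    ⌈♭⌉ⱽ-⊑ : ∀ {n} (ts : Vec T♯ n) → ⌈ ♭ⱽ ts ⌉ⱽ ⊑ⱽ ts
    ⌈♭⌉ⱽ-⊑ []       = []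
    ⌈♭⌉ⱽ-⊑ (t ∷ ts) = ⌈♭⌉-⊑ t ∷ ⌈♭⌉ⱽ-⊑ ts

  ⊑-isAnnotated : ∀ {s t} → s ⊑ t → isAnnotated s ≡ true → isAnnotated t ≡ true
  ⊑-isAnnotated (con m≤m′ _) = m≤m′

  ⊑-isDefined : ∀ {s t} → s ⊑ t → isDefined s ≡ isDefined t
  ⊑-isDefined var       = refl
  ⊑-isDefined (con _ _) = refl

  mutual
    ⊑-∣ : ∀ {s t u} π → s ⊑ t → s ∣ π ≡ just u → ∃ λ v → t ∣ π ≡ just v × u ⊑ v
    ⊑-∣ []      s⊑t           refl = _ , refl , s⊑t
    ⊑-∣ (i ∷ π) (con _ ss⊑ts) at   = ⊑ⱽ-∣ i π ss⊑ts at

    ⊑ⱽ-∣ : ∀ {n} {ss ts : Vec T♯ n} {u} i π → ss ⊑ⱽ ts → (nth ss i >>= (_∣ π)) ≡ just u →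
           ∃ λ v → (nth ts i >>= (_∣ π)) ≡ just v × u ⊑ v
    ⊑ⱽ-∣ zero    π (s⊑t ∷ _)     at = ⊑-∣ π s⊑t at
    ⊑ⱽ-∣ (suc i) π (_ ∷ ss⊑ts) at = ⊑ⱽ-∣ i π ss⊑ts at

  modifyNth-⊑ : ∀ {n} {ss ts : Vec T♯ n} i {g h} → (∀ {s t} → s ⊑ t → g s ⊑ h t) → ss ⊑ⱽ ts →
                modifyNth i g ss ⊑ⱽ modifyNth i h ts
  modifyNth-⊑ i       g⊑h []            = []
  modifyNth-⊑ zero    g⊑h (s⊑t ∷ ss⊑ts) = g⊑h s⊑t ∷ ss⊑ts
  modifyNth-⊑ (suc i) g⊑h (s⊑t ∷ ss⊑ts) = s⊑t ∷ modifyNth-⊑ i g⊑h ss⊑ts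

  []at-⊑ : ∀ {s t u v} π → s ⊑ t → u ⊑ v → s [ u ]at π ⊑ t [ v ]at π
  []at-⊑ []      s⊑t              u⊑v = u⊑v
  []at-⊑ (i ∷ π) var              u⊑v = var
  []at-⊑ (i ∷ π) (con m≤m′ ss⊑ts) u⊑v = con m≤m′ (modifyNth-⊑ i (λ s⊑t → []at-⊑ π s⊑t u⊑v) ss⊑ts)

  ♭↑-⊑ : ∀ {s t} π → s ⊑ t → ♭↑ π s ⊑ ♭↑ π t
  ♭↑-⊑ []      s⊑t           = s⊑t
  ♭↑-⊑ (i ∷ π) var           = var
  ♭↑-⊑ (i ∷ π) (con _ ss⊑ts) = con (λ ()) (modifyNth-⊑ i (♭↑-⊑ π) ss⊑ts)

  mutual
    subst-⊑ : ∀ {s t} σ → s ⊑ t → s ⟨ σ ⟩♯ ⊑ t ⟨ σ ⟩♯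
    subst-⊑ σ (var {x})        = ⊑-refl ⌈ apply σ x ⌉
    subst-⊑ σ (con m≤m′ ss⊑ts) = con m≤m′ (subst-⊑ⱽ σ ss⊑ts)

    subst-⊑ⱽ : ∀ {n} {ss ts : Vec T♯ n} σ → ss ⊑ⱽ ts →
      foldAll (⌈_⌉ ∘ apply σ) con ss ⊑ⱽ foldAll (⌈_⌉ ∘ apply σ) con ts
    subst-⊑ⱽ σ []            = []
    subst-⊑ⱽ σ (s⊑t ∷ ss⊑ts) = subst-⊑ σ s⊑t ∷ subst-⊑ⱽ σ ss⊑ts

  mutual
    annotate-⊑ : ∀ {Φ Φ′ s t} → (∀ π → Φ π ≡ true → Φ′ π ≡ true) → s ⊑ t → annotate Φ s ⊑ annotate Φ′ t
    annotate-⊑ h var                = var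
    annotate-⊑ h (con {f} _ ss⊑ts) = con (symbol f (h [])) (annotateFrom-⊑ 0 h ss⊑ts)
      where
      symbol : ∀ f {b b′} → (b ≡ true → b′ ≡ true) →
        is-just (proj₂ (annotateSymbol b (f , nothing))) ≡ true → is-just (proj₂ (annotateSymbol b′ (f , nothing))) ≡ true
      symbol f {true} h eq rewrite h refl = eq

    annotateFrom-⊑ : ∀ {n Φ Φ′} {ss ts : Vec T♯ n} i → (∀ π → Φ π ≡ true → Φ′ π ≡ true) → ss ⊑ⱽ ts →
      annotateFrom i Φ ss ⊑ⱽ annotateFrom i Φ′ ts
    annotateFrom-⊑ i h []            = []
    annotateFrom-⊑ i h (s⊑t ∷ ss⊑ts) = annotate-⊑ (h ∘ (i ∷_)) s⊑t ∷ annotateFrom-⊑ (suc i) h ss⊑ts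

  open DecMembership (List.≡-dec ℕ._≟_) using () renaming (_∈?_ to _∈ᵖ?_)

  #-⊑ : ∀ {L L′ s t} → L ⊆ L′ → s ⊑ t → #[ L ] s ⊑ #[ L′ ] t
  #-⊑ {L} {L′} L⊆L′ = annotate-⊑ λ π → member π
    where
    member : ∀ π → does (π ∈ᵖ? L) ≡ true → does (π ∈ᵖ? L′) ≡ true
    member π eq with π ∈ᵖ? L
    ... | yes π∈L = dec-true (π ∈ᵖ? L′) (L⊆L′ π∈L)

  private
    _≤ᵃ_ : Position × T♯ → Position × T♯ → Set
    (π , s) ≤ᵃ (ρ , t) = π ≡ ρ × (isAnnotated s ≡ true → isAnnotated t ≡ true)

    mutual
      occurrences-⊑ : ∀ {s t} → s ⊑ t → Pointwise _≤ᵃ_ (occurrences s) (occurrences t)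
      occurrences-⊑ var              = (refl , id) ∷ []
      occurrences-⊑ (con m≤m′ ss⊑ts) = (refl , m≤m′) ∷ occurrencesFrom-⊑ 0 ss⊑ts

      occurrencesFrom-⊑ : ∀ {n} {ss ts : Vec T♯ n} i → ss ⊑ⱽ ts →
        Pointwise _≤ᵃ_ (occurrencesFrom i ss) (occurrencesFrom i ts)
      occurrencesFrom-⊑ i []            = []
      occurrencesFrom-⊑ i (s⊑t ∷ ss⊑ts) = Pointwise.++⁺
        (Pointwise.map⁺ _ _ (Pointwise.map (λ (eq , ≤a) → cong (i ∷_) eq , ≤a) (occurrences-⊑ s⊑t)))
        (occurrencesFrom-⊑ (suc i) ss⊑ts)

    filterᵇ-⊆ : ∀ {xs ys} → Pointwise _≤ᵃ_ xs ys →
      map proj₁ (filterᵇ (isAnnotated ∘ proj₂) xs) ⊆ map proj₁ (filterᵇ (isAnnotated ∘ proj₂) ys)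
    filterᵇ-⊆ [] ()
    filterᵇ-⊆ {(_ , s) ∷ _} {(_ , t) ∷ _} ((refl , ≤a) ∷ pw) π∈ with isAnnotated s | isAnnotated t
    filterᵇ-⊆ ((refl , ≤a) ∷ pw) (here refl) | true  | true  = here refl
    filterᵇ-⊆ ((refl , ≤a) ∷ pw) (there π∈)  | true  | true  = there (filterᵇ-⊆ pw π∈)
    filterᵇ-⊆ ((refl , ≤a) ∷ pw) π∈          | true  | false = contradiction (≤a refl) λ ()
    filterᵇ-⊆ ((refl , ≤a) ∷ pw) π∈          | false | true  = there (filterᵇ-⊆ pw π∈)
    filterᵇ-⊆ ((refl , ≤a) ∷ pw) π∈          | false | false = filterᵇ-⊆ pw π∈

  annotatedPositions-⊑ : ∀ {s t} → s ⊑ t → annotatedPositions s ⊆ annotatedPositions t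
  annotatedPositions-⊑ s⊑t = filterᵇ-⊆ (occurrences-⊑ s⊑t)

  Ψ-⊑ : ∀ ℓ φ {u v} → u ⊑ v → Ψ ℓ φ u ⊆ Ψ ℓ φ v
  Ψ-⊑ ℓ φ {u} {v} u⊑v = go (variablePositions ℓ)
    where
    image : T♯ → Position → List Position
    image u ρ = maybe′ (λ ρ′ → map (ρ′ ++_) (maybe′ annotatedPositions [] (u ∣ ρ))) [] (φ ρ)
    image-⊆ : ∀ ρ → image u ρ ⊆ image v ρ
    image-⊆ ρ with φ ρ
    ... | nothing = id
    ... | just ρ′ with u ∣ ρ in eq
    ...   | nothing = λ ()
    ...   | just u′ with ⊑-∣ ρ u⊑v eq
    ...     | v′ , eq′ , u′⊑v′ rewrite eq′ = ⊆.map⁺ (ρ′ ++_) (annotatedPositions-⊑ u′⊑v′)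
    go : ∀ ρs → concatMap (image u) ρs ⊆ concatMap (image v) ρs
    go []       = id
    go (ρ ∷ ρs) = ⊆.++⁺ (image-⊆ ρ) (go ρs)

-- Erasing annotations in right-hand sides

module _ where

  open ≡ using (refl; sym; trans; cong; cong₂; subst)

  lookup-map : ∀ {a b} {A : Set a} {B : Set b} (f : A → B) xs i →
    lookup (map f xs) i ≡ f (lookup xs (cast (List.length-map f xs) i))
  lookup-map f (x ∷ xs) zero    = refl
  lookup-map f (x ∷ xs) (suc i) = lookup-map f xs i

  tabulate-cast : ∀ {a b r} {A : Set a} {B : Set b} {R : A → B → Set r} {m n} (eq : m ≡ n)
    {f : Fin m → A} {g : Fin n → B} → (∀ i → R (f i) (g (cast eq i))) → Pointwise R (tabulate f) (tabulate g)
  tabulate-cast {R = R} refl {f} {g} h = Pointwise.tabulate⁺ λ i → subst (λ j → R (f i) (g j)) (cast-is-id refl i) (h i)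

module Erasure {c ℓ₁ ℓ₂ : Level} (K : ArchimedeanOrderedField c ℓ₁ ℓ₂)
  (Sig : Signature) (V : Set) (D : Subset (Signature.size Sig)) where

  open ≡ using (refl; sym; trans; cong; cong₂; subst)
  open ADPFramework K Sig V D
  open Annotations K Sig V D
  open AnnotationOrder K Sig V D
  open Simulation K Sig V D

  infix 4 _≼_

  -- Common form of an ADP that is kept and one that is erased. Outcomes are indexed by lengths that
  -- agree only propositionally, as erasing maps over `rhs`; hence the translations `κ` and `ι`.
  record _≼_ (β α : ADP) : Set c where
    field
      lhs≡    : lhs β ≡ lhs α
      flag≡   : flag β ≡ flag α
      length≡ : length (rhs β) ≡ length (rhs α)

    κ : Outcome β → Outcome α
    κ = cast length≡

    ι : Outcome α → Outcome β
    ι = cast (sym length≡)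

    field
      p≡ : ∀ i → p β i ≡ p α (κ i)
      r⊑ : ∀ i → r β i ⊑ r α (κ i)

    ι∘κ : ∀ i → ι (κ i) ≡ i
    ι∘κ = cast-involutive (sym length≡) length≡

    κ∘ι : ∀ j → κ (ι j) ≡ j
    κ∘ι = cast-involutive length≡ (sym length≡)

    distribution-≼ : ∀ {R : T♯ → T♯ → Set} {t : Outcome β → T♯} {t′ : Outcome α → T♯} →
      (∀ i → R (t i) (t′ (κ i))) →
      Pointwise (λ (q , u) (q′ , u′) → q ≡ q′ × R u u′) (distribution β t) (distribution α t′)
    distribution-≼ h = tabulate-cast length≡ λ i → p≡ i , h i

  ≼-refl : ∀ α → α ≼ α
  ≼-refl α = record
    { lhs≡ = refl ; flag≡ = refl ; length≡ = refl
    ; p≡ = λ i → cong (p α) (sym (cast-is-id refl i))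
    ; r⊑ = λ i → subst (λ j → r α i ⊑ r α j) (sym (cast-is-id refl i)) (⊑-refl (r α i))
    }

  ♭ᴬ-≼ : ∀ α → ♭ᴬ α ≼ α
  ♭ᴬ-≼ α = record
    { lhs≡ = refl ; flag≡ = refl ; length≡ = List.length-map _ (rhs α)
    ; p≡ = λ i → cong proj₁ (lookup-map _ (rhs α) i)
    ; r⊑ = λ i → subst (_⊑ r α (cast _ i)) (sym (cong proj₂ (lookup-map _ (rhs α) i))) (⌈♭⌉-⊑ _)
    }

  ⊑-∣-var : ∀ {s t} π {x} → s ⊑ t → s ∣ π ≡ just (var x) → t ∣ π ≡ just (var x)
  ⊑-∣-var π s⊑t eq with ⊑-∣ π s⊑t eq
  ... | _ , eq′ , var = eq′

  -- That `π` is a position of `s` at all follows from `♭ s ≡ ♭ t`; the rest is inversion of `⊑` at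
  -- a variable.
  ⊒-∣-var : ∀ {s t} π {x} → s ⊑ t → t ∣ π ≡ just (var x) → s ∣ π ≡ just (var x)
  ⊒-∣-var {s} {t} π s⊑t eq with s ∣ π in at-s
  ... | just u with ⊑-∣ π s⊑t at-s
  ...   | _ , at-t , u⊑v with trans (sym at-t) eq
  ⊒-∣-var π s⊑t eq | just u | _ , at-t , var | refl = refl
  ⊒-∣-var {s} {t} π s⊑t eq | nothing with trans (sym (cong (Maybe.map ♭) at-s)) (trans (sym (♭-∣ s π))
    (trans (cong (_∣ π) (⊑⇒♭≡ s⊑t)) (trans (♭-∣ t π) (cong (Maybe.map ♭) eq))))
  ... | ()

  module _ {P′ P : ADPProblem} (extend : ∀ {β} → β ∈ P′ → ∃ λ α → α ∈ P × β ≼ α) where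

    private
      module Extend {s t} (R : Redex P′ s) (s⊑t : s ⊑ t) where

        open Redex R using (σ; π) renaming (α to β; u to u′) public

        α : ADP
        α = proj₁ (extend (Redex.α∈P R))

        open _≼_ (proj₂ (proj₂ (extend (Redex.α∈P R)))) public

        u : T♯
        u = proj₁ (⊑-∣ π s⊑t (Redex.s∣π R))

        u′⊑u : u′ ⊑ u
        u′⊑u = proj₂ (proj₂ (⊑-∣ π s⊑t (Redex.s∣π R)))

        redex : Redex P t
        redex = record
          { α         = α
          ; α∈P       = proj₁ (proj₂ (extend (Redex.α∈P R)))
          ; σ         = σ
          ; π         = π
          ; u         = u
          ; s∣π       = proj₁ (proj₂ (⊑-∣ π s⊑t (Redex.s∣π R)))
          ; u-defined = trans (sym (⊑-isDefined u′⊑u)) (Redex.u-defined R)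
          ; matches   = trans (sym (⊑⇒♭≡ u′⊑u)) (trans (Redex.matches R) (cong (_⟨ σ ⟩) lhs≡))
          }

        annotated : isAnnotated u′ ≡ true → isAnnotated u ≡ true
        annotated = ⊑-isAnnotated u′⊑u

        flagged : ∀ {b} → flag β ≡ b → flag α ≡ b
        flagged = trans (sym flag≡)

        module _ (φ : Repositioning β) (vrf : IsVRF β φ) where

          φ⁺ : Repositioning α
          φ⁺ = φ ∘ ι

          vrf⁺ : IsVRF α φ⁺
          vrf⁺ j ρ ρ′ ρ∈ eq =
            let x , at-ρ , at-ρ′ = vrf (ι j) ρ ρ′ (subst (λ ℓ → ρ ∈ variablePositions ℓ) (sym lhs≡) ρ∈) eq
            in x , subst (λ ℓ → ℓ ∣ ρ ≡ just (var x)) lhs≡ at-ρ ,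
               subst (λ j → r α j ∣ ρ′ ≡ just (var x)) (κ∘ι j) (⊑-∣-var ρ′ (r⊑ (ι j)) at-ρ′)

          Ψ⊆ : ∀ i → Ψ (lhs β) (φ i) u′ ⊆ Ψ (lhs α) (φ⁺ (κ i)) u
          Ψ⊆ i = subst (λ ℓ → Ψ (lhs β) (φ i) u′ ⊆ Ψ ℓ (φ⁺ (κ i)) u) lhs≡
            (subst (λ k → Ψ (lhs β) (φ i) u′ ⊆ Ψ (lhs β) (φ k) u) (sym (ι∘κ i)) (Ψ-⊑ (lhs β) (φ i) u′⊑u))

          Φ⊆ : ∀ i → Φ (lhs β) (r β i) (φ i) u′ ⊆ Φ (lhs α) (r α (κ i)) (φ⁺ (κ i)) u
          Φ⊆ i = ⊆.++⁺ (annotatedPositions-⊑ (r⊑ i)) (Ψ⊆ i)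

          contractum-⊑ : ∀ i {L L′} → L ⊆ L′ →
            s [ #[ L ] (r β i ⟨ σ ⟩♯) ]at π ⊑ t [ #[ L′ ] (r α (κ i) ⟨ σ ⟩♯) ]at π
          contractum-⊑ i L⊆L′ = []at-⊑ π s⊑t (#-⊑ L⊆L′ (subst-⊑ σ (r⊑ i)))

        innermost-⊑ : ∀ i → s [ r β i ⟨ σ ⟩♯ ]at π ⊑ t [ r α (κ i) ⟨ σ ⟩♯ ]at π
        innermost-⊑ i = []at-⊑ π s⊑t (subst-⊑ σ (r⊑ i))

        ♭r⊑r : ∀ i → ⌈ ♭ (r β i) ⌉ ⊑ r α (κ i)
        ♭r⊑r i = subst (λ u → ⌈ u ⌉ ⊑ r α (κ i)) (sym (⊑⇒♭≡ (r⊑ i))) (⌈♭⌉-⊑ (r α (κ i)))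

        erased-⊑ : ∀ i → s [ ⌈ ♭ (r β i) ⌉ ⟨ σ ⟩♯ ]at π ⊑ t [ r α (κ i) ⟨ σ ⟩♯ ]at π
        erased-⊑ i = []at-⊑ π s⊑t (subst-⊑ σ (♭r⊑r i))

        erased-erased-⊑ : ∀ i → s [ ⌈ ♭ (r β i) ⌉ ⟨ σ ⟩♯ ]at π ⊑ t [ ⌈ ♭ (r α (κ i)) ⌉ ⟨ σ ⟩♯ ]at π
        erased-erased-⊑ i = []at-⊑ π s⊑t (subst-⊑ σ (subst (λ u → ⌈ ♭ (r β i) ⌉ ⊑ ⌈ u ⌉) (⊑⇒♭≡ (r⊑ i)) (⊑-refl _)))

    -- The redex may be annotated in `t` although it is not in `s`. Then (nt) is simulated by (at),
    -- whose set `Φ` contains `Ψ`.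
    ↪-simulates : Simulates _⊑_ (P′ ⊢_↪[_]_) (P ⊢_↪[_]_)
    ↪-simulates s⊑t (at R φ vrf ann fl) = true , _ ,
      at redex (φ⁺ φ vrf) (vrf⁺ φ vrf) (annotated ann) (flagged fl) , id ,
      distribution-≼ λ i → contractum-⊑ φ vrf i (Φ⊆ φ vrf i)
      where open Extend R s⊑t
    ↪-simulates s⊑t (af R φ vrf ann fl) = true , _ ,
      af redex (φ⁺ φ vrf) (vrf⁺ φ vrf) (annotated ann) (flagged fl) , id ,
      distribution-≼ λ i → ♭↑-⊑ π (contractum-⊑ φ vrf i (Φ⊆ φ vrf i))
      where open Extend R s⊑t
    ↪-simulates s⊑t (nt R φ vrf ann fl) with isAnnotated (Extend.u R s⊑t) in eq
    ... | true = true , _ , at redex (φ⁺ φ vrf) (vrf⁺ φ vrf) eq (flagged fl) , (λ ()) ,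
      distribution-≼ λ i → contractum-⊑ φ vrf i (⊆.⊆-trans (Ψ⊆ φ vrf i) (⊆.xs⊆ys++xs _ (annotatedPositions (r α (κ i)))))
      where open Extend R s⊑t
    ... | false = false , _ , nt redex (φ⁺ φ vrf) (vrf⁺ φ vrf) eq (flagged fl) , (λ ()) ,
      distribution-≼ λ i → contractum-⊑ φ vrf i (Ψ⊆ φ vrf i)
      where open Extend R s⊑t

    module _ (restrict : ∀ {α} → α ∈ P → ∃ λ β → β ∈ P′ × lhs β ≡ lhs α) where

      -- `ANF` mentions left-hand sides only, and each of those in `P` also occurs in `P′`.
      ANF-⊆ : ∀ {t} → ANF P′ t → ANF P t
      ANF-⊆ anf π t′ π≢[] at-π α α∈P σ eq =
        let β , β∈P′ , lhs≡ = restrict α∈P in anf π t′ π≢[] at-π β β∈P′ σ (trans (cong (_⟨ σ ⟩) lhs≡) eq)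

      -- If the redex is annotated only in `t`, then (nt) becomes (at) and (nf) becomes (af): the
      -- contractum gains annotations, and in the latter case both sides erase those above.
      ↪ⁱ-simulates : Simulates _⊑_ (P′ ⊢_↪ⁱ[_]_) (P ⊢_↪ⁱ[_]_)
      ↪ⁱ-simulates s⊑t (at R anf ann fl) = true , _ ,
        at redex (ANF-⊆ (subst (λ ℓ → ANF P′ (ℓ ⟨ σ ⟩)) lhs≡ anf)) (annotated ann) (flagged fl) , id ,
        distribution-≼ innermost-⊑
        where open Extend R s⊑t
      ↪ⁱ-simulates s⊑t (af R anf ann fl) = true , _ ,
        af redex (ANF-⊆ (subst (λ ℓ → ANF P′ (ℓ ⟨ σ ⟩)) lhs≡ anf)) (annotated ann) (flagged fl) , id ,
        distribution-≼ λ i → ♭↑-⊑ π (innermost-⊑ i)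
        where open Extend R s⊑t
      ↪ⁱ-simulates s⊑t (nt R anf ann fl) with isAnnotated (Extend.u R s⊑t) in eq
      ... | true = true , _ ,
        at redex (ANF-⊆ (subst (λ ℓ → ANF P′ (ℓ ⟨ σ ⟩)) lhs≡ anf)) eq (flagged fl) , (λ ()) , distribution-≼ erased-⊑
        where open Extend R s⊑t
      ... | false = false , _ ,
        nt redex (ANF-⊆ (subst (λ ℓ → ANF P′ (ℓ ⟨ σ ⟩)) lhs≡ anf)) eq (flagged fl) , (λ ()) , distribution-≼ erased-erased-⊑
        where open Extend R s⊑t
      ↪ⁱ-simulates s⊑t (nf R anf ann fl) with isAnnotated (Extend.u R s⊑t) in eq
      ... | true = true , _ ,
        af redex (ANF-⊆ (subst (λ ℓ → ANF P′ (ℓ ⟨ σ ⟩)) lhs≡ anf)) eq (flagged fl) , (λ ()) ,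
        distribution-≼ λ i → ♭↑-⊑ π (erased-⊑ i)
        where open Extend R s⊑t
      ... | false = false , _ ,
        nf redex (ANF-⊆ (subst (λ ℓ → ANF P′ (ℓ ⟨ σ ⟩)) lhs≡ anf)) eq (flagged fl) , (λ ()) ,
        distribution-≼ λ i → ♭↑-⊑ π (erased-erased-⊑ i)
        where open Extend R s⊑t

-- Soundness and completeness of the processor

module ReductionPair {c ℓ₁ ℓ₂ : Level} (K : ArchimedeanOrderedField c ℓ₁ ℓ₂)
  (Sig : Signature) (V : Set) (D : Subset (Signature.size Sig)) where

  open ≡ using (refl; sym; trans; cong; cong₂; subst)
  open OrderedFieldProperties K using (Carrier; 0#; _≤_; _<_; fromℕ)
  open ADPFramework K Sig V D
  open Annotations K Sig V D
  open AnnotationOrder K Sig V D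
  open ChainTrees K Sig V D
  open CutSoundness K Sig V D
  open StepBounds K Sig V D
  open Expectations K Sig V D
  open Erasure K Sig V D
  open Simulation K Sig V D

  module _ (P≥ P> : ADPProblem) where

    P P′ : ADPProblem
    P  = P≥ ++ P>
    P′ = P≥ ++ ♭ᴾ P>

    extend : ∀ {β} → β ∈ P′ → ∃ λ α → α ∈ P × β ≼ α
    extend {β} β∈P′ with ∈.∈-++⁻ P≥ β∈P′
    ... | inj₁ β∈P≥ = β , ∈.∈-++⁺ˡ β∈P≥ , ≼-refl β
    ... | inj₂ β∈♭P> with ∈.∈-map⁻ ♭ᴬ β∈♭P>
    ...   | α , α∈P> , refl = α , ∈.∈-++⁺ʳ P≥ α∈P> , ♭ᴬ-≼ α

    restrict : ∀ {α} → α ∈ P → ∃ λ β → β ∈ P′ × lhs β ≡ lhs α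
    restrict {α} α∈P with ∈.∈-++⁻ P≥ α∈P
    ... | inj₁ α∈P≥ = α , ∈.∈-++⁺ˡ α∈P≥ , refl
    ... | inj₂ α∈P> = ♭ᴬ α , ∈.∈-++⁺ʳ P≥ (∈.∈-map⁺ ♭ᴬ α∈P>) , refl

    private
      ANF-erase : ∀ {t} → ANF P t → ANF P′ t
      ANF-erase anf π t′ π≢[] at-π β β∈P′ σ eq =
        let α , α∈P , β≼α = extend β∈P′
        in anf π t′ π≢[] at-π α α∈P σ (trans (cong (_⟨ σ ⟩) (sym (_≼_.lhs≡ β≼α))) eq)

      keep : ∀ {s} (R : Redex P s) → Redex.α R ∈ P≥ → Redex P′ s
      keep R α∈P≥ = record { Redex R ; α∈P = ∈.∈-++⁺ˡ α∈P≥ }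

      erase : ∀ {s} (R : Redex P s) → Redex.α R ∈ P> → Redex P′ s
      erase R α∈P> = record
        { α = ♭ᴬ (Redex.α R) ; α∈P = ∈.∈-++⁺ʳ P≥ (∈.∈-map⁺ ♭ᴬ α∈P>)
        ; σ = Redex.σ R ; π = Redex.π R ; u = Redex.u R ; s∣π = Redex.s∣π R
        ; u-defined = Redex.u-defined R ; matches = Redex.matches R }

      module _ (α : ADP) where

        open _≼_ (♭ᴬ-≼ α)

        ♭-♭ᴬ : ∀ i → ♭ (r (♭ᴬ α) i) ≡ ♭ (r α (κ i))
        ♭-♭ᴬ i = ⊑⇒♭≡ (r⊑ i)

        distribution-♭ᴬ : ∀ {t t′} → (∀ i → t i ≡ t′ (κ i)) → distribution (♭ᴬ α) t ≡ distribution α t′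
        distribution-♭ᴬ h = Pointwise.Pointwise-≡⇒≡ (Pointwise.map (λ (eq , eq′) → cong₂ _,_ eq eq′) (distribution-≼ h))

        vrf-♭ᴬ : ∀ {φ} → IsVRF α φ → IsVRF (♭ᴬ α) (φ ∘ κ)
        vrf-♭ᴬ vrf i ρ ρ′ ρ∈ eq =
          let x , at-ρ , at-ρ′ = vrf (κ i) ρ ρ′ ρ∈ eq in x , at-ρ , ⊒-∣-var ρ′ (r⊑ i) at-ρ′

      -- An (nt) step annotates exactly the positions in `Ψ`, which stem from the redex; the
      -- annotations of `r α j` are overwritten in any case.
      ♭ᴬ-nt : ∀ {s} (R : Redex P s) → let open Redex R in α ∈ P> → (φ : Repositioning α) → IsVRF α φ →
        isAnnotated u ≡ false → flag α ≡ true →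
        P′ ⊢ s ↪[ false ] distribution α λ j → s [ #[ Ψ (lhs α) (φ j) u ] (r α j ⟨ σ ⟩♯) ]at π
      ♭ᴬ-nt {s} R α∈P> φ vrf ann fl = subst (P′ ⊢ s ↪[ false ]_)
        (distribution-♭ᴬ α λ i → cong (λ w → s [ w ]at π) (annotate-cong-♭ _
          (trans (♭-subst (r (♭ᴬ α) i) σ) (trans (cong (_⟨ σ ⟩) (♭-♭ᴬ α i)) (sym (♭-subst (r α _) σ))))))
        (nt (erase R α∈P>) _ (vrf-♭ᴬ α vrf) ann fl)
        where open Redex R

      -- The innermost (nt) step applies `♭` to the right-hand side itself, so erasing it beforehand
      -- changes nothing.
      ♭ᴬ-ntⁱ : ∀ {s} (R : Redex P s) → let open Redex R in α ∈ P> → ANF P (lhs α ⟨ σ ⟩) →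
        isAnnotated u ≡ false → flag α ≡ true →
        P′ ⊢ s ↪ⁱ[ false ] distribution α λ j → s [ ⌈ ♭ (r α j) ⌉ ⟨ σ ⟩♯ ]at π
      ♭ᴬ-ntⁱ {s} R α∈P> anf ann fl = subst (P′ ⊢ s ↪ⁱ[ false ]_)
        (distribution-♭ᴬ α λ i → cong (λ u → s [ ⌈ u ⌉ ⟨ σ ⟩♯ ]at π) (♭-♭ᴬ α i))
        (nt (erase R α∈P>) (ANF-erase anf) ann fl)
        where open Redex R

      ♭ᴬ-nfⁱ : ∀ {s} (R : Redex P s) → let open Redex R in α ∈ P> → ANF P (lhs α ⟨ σ ⟩) →
        isAnnotated u ≡ false → flag α ≡ false →
        P′ ⊢ s ↪ⁱ[ false ] distribution α λ j → ♭↑ π (s [ ⌈ ♭ (r α j) ⌉ ⟨ σ ⟩♯ ]at π)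
      ♭ᴬ-nfⁱ {s} R α∈P> anf ann fl = subst (P′ ⊢ s ↪ⁱ[ false ]_)
        (distribution-♭ᴬ α λ i → cong (λ u → ♭↑ π (s [ ⌈ u ⌉ ⟨ σ ⟩♯ ]at π)) (♭-♭ᴬ α i))
        (nf (erase R α∈P>) (ANF-erase anf) ann fl)
        where open Redex R

    AST-complete : AST P → AST P′
    AST-complete = simulation-converges ⊑-refl (↪-simulates extend)

    iAST-complete : iAST P → iAST P′
    iAST-complete = simulation-converges ⊑-refl (↪ⁱ-simulates extend restrict)

    module _ (Pol : PolynomialInterpretation) (multilinear : Multilinear Pol) (isP : IsADPProblem P)
      (𝔼S≤ : ∀ α → α ∈ P → ∀ x → expectation α (λ t → Sum Pol t x) ≤ fromℕ (value Pol (lhs α ♯) x))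
      (decrease : ∀ α → α ∈ P> → ∃ λ j →
        (∀ x → value Pol (lhs α ♯) x > Sum Pol (r α j) x) ×
        (flag α ≡ true → ∀ x → value Pol ⌈ lhs α ⌉ x ≥ value Pol ⌈ ♭ (r α j) ⌉ x))
      (𝔼val≤ : ∀ α → α ∈ P → flag α ≡ true → ∀ x →
        expectation α (λ t → value Pol ⌈ ♭ t ⌉ x) ≤ fromℕ (value Pol ⌈ lhs α ⌉ x))
      where

      private
        -- Any fixed valuation would serve, since the conditions on the ADPs hold for all of them.
        origin : Valuation
        origin = const 0

        X : T♯ → ℕ
        X t = Sum Pol t origin

        q₀ : Carrier
        q₀ = proj₁ (minimal-probability isP)

        0<q₀ : 0# < q₀
        0<q₀ = proj₁ (proj₂ (minimal-probability isP))

        Decreasing : T♯ → MultiDistribution T♯ → Set _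
        Decreasing s = Any (λ (q , t) → q₀ ≤ q × X t ℕ.< X s)

        Bounded : T♯ → Bool → MultiDistribution T♯ → Set c
        Bounded = BoundedStep Pol multilinear origin P

        proper : ∀ {s b μ} → Bounded s b μ → Proper μ
        proper record { α∈P = α∈P ; t = t ; μ≡ = refl } = distribution-proper (All.lookup isP α∈P) t

        probabilities-≤1 : ∀ {s b μ} → Bounded s b μ → All (λ (q , _) → q ≤ _) μ
        probabilities-≤1 record { α∈P = α∈P ; μ≡ = refl } = All.tabulate⁺ (IsADP.p-≤1 (All.lookup isP α∈P))

        supermartingale : ∀ {s b μ} → Bounded s b μ → 𝔼 μ (fromℕ ∘ X) ≤ fromℕ (X s)
        supermartingale record { α = α ; α∈P = α∈P ; μ≡ = refl ; bound = bound } =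
          StepBound-supermartingale Pol multilinear origin (All.lookup isP α∈P) (𝔼S≤ α α∈P) (𝔼val≤ α α∈P) bound

        decreasing : ∀ {α s t} → α ∈ P> → StepBound Pol multilinear origin α s t true → Decreasing s (distribution α t)
        decreasing α∈P> = StepBound-decreasing Pol multilinear origin
          (All.lookup (proj₂ (proj₂ (minimal-probability isP))) (∈.∈-++⁺ʳ P≥ α∈P>)) (decrease _ α∈P>)

        -- The strict steps are exactly the annotated ones with an ADP of `P>`, up to ADPs that also
        -- lie in `P≥`; all others survive the erasure unchanged.
        classify : ∀ {s b μ} → P ⊢ s ↪[ b ] μ → (P′ ⊢ s ↪[ b ] μ) ⊎ Decreasing s μ
        classify (at R φ vrf ann fl) with ∈.∈-++⁻ P≥ (Redex.α∈P R)
        ... | inj₁ α∈P≥ = inj₁ (at (keep R α∈P≥) φ vrf ann fl)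
        ... | inj₂ α∈P> = inj₂ (decreasing α∈P> (Full.at-bound Pol multilinear origin isP R φ vrf ann fl))
        classify (af R φ vrf ann fl) with ∈.∈-++⁻ P≥ (Redex.α∈P R)
        ... | inj₁ α∈P≥ = inj₁ (af (keep R α∈P≥) φ vrf ann fl)
        ... | inj₂ α∈P> = inj₂ (decreasing α∈P> (Full.af-bound Pol multilinear origin isP R φ vrf ann))
        classify (nt R φ vrf ann fl) with ∈.∈-++⁻ P≥ (Redex.α∈P R)
        ... | inj₁ α∈P≥ = inj₁ (nt (keep R α∈P≥) φ vrf ann fl)
        ... | inj₂ α∈P> = inj₁ (♭ᴬ-nt R α∈P> φ vrf ann fl)

        classifyⁱ : ∀ {s b μ} → P ⊢ s ↪ⁱ[ b ] μ → (P′ ⊢ s ↪ⁱ[ b ] μ) ⊎ Decreasing s μ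
        classifyⁱ (at R anf ann fl) with ∈.∈-++⁻ P≥ (Redex.α∈P R)
        ... | inj₁ α∈P≥ = inj₁ (at (keep R α∈P≥) (ANF-erase anf) ann fl)
        ... | inj₂ α∈P> = inj₂ (decreasing α∈P> (Innermost.at-bound Pol multilinear origin isP R ann fl))
        classifyⁱ (af R anf ann fl) with ∈.∈-++⁻ P≥ (Redex.α∈P R)
        ... | inj₁ α∈P≥ = inj₁ (af (keep R α∈P≥) (ANF-erase anf) ann fl)
        ... | inj₂ α∈P> = inj₂ (decreasing α∈P> (Innermost.af-bound Pol multilinear origin isP R ann))
        classifyⁱ (nt R anf ann fl) with ∈.∈-++⁻ P≥ (Redex.α∈P R)
        ... | inj₁ α∈P≥ = inj₁ (nt (keep R α∈P≥) (ANF-erase anf) ann fl)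
        ... | inj₂ α∈P> = inj₁ (♭ᴬ-ntⁱ R α∈P> anf ann fl)
        classifyⁱ (nf R anf ann fl) with ∈.∈-++⁻ P≥ (Redex.α∈P R)
        ... | inj₁ α∈P≥ = inj₁ (nf (keep R α∈P≥) (ANF-erase anf) ann fl)
        ... | inj₂ α∈P> = inj₁ (♭ᴬ-nfⁱ R α∈P> anf ann fl)

      AST-sound : AST P′ → AST P
      AST-sound = converges X q₀ 0<q₀ (proper ∘ full) (probabilities-≤1 ∘ full) (supermartingale ∘ full) classify
        where
        full : ∀ {s b μ} → P ⊢ s ↪[ b ] μ → Bounded s b μ
        full = ↪-bound Pol multilinear origin isP

      iAST-sound : iAST P′ → iAST P
      iAST-sound =
        converges X q₀ 0<q₀ (proper ∘ innermost) (probabilities-≤1 ∘ innermost) (supermartingale ∘ innermost) classifyⁱ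
        where
        innermost : ∀ {s b μ} → P ⊢ s ↪ⁱ[ b ] μ → Bounded s b μ
        innermost = ↪ⁱ-bound Pol multilinear origin isP

theorem36 :
    ∀ {c ℓ₁ ℓ₂ : Level} (K : ArchimedeanOrderedField c ℓ₁ ℓ₂)
    (Sig : Signature) (V : Set) (D : Subset (Signature.size Sig)) →
    let open ArchimedeanOrderedField K
        open ADPFramework K Sig V D
    in
    (Pol : PolynomialInterpretation) → Multilinear Pol →
    (P≥ P> : ADPProblem) →
    IsADPProblem (P≥ ++ P>) → DefinedSymbolsOf (P≥ ++ P>) →
    Disjoint P≥ P> → P> ≢ [] →
    (∀ α → α ∈ P≥ ++ P> → ∀ x →
      expectation α (λ t → Sum Pol t x) ≤ fromℕ (value Pol (lhs α ♯) x)) →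
    (∀ α → α ∈ P> → ∃ λ j →
      (∀ x → value Pol (lhs α ♯) x > Sum Pol (r α j) x) ×
      (flag α ≡ true → ∀ x → value Pol ⌈ lhs α ⌉ x ≥ value Pol ⌈ ♭ (r α j) ⌉ x)) →
    (∀ α → α ∈ P≥ ++ P> → flag α ≡ true → ∀ x →
      expectation α (λ t → value Pol ⌈ ♭ t ⌉ x) ≤ fromℕ (value Pol ⌈ lhs α ⌉ x)) →
    (Sound iAST (P≥ ++ P>) (Proc-RP P≥ P>) × Complete iAST (P≥ ++ P>) (Proc-RP P≥ P>)) ×
    (Sound AST (P≥ ++ P>) (Proc-RP P≥ P>) × Complete AST (P≥ ++ P>) (Proc-RP P≥ P>))
theorem36 K Sig V D Pol multilinear P≥ P> isP _ _ _ 𝔼S≤ decrease 𝔼val≤ =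
  ((λ { (iast ∷ []) → iAST-sound P≥ P> Pol multilinear isP 𝔼S≤ decrease 𝔼val≤ iast }) ,
   (λ iast → iAST-complete P≥ P> iast ∷ [])) ,
  ((λ { (ast ∷ []) → AST-sound P≥ P> Pol multilinear isP 𝔼S≤ decrease 𝔼val≤ ast }) ,
   (λ ast → AST-complete P≥ P> ast ∷ []))
  where open ReductionPair K Sig V D
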